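{- Let $k\geq t+2\geq 4$ and let $\mathcal{F},\mathcal{G}\subseteq\binom{[n]}{k}$ be cross $t$-intersecting with $\left|\bigcap_{F\in\mathcal{F}\cup\mathcal{G}}F\right|<t$. If $n\geq t+(k-t)\cdot\max\{30(t+2),\,2ek\}$, then $$\min\{|\mathcal{F}|,|\mathcal{G}|\}\leq\max\{|\mathcal{A}(n,k,t)|,|\mathcal{H}(n,k,t)|\}.$$ Moreover, if equality holds, then either (i) there exist $X\in\binom{[n]}{t}$ and $K,L\in\binom{[n]}{k+1}$ with $X\subseteq K\cap L$ and $|K\cap L|\geq t+2$ such that $\mathcal{F}=\mathcal{H}(X,K,L)$ and $\mathcal{G}=\mathcal{H}(X,L,K)$, or (ii) there exists $Z\in\binom{[n]}{t+2}$ such that $\mathcal{F}=\mathcal{G}=\mathcal{A}(Z)$.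
   Context: $n,k,t$ are positive integers, $[n]=\{1,\dots,n\}$, $[i,j]=\{i,i+1,\dots,j\}$, $\binom{[n]}{k}$ is the family of all $k$-subsets of $[n]$, and $e$ is the base of the natural logarithm. Families $\mathcal{F},\mathcal{G}$ are cross $t$-intersecting if $|F\cap G|\ge t$ for all $F\in\mathcal{F}$, $G\in\mathcal{G}$. For $Z\in\binom{[n]}{t+2}$, $\mathcal{A}(Z)=\{F\in\binom{[n]}{k}:|F\cap Z|\geq t+1\}$, and $\mathcal{A}(n,k,t)=\mathcal{A}([t+2])$. For $X\in\binom{[n]}{t}$ and $K,L\in\binom{[n]}{k+1}$ with $X\subseteq K\cap L$, $$\mathcal{H}(X,K,L)=\left\{F\in\binom{[n]}{k}:X\subseteq F,\ F\cap(L\setminus X)\neq\emptyset\right\}\cup\{K\setminus\{x\}:x\in X\},$$ and $\mathcal{H}(n,k,t)=\mathcal{H}([t],[k+1],[k+1])=\{F\in\binom{[n]}{k}:[t]\subseteq F,\ F\cap[t+1,k+1]\neq\emptyset\}\cup\{[k+1]\setminus\{i\}:i\in[t]\}$. -}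

module Defs where

open import Data.Bool.Properties using () renaming (_≟_ to _≟ᵇ_)
open import Data.Fin.Base using (Fin; toℕ)
open import Data.Fin.Properties using (any?)
open import Data.Fin.Subset
open import Data.Fin.Subset.Properties using (_∈?_; _⊆?_; nonempty?)
open import Data.Integer.Base using (+_)
open import Data.List.Base using (List; []; _∷_; _++_; map; filter; length)
open import Data.Nat.Base using (ℕ; zero; suc; _!; _∸_; _<ᵇ_; _≤_)
import Data.Nat.Base as ℕ
open import Data.Nat.Properties using (_≟_; _≤?_; _!≢0)
open import Data.Product.Base using (∃; _×_)
open import Data.Rational.Base using (ℚ; _/_; 1ℚ; _+_; _*_; _⊔_)
import Data.Rational.Base as ℚ
open import Data.Vec.Base using ([]; _∷_; tabulate)
open import Data.Vec.Properties using (≡-dec)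
open import Level using (0ℓ)
open import Relation.Binary.PropositionalEquality using (_≡_)
open import Relation.Nullary.Decidable using (_×-dec_)
open import Relation.Unary using (Pred; Decidable)
import Relation.Unary as U
open import Relation.Unary.Properties using (_∪?_)

private
  variable
    n : ℕ

-- The ground set {1,…,n} is Fin n, so the number i is the element of Fin n
-- whose toℕ is i - 1.  Families are predicates; those whose members are
-- counted or intersected come with a decision procedure.  Equality of
-- families is extensional, as given by _≐_ of Relation.Unary.
Family : ℕ → Set₁
Family n = Pred (Subset n) 0ℓ

-- Every subset of Fin n occurs exactly once.
allSubsets : ∀ n → List (Subset n)
allSubsets zero    = [] ∷ []
allSubsets (suc n) = map (outside ∷_) (allSubsets n) ++ map (inside ∷_) (allSubsets n)

members : {𝓕 : Family n} → Decidable 𝓕 → List (Subset n)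
members 𝓕? = filter 𝓕? (allSubsets _)

card : {𝓕 : Family n} → Decidable 𝓕 → ℕ
card 𝓕? = length (members 𝓕?)

-- The intersection of all members; it is the whole ground set if there are none.
⋂ᶠ : {𝓕 : Family n} → Decidable 𝓕 → Subset n
⋂ᶠ 𝓕? = ⋂ (members 𝓕?)

-- The family of all k-element subsets.
Uniform : ∀ n → ℕ → Family n
Uniform n k F = ∣ F ∣ ≡ k

uniform? : ∀ n k → Decidable (Uniform n k)
uniform? n k F = ∣ F ∣ ≟ k

CrossIntersecting : ℕ → Family n → Family n → Set
CrossIntersecting t 𝓕 𝓖 = ∀ {F G} → 𝓕 F → 𝓖 G → t ≤ ∣ F ∩ G ∣

-- [1,i]; only meaningful for i ≤ n.
initial : ∀ n → ℕ → Subset n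
initial n i = tabulate λ x → toℕ x <ᵇ i

𝓐 : (k t : ℕ) → Subset n → Family n
𝓐 {n} k t Z = Uniform n k U.∩ λ F → t ℕ.+ 1 ≤ ∣ F ∩ Z ∣

𝓐? : (k t : ℕ) (Z : Subset n) → Decidable (𝓐 k t Z)
𝓐? {n} k t Z F = uniform? n k F ×-dec (t ℕ.+ 1 ≤? ∣ F ∩ Z ∣)

Star : (k : ℕ) → Subset n → Subset n → Family n
Star {n} k X L = Uniform n k U.∩ λ F → X ⊆ F × Nonempty (F ∩ (L ─ X))

Deletions : Subset n → Subset n → Family n
Deletions X K F = ∃ λ x → x ∈ X × F ≡ K - x

𝓗 : (k : ℕ) → (X K L : Subset n) → Family n
𝓗 k X K L = Star k X L U.∪ Deletions X K

𝓗? : (k : ℕ) (X K L : Subset n) → Decidable (𝓗 k X K L)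
𝓗? {n} k X K L = star? ∪? deletions?
  where
  star? : Decidable (Star k X L)
  star? F = uniform? n k F ×-dec ((X ⊆? F) ×-dec nonempty? (F ∩ (L ─ X)))

  deletions? : Decidable (Deletions X K)
  deletions? F = any? λ x → (x ∈? X) ×-dec ≡-dec _≟ᵇ_ F (K - x)

∣𝓐[_,_,_]∣ : (n k t : ℕ) → ℕ
∣𝓐[ n , k , t ]∣ = card (𝓐? k t (initial n (t ℕ.+ 2)))

∣𝓗[_,_,_]∣ : (n k t : ℕ) → ℕ
∣𝓗[ n , k , t ]∣ = card (𝓗? k (initial n t) (initial n (k ℕ.+ 1)) (initial n (k ℕ.+ 1)))

fromℕ : ℕ → ℚ
fromℕ m = + m / 1

-- ePartial m = 1/0! + 1/1! + ⋯ + 1/m!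
ePartial : ℕ → ℚ
ePartial zero    = 1ℚ
ePartial (suc m) = ePartial m + (+ 1 / (suc m !)) {{suc m !≢0}}

-- t + (k - t) · max {30 (t + 2), 2 x k}, for t ≤ k.
threshold : (k t : ℕ) → ℚ → ℚ
threshold k t x = fromℕ t + fromℕ (k ∸ t) * (fromℕ (30 ℕ.* (t ℕ.+ 2)) ⊔ fromℕ 2 * x * fromℕ k)

-- n ≥ t + (k - t) · max {30 (t + 2), 2 e k}.  Since e is the supremum of its
-- partial sums and the threshold is a continuous nondecreasing function of x,
-- its value at x = e is the supremum of its values at the partial sums; a number
-- is an upper bound of these values exactly when it is at least that supremum.
AboveThreshold : (n k t : ℕ) → Set
AboveThreshold n k t = ∀ m → threshold k t (ePartial m) ℚ.≤ fromℕ n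

{-# OPTIONS --safe #-}
-- Write N for the number of k-sets containing a given (t + 1)-set and suppose
-- that both families have at least max {|𝓐(n,k,t)|, |𝓗(n,k,t)|} members.
--
-- Peeling: starting from 𝓕 and 𝓖 as families of generators, alternately replace
-- one of them by the smaller sets that t-intersect all members of the other.
-- What is lost are the sets above a minimal such cover of size t + i; it is found
-- by choosing a t-subset of some generator and then branching i times with at
-- most i + 1 choices, so at most C(t+i,t) (i+1)^i C(n-t-i,k-t-i) sets are lost.
-- By the bound on n these numbers decrease geometrically for i ≥ 2, and together
-- they are at most E ≤ (t + 1) N / 5.
--
-- The remaining generators have at most t + 1 elements, and no three (t + 1)-sets
-- suffice to generate either family, because 3 N + E < |𝓐(n,k,t)|.  So all of
-- them contain a common t-set X, or all are (t + 1)-subsets of a (t + 2)-set Z.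
-- In the second case one member outside 𝓐(Z) would make the other family smaller
-- than |𝓐(n,k,t)|.  In the first case every F in 𝓕 not containing X misses exactly
-- one point of X, and all members of 𝓖 containing X meet F ∖ X.  If two such
-- unions F ∪ X differed, this would cost 𝓖 about N members, more than it can
-- have members not containing X, since the latter must hit all members of 𝓕
-- through X.  Hence K = F ∪ X is unique, and so is L = G ∪ X.

module Submission where

open import Data.Bool.Properties using () renaming (_≟_ to _≟ᵇ_)
import Data.Empty as Empty
open import Data.Empty using (⊥-elim)
open import Data.Fin.Base using (Fin; zero; suc)
open import Data.Fin.Properties using () renaming (_≟_ to _≟ᶠ_; any? to any?ᶠ)
open import Data.Fin.Subset.Properties
open import Data.Fin.Subset
import Data.Integer.Base as ℤ
import Data.Integer.Properties as ℤ
open import Data.List.Base using (List; []; _∷_; _++_; map; filter; length)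
open import Data.List.Membership.Propositional using (find; lose) renaming (_∈_ to _∈ˡ_)
open import Data.List.Membership.Propositional.Properties using (∈-filter⁺; ∈-filter⁻; ∈-++⁺ˡ; ∈-++⁺ʳ; ∈-map⁺)
open import Data.List.Properties using (filter-++; length-++; length-map; filter-none)
import Data.List.Relation.Unary.All as All
open import Data.List.Relation.Unary.All using (All; []; _∷_; all?)
import Data.List.Relation.Unary.All.Properties as All
import Data.List.Relation.Unary.Any as Any
open import Data.List.Relation.Unary.Any using (Any; here; there; any?)
import Data.List.Relation.Unary.Any.Properties as Any
open import Data.Nat.Base using (ℕ; zero; suc; _+_; _*_; _∸_; _^_; _≤_; _<_; _⊔_; _⊓_; ⌊_/2⌋; z≤n; s≤s; s≤s⁻¹; NonZero; >-nonZero)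
open import Data.Nat.Combinatorics using (_C_; nCk+nC[k+1]≡[n+1]C[k+1]; nCn≡1; nC1≡n; nCk≡nC[n∸k]; k>n⇒nCk≡0)
open import Data.Nat.ListAction using (sum)
open import Data.Nat.Properties
open import Data.Nat.Tactic.RingSolver using (solve-∀)
open import Data.Product.Base using (_×_; _,_; proj₁; proj₂; ∃-syntax)
import Data.Rational.Base as ℚ
import Data.Rational.Properties as ℚ
import Data.Rational.Unnormalised.Base as ℚᵘ
import Data.Rational.Unnormalised.Properties as ℚᵘ
open import Data.Sum.Base using (_⊎_; inj₁; inj₂; [_,_]′)
open import Data.Vec.Base using ([]; _∷_; here; there)
open import Data.Vec.Properties using (≡-dec; ∷-injectiveʳ)
open import Defs
open import Function.Base using (_∘_; id)
open import Level using (0ℓ)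
open import Relation.Binary.PropositionalEquality using (_≡_; _≢_; refl; sym; trans; cong; cong₂; subst; subst₂)
open import Relation.Nullary using (¬_; Dec; yes; no; contradiction)
open import Relation.Nullary.Decidable using (_×-dec_; ¬?; decidable-stable)
open import Relation.Unary using (Pred; Decidable; _≐_) renaming (_⊆_ to _⊆ᶠ_)
open import Relation.Unary.Properties using (_∪?_)

-- Inequality and equality case come from one statement: if both families have at least
-- `M = max {|𝓐(n,k,t)|, |𝓗(n,k,t)|}` members, they have one of the two listed forms, and these have
-- at most `M` members. Of e only `e ≥ 5/2` enters, through `w = max {30 (t + 2), 5 k}`: each
-- further prescribed point divides the number of k-sets by at least `w`. The part `30 (t + 2)`
-- keeps the losses small against `|𝓐| ≥ (t + 2 - 1/30) N`; the part `5 k` absorbs branching factors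
-- such as `k - t + 1`. The obstacle is the uniqueness of `K`. Two different unions force at least
-- `4 N / 5` members not containing `X` on the other side, but the bound `(t + 1) N / 5` on `E`
-- exceeds this for large `t`, so peeling alone does not exclude it. Those members are counted
-- afresh, by branching about `(k - t) / 2` times over members through `X` that avoid the points
-- chosen so far; such a member is guaranteed only while the number of chosen points times `N`, plus
-- `E`, stays below `M`.

private
  variable
    n : ℕ

-- Subsets of a finite set

∣p∪q∣+∣p∩q∣≡∣p∣+∣q∣ : ∀ (p q : Subset n) → ∣ p ∪ q ∣ + ∣ p ∩ q ∣ ≡ ∣ p ∣ + ∣ q ∣
∣p∪q∣+∣p∩q∣≡∣p∣+∣q∣ []            []            = refl
∣p∪q∣+∣p∩q∣≡∣p∣+∣q∣ (outside ∷ p) (outside ∷ q) = ∣p∪q∣+∣p∩q∣≡∣p∣+∣q∣ p q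
∣p∪q∣+∣p∩q∣≡∣p∣+∣q∣ (inside  ∷ p) (outside ∷ q) = cong suc (∣p∪q∣+∣p∩q∣≡∣p∣+∣q∣ p q)
∣p∪q∣+∣p∩q∣≡∣p∣+∣q∣ (outside ∷ p) (inside  ∷ q) =
  trans (cong suc (∣p∪q∣+∣p∩q∣≡∣p∣+∣q∣ p q)) (sym (+-suc ∣ p ∣ ∣ q ∣))
∣p∪q∣+∣p∩q∣≡∣p∣+∣q∣ (inside  ∷ p) (inside  ∷ q) =
  cong suc (trans (+-suc _ _) (trans (cong suc (∣p∪q∣+∣p∩q∣≡∣p∣+∣q∣ p q)) (sym (+-suc ∣ p ∣ ∣ q ∣))))

∣p─q∣+∣p∩q∣≡∣p∣ : ∀ (p q : Subset n) → ∣ p ─ q ∣ + ∣ p ∩ q ∣ ≡ ∣ p ∣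
∣p─q∣+∣p∩q∣≡∣p∣ []            []            = refl
∣p─q∣+∣p∩q∣≡∣p∣ (outside ∷ p) (outside ∷ q) = ∣p─q∣+∣p∩q∣≡∣p∣ p q
∣p─q∣+∣p∩q∣≡∣p∣ (inside  ∷ p) (outside ∷ q) = cong suc (∣p─q∣+∣p∩q∣≡∣p∣ p q)
∣p─q∣+∣p∩q∣≡∣p∣ (outside ∷ p) (inside  ∷ q) = ∣p─q∣+∣p∩q∣≡∣p∣ p q
∣p─q∣+∣p∩q∣≡∣p∣ (inside  ∷ p) (inside  ∷ q) = trans (+-suc _ _) (cong suc (∣p─q∣+∣p∩q∣≡∣p∣ p q))

x∈p─q⁻ : ∀ (p q : Subset n) {x} → x ∈ p ─ q → x ∈ p × x ∉ q
x∈p─q⁻ (_ ∷ p) (outside ∷ q) here      = here , λ ()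
x∈p─q⁻ (_ ∷ p) (_ ∷ q)       (there m) with x∈p─q⁻ p q m
... | x∈p , x∉q = there x∈p , λ { (there x∈q) → x∉q x∈q }

∩-comm-∣∣ : ∀ (p q : Subset n) → ∣ p ∩ q ∣ ≡ ∣ q ∩ p ∣
∩-comm-∣∣ p q = cong ∣_∣ (∩-comm p q)

∪-least : {p q r : Subset n} → p ⊆ r → q ⊆ r → p ∪ q ⊆ r
∪-least {p = p} {q} a b m with x∈p∪q⁻ p q m
... | inj₁ x = a x
... | inj₂ y = b y

⁅⁆⊆ : {x : Fin n} {p : Subset n} → x ∈ p → ⁅ x ⁆ ⊆ p
⁅⁆⊆ {x = x} {p} x∈p m = subst (_∈ p) (sym (x∈⁅y⁆⇒x≡y x m)) x∈p

x∈p─q⇒x∉q : ∀ (p q : Subset n) {x} → x ∈ p ─ q → x ∉ q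
x∈p─q⇒x∉q p q = proj₂ ∘ x∈p─q⁻ p q

∉- : ∀ (p : Subset n) x → x ∉ p - x
∉- p x m = x∈p─q⇒x∉q p ⁅ x ⁆ m (x∈⁅x⁆ x)

∣p∩q∣≡∣p∣ : {p q : Subset n} → p ⊆ q → ∣ p ∩ q ∣ ≡ ∣ p ∣
∣p∩q∣≡∣p∣ {p = p} {q} p⊆q = ≤-antisym (∣p∩q∣≤∣p∣ p q) (p⊆q⇒∣p∣≤∣q∣ λ m → x∈p∩q⁺ (m , p⊆q m))

∣p∣>0⇒nonempty : ∀ (p : Subset n) → 0 < ∣ p ∣ → Nonempty p
∣p∣>0⇒nonempty (inside  ∷ p) _ = zero , here
∣p∣>0⇒nonempty (outside ∷ p) h with ∣p∣>0⇒nonempty p h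
... | x , m = suc x , there m

∣p∪⁅x⁆∣ : ∀ {n} {p : Subset n} {x} → x ∉ p → ∣ p ∪ ⁅ x ⁆ ∣ ≡ suc ∣ p ∣
∣p∪⁅x⁆∣ {n} {p} {x} x∉p = +-cancelʳ-≡ _ _ _ (trans (∣p∪q∣+∣p∩q∣≡∣p∣+∣q∣ p ⁅ x ⁆)
  (trans (cong (∣ p ∣ +_) (∣⁅x⁆∣≡1 x)) (trans (+-comm ∣ p ∣ 1) (trans (sym (+-identityʳ _)) (cong (suc ∣ p ∣ +_) (sym disj))))))
  where
  disj : ∣ p ∩ ⁅ x ⁆ ∣ ≡ 0
  disj = trans (cong ∣_∣ (Empty-unique λ { (y , m) → let (y∈p , y∈x) = x∈p∩q⁻ p ⁅ x ⁆ m in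
    x∉p (subst (_∈ p) (x∈⁅y⁆⇒x≡y x y∈x) y∈p) })) (∣⊥∣≡0 n)

suc∣p-x∣ : ∀ {p : Subset n} {x} → x ∈ p → suc ∣ p - x ∣ ≡ ∣ p ∣
suc∣p-x∣ {p = p} {x} x∈p = trans (+-comm 1 _) (trans (cong (∣ p - x ∣ +_) (sym e)) (∣p─q∣+∣p∩q∣≡∣p∣ p ⁅ x ⁆))
  where
  e : ∣ p ∩ ⁅ x ⁆ ∣ ≡ 1
  e = trans (∩-comm-∣∣ p ⁅ x ⁆) (trans (∣p∩q∣≡∣p∣ (⁅⁆⊆ x∈p)) (∣⁅x⁆∣≡1 x))

p⊆q∧∣q∣≤∣p∣⇒q⊆p : {p q : Subset n} → p ⊆ q → ∣ q ∣ ≤ ∣ p ∣ → q ⊆ p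
p⊆q∧∣q∣≤∣p∣⇒q⊆p {p = p} p⊆q h {x} x∈q with x ∈? p
... | yes x∈p = x∈p
... | no x∉p  = contradiction (<-≤-trans (p⊂q⇒∣p∣<∣q∣ (p⊆q , x , x∈q , x∉p)) h) (<-irrefl refl)

p⊆q∧∣q∣≤∣p∣⇒p≡q : {p q : Subset n} → p ⊆ q → ∣ q ∣ ≤ ∣ p ∣ → p ≡ q
p⊆q∧∣q∣≤∣p∣⇒p≡q p⊆q h = ⊆-antisym p⊆q (p⊆q∧∣q∣≤∣p∣⇒q⊆p p⊆q h)

∣q∣<∣p∣⇒∃∈p∉q : ∀ (p q : Subset n) → ∣ q ∣ < ∣ p ∣ → ∃[ x ] (x ∈ p × x ∉ q)
∣q∣<∣p∣⇒∃∈p∉q p q h = let (x , m) = ∣p∣>0⇒nonempty (p ─ q) pos in x , x∈p─q⁻ p q m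
  where
  pos : 0 < ∣ p ─ q ∣
  pos = +-cancelʳ-< (∣ p ∩ q ∣) 0 _ (≤-<-trans (∣p∩q∣≤∣q∣ p q) (<-≤-trans h (≤-reflexive (sym (∣p─q∣+∣p∩q∣≡∣p∣ p q)))))

⊈⇒∃ : ∀ (p q : Subset n) → ¬ (p ⊆ q) → ∃[ x ] (x ∈ p × x ∉ q)
⊈⇒∃ p q p⊈q with nonempty? (p ─ q)
... | yes (x , m) = x , x∈p─q⁻ p q m
... | no e = ⊥-elim (p⊈q λ {x} x∈p → decidable-stable (x ∈? q) λ x∉q → e (x , x∈p∧x∉q⇒x∈p─q x∈p x∉q))

∣p∩q∣<∣p∣ : ∀ {p q : Subset n} {x} → x ∈ p → x ∉ q → ∣ p ∩ q ∣ < ∣ p ∣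
∣p∩q∣<∣p∣ {p = p} {q} {x} x∈p x∉q = p⊂q⇒∣p∣<∣q∣ (p∩q⊆p p q , x , x∈p , x∉q ∘ proj₂ ∘ x∈p∩q⁻ p q)

-- The set `p` misses at most one point of `q`: missing both `x` and `y` would leave `p ∩ q` inside
-- `q` with two points removed. This is the basic move for (t + 1)-sets that share `t` points.
one-of-two : ∀ {p q : Subset n} {x y s} → s ≤ ∣ p ∩ q ∣ → ∣ q ∣ ≤ suc s → x ∈ q → y ∈ q → x ≢ y → x ∉ p → y ∈ p
one-of-two {p = p} {q} {x} {y} h₁ h₂ x∈q y∈q x≢y x∉p = decidable-stable (y ∈? p) λ y∉p →
  <-irrefl refl (<-≤-trans (s≤s (s≤s h₁)) (≤-trans (s≤s (≤-trans (s≤s (p⊆q⇒∣p∣≤∣q∣ (sub y∉p)))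
    (≤-reflexive (suc∣p-x∣ (x∈p∧x≢y⇒x∈p-y y∈q (x≢y ∘ sym)))))) (≤-trans (≤-reflexive (suc∣p-x∣ x∈q)) h₂)))
  where
  sub : y ∉ p → p ∩ q ⊆ (q - x) - y
  sub y∉p {z} m = let (z∈p , z∈q) = x∈p∩q⁻ p q m in
    x∈p∧x≢y⇒x∈p-y (x∈p∧x≢y⇒x∈p-y z∈q λ { refl → x∉p z∈p }) λ { refl → y∉p z∈p }

intermediate : ∀ {p q : Subset n} s → p ⊆ q → ∣ p ∣ ≤ s → s ≤ ∣ q ∣ → ∃[ w ] (p ⊆ w × w ⊆ q × ∣ w ∣ ≡ s)
intermediate {p = []} {[]} zero _ _ _ = [] , id , id , refl
intermediate {p = outside ∷ p} {outside ∷ q} s p⊆q h₁ h₂ with intermediate s (drop-∷-⊆ p⊆q) h₁ h₂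
... | w , a , b , c = outside ∷ w , s⊆s a , s⊆s b , c
intermediate {p = inside ∷ p} {outside ∷ q} s p⊆q h₁ h₂ with () ← p⊆q here
intermediate {p = inside ∷ p} {inside ∷ q} (suc s) p⊆q (s≤s h₁) (s≤s h₂) with intermediate s (drop-∷-⊆ p⊆q) h₁ h₂
... | w , a , b , c = inside ∷ w , s⊆s a , s⊆s b , cong suc c
intermediate {p = outside ∷ p} {inside ∷ q} s p⊆q h₁ h₂ with ≤-total s ∣ q ∣
... | inj₁ s≤q with intermediate s (drop-∷-⊆ {s = outside} {t = inside} p⊆q) h₁ s≤q
...   | w , a , b , c = outside ∷ w , s⊆s a , out⊆ b , c
intermediate {p = outside ∷ p} {inside ∷ q} s p⊆q h₁ h₂ | inj₂ q≤s with m≤n⇒m<n∨m≡n h₂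
... | inj₁ (s≤s s≤q) with intermediate s (drop-∷-⊆ {s = outside} {t = inside} p⊆q) h₁ s≤q
...   | w , a , b , c = outside ∷ w , s⊆s a , out⊆ b , c
intermediate {p = outside ∷ p} {inside ∷ q} s p⊆q h₁ h₂ | inj₂ q≤s | inj₂ e =
  inside ∷ q , p⊆q , id , sym e

elements : Subset n → List (Fin n)
elements []            = []
elements (outside ∷ p) = map suc (elements p)
elements (inside  ∷ p) = zero ∷ map suc (elements p)

length-elements : ∀ (p : Subset n) → length (elements p) ≡ ∣ p ∣
length-elements []            = refl
length-elements (outside ∷ p) = trans (length-map suc (elements p)) (length-elements p)
length-elements (inside  ∷ p) = cong suc (trans (length-map suc (elements p)) (length-elements p))

∈⇒∈-elements : ∀ {p : Subset n} {x} → x ∈ p → x ∈ˡ elements p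
∈⇒∈-elements {p = inside  ∷ p} here      = here refl
∈⇒∈-elements {p = outside ∷ p} (there m) = ∈-map⁺ suc (∈⇒∈-elements m)
∈⇒∈-elements {p = inside  ∷ p} (there m) = there (∈-map⁺ suc (∈⇒∈-elements m))

elements⊆ : ∀ (p : Subset n) → All (_∈ p) (elements p)
elements⊆ []            = []
elements⊆ (outside ∷ p) = All.map⁺ (All.map there (elements⊆ p))
elements⊆ (inside  ∷ p) = here ∷ All.map⁺ (All.map there (elements⊆ p))

choose : Subset n → ℕ → List (Subset n)
choose []            zero    = [] ∷ []
choose []            (suc s) = []
choose (outside ∷ p) s       = map (outside ∷_) (choose p s)
choose (inside  ∷ p) zero    = map (outside ∷_) (choose p zero)
choose (inside  ∷ p) (suc s) = map (inside ∷_) (choose p s) ++ map (outside ∷_) (choose p (suc s))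

length-choose : ∀ (p : Subset n) s → length (choose p s) ≡ ∣ p ∣ C s
length-choose []            zero    = refl
length-choose []            (suc s) = sym (k>n⇒nCk≡0 {0} {suc s} (s≤s z≤n))
length-choose (outside ∷ p) s       = trans (length-map _ (choose p s)) (length-choose p s)
length-choose (inside  ∷ p) zero    = trans (length-map _ (choose p zero)) (length-choose p 0)
length-choose (inside  ∷ p) (suc s) = trans (length-++ (map _ (choose p s)))
  (trans (cong₂ _+_ (trans (length-map _ (choose p s)) (length-choose p s)) (trans (length-map _ (choose p (suc s)))
      (length-choose p (suc s))))
    (nCk+nC[k+1]≡[n+1]C[k+1] ∣ p ∣ s))

∣choose∣ : ∀ (p : Subset n) s → All (λ r → ∣ r ∣ ≡ s) (choose p s)
∣choose∣ []            zero    = refl ∷ []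
∣choose∣ []            (suc s) = []
∣choose∣ (outside ∷ p) s       = All.map⁺ (∣choose∣ p s)
∣choose∣ (inside  ∷ p) zero    = All.map⁺ (∣choose∣ p zero)
∣choose∣ (inside  ∷ p) (suc s) = All.++⁺ (All.map⁺ (All.map (cong suc) (∣choose∣ p s))) (All.map⁺ (∣choose∣ p (suc s)))

choose-covers : ∀ (b p : Subset n) s → s ≤ ∣ b ∩ p ∣ → Any (_⊆ b) (choose p s)
choose-covers []            []            zero    _ = here id
choose-covers (x ∷ b)       (outside ∷ p) s       h = Any.map⁺ (Any.map out⊆ (choose-covers b p s (≤-trans h (lem x))))
  where
  lem : ∀ x → ∣ (x ∷ b) ∩ (outside ∷ p) ∣ ≤ ∣ b ∩ p ∣
  lem outside = ≤-refl
  lem inside  = ≤-refl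
choose-covers (x ∷ b)       (inside ∷ p)  zero    h = Any.map⁺ (Any.map out⊆ (choose-covers b p zero z≤n))
choose-covers (outside ∷ b) (inside ∷ p)  (suc s) h = Any.++⁺ʳ (map _ (choose p s))
    (Any.map⁺ (Any.map s⊆s (choose-covers b p (suc s) h)))
choose-covers (inside ∷ b)  (inside ∷ p)  (suc s) (s≤s h) = Any.++⁺ˡ (Any.map⁺ (Any.map s⊆s (choose-covers b p s h)))

-- If R meets T in fewer than t points, then every B with t points in T leaves
-- any (t - 1)-set W with R ∩ T ⊆ W ⊆ T, and T ─ W is small and disjoint from R.
branch-points : ∀ {t i} (R T : Subset n) → ∣ R ∩ T ∣ < t → ∣ T ∣ ≤ t + i →
  ∃[ ys ] (length ys ≤ suc i × All (_∉ R) ys × (∀ {B} → t ≤ ∣ B ∩ T ∣ → Any (_∈ B) ys))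
branch-points {t = suc s} {i} R T (s≤s h) hT with s ≤? ∣ T ∣
... | no s≰T = [] , z≤n , [] , λ {B} t≤ → contradiction (≤-trans (n≤1+n s) (≤-trans t≤ (∣p∩q∣≤∣q∣ B T))) s≰T
... | yes s≤T with intermediate s (p∩q⊆q R T) h s≤T
...   | W , a , b , c = elements (T ─ W) ,
        ≤-trans (≤-reflexive (length-elements (T ─ W))) size ,
        All.map (λ y∈ y∈R → let (y∈T , y∉W) = x∈p─q⁻ T W y∈ in y∉W (a (x∈p∩q⁺ (y∈R , y∈T)))) (elements⊆ (T ─ W)) ,
        λ {B} t≤ → hit B t≤
  where
  size : ∣ T ─ W ∣ ≤ suc i
  size = +-cancelʳ-≤ s _ _ (≤-trans
      (≤-reflexive (trans (cong (∣ T ─ W ∣ +_) (sym (trans (∩-comm-∣∣ T W) (trans (∣p∩q∣≡∣p∣ b) c)))) (∣p─q∣+∣p∩q∣≡∣p∣ T W)))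
    (≤-trans hT (≤-reflexive (cong suc (+-comm s i)))))
  hit : ∀ B → suc s ≤ ∣ B ∩ T ∣ → Any (_∈ B) (elements (T ─ W))
  hit B t≤ with ∣q∣<∣p∣⇒∃∈p∉q (B ∩ T) W (≤-trans (≤-reflexive (cong suc c)) t≤)
  ... | x , m , x∉W = let (x∈B , x∈T) = x∈p∩q⁻ B T m in
    Any.map (λ { refl → x∈B }) (∈⇒∈-elements (x∈p∧x∉q⇒x∈p─q x∈T x∉W))

-- Counting k-sets

∈-allSubsets : ∀ (F : Subset n) → F ∈ˡ allSubsets n
∈-allSubsets []            = here refl
∈-allSubsets (outside ∷ F) = ∈-++⁺ˡ (∈-map⁺ _ (∈-allSubsets F))
∈-allSubsets (inside  ∷ F) = ∈-++⁺ʳ (map _ (allSubsets _)) (∈-map⁺ _ (∈-allSubsets F))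

module _ {a} {A : Set a} where

  private
    variable
      P Q R : Pred A 0ℓ

  length-filter-mono : (P? : Decidable P) (Q? : Decidable Q) → P ⊆ᶠ Q →
    ∀ xs → length (filter P? xs) ≤ length (filter Q? xs)
  length-filter-mono P? Q? P⊆Q [] = z≤n
  length-filter-mono P? Q? P⊆Q (x ∷ xs) with P? x | Q? x
  ... | yes p | yes q = s≤s (length-filter-mono P? Q? P⊆Q xs)
  ... | yes p | no ¬q = ⊥-elim (¬q (P⊆Q p))
  ... | no ¬p | yes q = m≤n⇒m≤1+n (length-filter-mono P? Q? P⊆Q xs)
  ... | no ¬p | no ¬q = length-filter-mono P? Q? P⊆Q xs

  length-filter-mono-< : (P? : Decidable P) (Q? : Decidable Q) → P ⊆ᶠ Q →
    ∀ {x} xs → x ∈ˡ xs → Q x → ¬ P x → length (filter P? xs) < length (filter Q? xs)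
  length-filter-mono-< P? Q? P⊆Q (x ∷ xs) x∈ qx ¬px with P? x | Q? x
  ... | yes p | no ¬q = ⊥-elim (¬q (P⊆Q p))
  ... | no ¬p | yes q = s≤s (length-filter-mono P? Q? P⊆Q xs)
  length-filter-mono-< P? Q? P⊆Q (x ∷ xs) (here refl) qx ¬px | yes p | yes q = ⊥-elim (¬px p)
  length-filter-mono-< P? Q? P⊆Q (x ∷ xs) (there m) qx ¬px   | yes p | yes q = s≤s (length-filter-mono-< P? Q? P⊆Q xs m qx ¬px)
  length-filter-mono-< P? Q? P⊆Q (x ∷ xs) (here refl) qx ¬px | no ¬p | no ¬q = ⊥-elim (¬q qx)
  length-filter-mono-< P? Q? P⊆Q (x ∷ xs) (there m) qx ¬px   | no ¬p | no ¬q = length-filter-mono-< P? Q? P⊆Q xs m qx ¬px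

  length-filter-∪ : (P? : Decidable P) (Q? : Decidable Q) (R? : Decidable R) → (∀ {x} → P x → Q x ⊎ R x) →
    ∀ xs → length (filter P? xs) ≤ length (filter Q? xs) + length (filter R? xs)
  length-filter-∪ P? Q? R? P⊆ [] = z≤n
  length-filter-∪ P? Q? R? P⊆ (x ∷ xs) with ih ← length-filter-∪ P? Q? R? P⊆ xs | P? x | Q? x | R? x
  ... | yes p | yes q | yes r = s≤s (≤-trans ih (+-monoʳ-≤ _ (n≤1+n _)))
  ... | yes p | yes q | no ¬r = s≤s ih
  ... | yes p | no ¬q | yes r = ≤-trans (s≤s ih) (≤-reflexive (sym (+-suc _ _)))
  ... | yes p | no ¬q | no ¬r = ⊥-elim ([ ¬q , ¬r ]′ (P⊆ p))
  ... | no ¬p | yes q | yes r = ≤-trans ih (+-mono-≤ (n≤1+n _) (n≤1+n _))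
  ... | no ¬p | yes q | no ¬r = m≤n⇒m≤1+n ih
  ... | no ¬p | no ¬q | yes r = ≤-trans ih (+-monoʳ-≤ _ (n≤1+n _))
  ... | no ¬p | no ¬q | no ¬r = ih

  length-filter-disjoint : (P? : Decidable P) (Q? : Decidable Q) (R? : Decidable R) →
    Q ⊆ᶠ P → R ⊆ᶠ P → (∀ {x} → Q x → ¬ R x) →
    ∀ xs → length (filter Q? xs) + length (filter R? xs) ≤ length (filter P? xs)
  length-filter-disjoint P? Q? R? Q⊆ R⊆ dis [] = z≤n
  length-filter-disjoint P? Q? R? Q⊆ R⊆ dis (x ∷ xs) with ih ← length-filter-disjoint P? Q? R? Q⊆ R⊆ dis xs | P? x | Q? x | R? x
  ... | _     | yes q | yes r = ⊥-elim (dis q r)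
  ... | yes p | yes q | no ¬r = s≤s ih
  ... | yes p | no ¬q | yes r = ≤-trans (≤-reflexive (+-suc _ _)) (s≤s ih)
  ... | yes p | no ¬q | no ¬r = m≤n⇒m≤1+n ih
  ... | no ¬p | yes q | no ¬r = ⊥-elim (¬p (Q⊆ q))
  ... | no ¬p | no ¬q | yes r = ⊥-elim (¬p (R⊆ r))
  ... | no ¬p | no ¬q | no ¬r = ih

  length-filter-map : ∀ {B : Set} (f : B → A) (P? : Decidable P) (Q? : Decidable (P ∘ f)) →
    ∀ xs → length (filter P? (map f xs)) ≡ length (filter Q? xs)
  length-filter-map f P? Q? [] = refl
  length-filter-map f P? Q? (x ∷ xs) with P? (f x) | Q? x
  ... | yes p | yes q = cong suc (length-filter-map f P? Q? xs)
  ... | no ¬p | no ¬q = length-filter-map f P? Q? xs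
  ... | yes p | no ¬q = ⊥-elim (¬q p)
  ... | no ¬p | yes q = ⊥-elim (¬p q)

module _ {P Q : Family n} (P? : Decidable P) (Q? : Decidable Q) where

  card-mono : P ⊆ᶠ Q → card P? ≤ card Q?
  card-mono P⊆Q = length-filter-mono P? Q? P⊆Q (allSubsets n)

  card-mono⁻¹ : P ⊆ᶠ Q → card Q? ≤ card P? → Q ⊆ᶠ P
  card-mono⁻¹ P⊆Q h {F} q = decidable-stable (P? F) λ ¬p →
    <-irrefl refl (<-≤-trans (length-filter-mono-< P? Q? P⊆Q (allSubsets n) (∈-allSubsets F) q ¬p) h)

card-cong : {P Q : Family n} (P? : Decidable P) (Q? : Decidable Q) → P ≐ Q → card P? ≡ card Q?
card-cong P? Q? (a , b) = ≤-antisym (card-mono P? Q? a) (card-mono Q? P? b)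

card-empty : {P : Family n} (P? : Decidable P) → (∀ {F} → ¬ P F) → card P? ≡ 0
card-empty {n} P? e = cong length (filter-none P? (All.universal (λ _ → e) (allSubsets n)))

card-⊎ : {P Q R : Family n} (P? : Decidable P) (Q? : Decidable Q) (R? : Decidable R) →
  (∀ {F} → P F → Q F ⊎ R F) → Q ⊆ᶠ P → R ⊆ᶠ P → (∀ {F} → Q F → ¬ R F) → card P? ≡ card Q? + card R?
card-⊎ {n} P? Q? R? a b c d = ≤-antisym (length-filter-∪ P? Q? R? a (allSubsets n))
  (length-filter-disjoint P? Q? R? b c d (allSubsets n))

-- `allSubsets` lists the sets without the first point before those with it. The exact counts below
-- are inductions on the ground set through this splitting.
card-∷ : {P : Family (suc n)} {P₀ P₁ : Family n} (P? : Decidable P) (P₀? : Decidable P₀) (P₁? : Decidable P₁) →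
  (P ∘ (outside ∷_)) ≐ P₀ → (P ∘ (inside ∷_)) ≐ P₁ → card P? ≡ card P₀? + card P₁?
card-∷ {n} P? P₀? P₁? e₀ e₁ = trans (cong length (filter-++ P? (map (outside ∷_) (allSubsets n)) _))
  (trans (length-++ (filter P? (map (outside ∷_) (allSubsets n)))) (cong₂ _+_
    (trans (length-filter-map (outside ∷_) P? (P? ∘ (outside ∷_)) (allSubsets n)) (card-cong (P? ∘ (outside ∷_)) P₀? e₀))
    (trans (length-filter-map (inside ∷_) P? (P? ∘ (inside ∷_)) (allSubsets n)) (card-cong (P? ∘ (inside ∷_)) P₁? e₁))))

-- One family for three counts: supersets of `R` (`U = ⊤`), sets through `R` avoiding a given set
-- (`U` its complement), and the singleton `R = U`.
Interval : ℕ → Subset n → Subset n → Family n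
Interval k R U F = ∣ F ∣ ≡ k × R ⊆ F × F ⊆ U

interval? : ∀ k (R U : Subset n) → Decidable (Interval k R U)
interval? k R U F = (∣ F ∣ ≟ k) ×-dec ((R ⊆? F) ×-dec (F ⊆? U))

private
  zero∉outside : {p : Subset n} → ¬ (zero ∈ outside ∷ p)
  zero∉outside ()

never? : Decidable {A = Subset n} (λ _ → Empty.⊥)
never? _ = no λ ()

card-never : ∀ n → card (never? {n}) ≡ 0
card-never n = card-empty (never? {n}) λ ()

card-interval : ∀ {n c} (R U : Subset n) → R ⊆ U → ∀ {b} → ∣ U ∣ ≡ ∣ R ∣ + b → card (interval? (∣ R ∣ + c) R U) ≡ b C c
card-interval {c = zero}  []            []            _   {zero} e = refl
card-interval {c = suc c} []            []            _   {zero} e = sym (k>n⇒nCk≡0 {0} {suc c} (s≤s z≤n))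
card-interval {suc n} {c = c} (inside ∷ R) (inside ∷ U) R⊆U {b} e =
  trans (card-∷ (interval? _ (inside ∷ R) (inside ∷ U)) never? (interval? (∣ R ∣ + c) R U)
    ((λ (_ , h , _) → ⊥-elim (zero∉outside (h here))) , λ ())
    ((λ (h₀ , h₁ , h₂) → suc-injective h₀ , drop-∷-⊆ h₁ , drop-∷-⊆ h₂) , λ (h₀ , h₁ , h₂) → cong suc h₀ , s⊆s h₁ , s⊆s h₂))
  (cong₂ _+_ (card-never n) (card-interval {c = c} R U (drop-∷-⊆ R⊆U) (suc-injective e)))
card-interval {c = c} (inside ∷ R) (outside ∷ U) R⊆U {b} e with () ← R⊆U here
card-interval {suc n} {c = c} (outside ∷ R) (outside ∷ U) R⊆U {b} e =
  trans (card-∷ (interval? _ (outside ∷ R) (outside ∷ U)) (interval? (∣ R ∣ + c) R U) never?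
    ((λ (h₀ , h₁ , h₂) → h₀ , drop-∷-⊆ h₁ , drop-∷-⊆ h₂) , λ (h₀ , h₁ , h₂) → h₀ , s⊆s h₁ , s⊆s h₂)
    ((λ (_ , _ , h) → ⊥-elim (zero∉outside (h here))) , λ ()))
  (trans (cong (card (interval? (∣ R ∣ + c) R U) +_) (card-never n)) (trans (+-identityʳ _) (card-interval R U (drop-∷-⊆ R⊆U) e)))
card-interval {c = c} (outside ∷ R) (inside ∷ U) R⊆U {zero} e =
  ⊥-elim (<-irrefl refl (<-≤-trans (≤-reflexive (trans e (+-identityʳ _))) (p⊆q⇒∣p∣≤∣q∣ (drop-∷-⊆ {s = outside} {t = inside} R⊆U))))
card-interval {suc n} {c = zero} (outside ∷ R) (inside ∷ U) R⊆U {suc b} e =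
  trans (card-∷ (interval? _ (outside ∷ R) (inside ∷ U)) (interval? (∣ R ∣ + 0) R U) never?
    ((λ (h₀ , h₁ , h₂) → h₀ , drop-∷-⊆ h₁ , drop-∷-⊆ {s = outside} {t = inside} h₂) , λ (h₀ , h₁ , h₂) → h₀ , s⊆s h₁ , out⊆ h₂)
    ((λ {F} (h₀ , h₁ , _) → <-irrefl refl (<-≤-trans (≤-reflexive (trans h₀ (+-identityʳ _)))
        (p⊆q⇒∣p∣≤∣q∣ (drop-∷-⊆ {s = outside} {t = inside} h₁)))) , λ ()))
  (trans (cong (card (interval? (∣ R ∣ + 0) R U) +_) (card-never n))
    (trans (+-identityʳ _) (card-interval R U (drop-∷-⊆ {s = outside} {t = inside} R⊆U) {b} (suc-injective (trans e (+-suc _ b))))))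
card-interval {c = suc c} (outside ∷ R) (inside ∷ U) R⊆U {suc b} e =
  trans (card-∷ (interval? _ (outside ∷ R) (inside ∷ U)) (interval? (∣ R ∣ + suc c) R U) (interval? (∣ R ∣ + c) R U)
    ((λ (h₀ , h₁ , h₂) → h₀ , drop-∷-⊆ h₁ , drop-∷-⊆ {s = outside} {t = inside} h₂) , λ (h₀ , h₁ , h₂) → h₀ , s⊆s h₁ , out⊆ h₂)
    ((λ (h₀ , h₁ , h₂) → suc-injective (trans h₀ (+-suc _ c)) , drop-∷-⊆ {s = outside} {t = inside} h₁ , drop-∷-⊆ h₂) ,
      λ (h₀ , h₁ , h₂) → trans (cong suc h₀) (sym (+-suc _ c)) , out⊆ h₁ , s⊆s h₂))
  (trans (cong₂ _+_ (card-interval R U R⊆U′ e′) (card-interval R U R⊆U′ e′)) (trans (+-comm (b C suc c) (b C c))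
      (nCk+nC[k+1]≡[n+1]C[k+1] b c)))
  where
  R⊆U′ = drop-∷-⊆ {s = outside} {t = inside} R⊆U
  e′ = suc-injective (trans e (+-suc _ b))

card-supersets : ∀ {c d b} (R : Subset n) → ∣ R ∣ ≡ d → n ≡ d + b → card (interval? (d + c) R ⊤) ≡ b C c
card-supersets {n} {c} R refl e = card-interval {c = c} R ⊤ ⊆⊤ (trans (∣⊤∣≡n n) e)

-- Sizes of the families `𝓗` and `𝓐`

star? : ∀ k (X L : Subset n) → Decidable (Star k X L)
star? k X L F = uniform? _ k F ×-dec ((X ⊆? F) ×-dec nonempty? (F ∩ (L ─ X)))

deletions? : ∀ (X K : Subset n) → Decidable (Deletions X K)
deletions? X K F = any?ᶠ λ x → (x ∈? X) ×-dec ≡-dec _≟ᵇ_ F (K - x)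

∣L─X∣ : ∀ {X L : Subset n} {t l} → X ⊆ L → ∣ X ∣ ≡ t → ∣ L ∣ ≡ t + l → ∣ L ─ X ∣ ≡ l
∣L─X∣ {X = X} {L} {t} {l} X⊆L hX hL = +-cancelʳ-≡ t _ _
    (trans (cong (∣ L ─ X ∣ +_) (sym (trans (∩-comm-∣∣ L X) (trans (∣p∩q∣≡∣p∣ X⊆L) hX))))
  (trans (∣p─q∣+∣p∩q∣≡∣p∣ L X) (trans hL (+-comm t l))))

-- Among the (t + r)-sets through `X`, those outside the star avoid `L ─ X` and form an interval of
-- `x C r` sets. That number stands on the left so that no subtraction occurs.
card-star : ∀ {t l x r} (X L : Subset n) → X ⊆ L → ∣ X ∣ ≡ t → ∣ L ∣ ≡ t + l → n ≡ t + (l + x) →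
  card (star? (t + r) X L) + x C r ≡ (l + x) C r
card-star {n} {t} {l} {x} {r} X L X⊆L hX hL e =
  trans (cong (card (star? (t + r) X L) +_) (sym (avoid hX)))
  (trans (sym (card-⊎ (interval? (t + r) X ⊤) (star? (t + r) X L) (interval? (t + r) X (∁ (L ─ X)))
    split (λ (a , b , _) → a , b , ⊆⊤) (λ (a , b , _) → a , b , ⊆⊤) dis))
  (card-supersets X hX e))
  where
  split : ∀ {F} → Interval (t + r) X ⊤ F → Star (t + r) X L F ⊎ Interval (t + r) X (∁ (L ─ X)) F
  split {F} (a , b , _) with nonempty? (F ∩ (L ─ X))
  ... | yes h = inj₁ (a , b , h)
  ... | no ¬h = inj₂ (a , b , λ m → x∉p⇒x∈∁p λ m′ → ¬h (_ , x∈p∩q⁺ (m , m′)))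
  dis : ∀ {F} → Star (t + r) X L F → ¬ Interval (t + r) X (∁ (L ─ X)) F
  dis {F} (_ , _ , y , m) (_ , _ , h) = let (a , b) = x∈p∩q⁻ F (L ─ X) m in x∈∁p⇒x∉p (h a) b
  size : ∣ ∁ (L ─ X) ∣ ≡ t + x
  size = trans (∣∁p∣≡n∸∣p∣ (L ─ X)) (trans (cong₂ _∸_ e (∣L─X∣ X⊆L hX hL)) (trans (cong (_∸ l) (lem t l x)) (m+n∸m≡n l (t + x))))
    where
    lem : ∀ t l x → t + (l + x) ≡ l + (t + x)
    lem = solve-∀
  avoid : ∣ X ∣ ≡ t → card (interval? (t + r) X (∁ (L ─ X))) ≡ x C r
  avoid refl = card-interval {c = r} X (∁ (L ─ X)) (λ m → x∉p⇒x∈∁p λ m′ → x∈p─q⇒x∉q L X m′ m) size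

-- Since `X ⊆ K`, different points give different deletions. In the induction a first point common
-- to `X` and `K` is absent from exactly one of them, which is counted as the singleton interval
-- between `K` and `K`.
card-deletions : ∀ (X K : Subset n) → X ⊆ K → card (deletions? X K) ≡ ∣ X ∣
card-deletions [] [] _ = refl
card-deletions {suc n} (inside ∷ X) (outside ∷ K) h with () ← h here
card-deletions {suc n} (inside ∷ X) (inside ∷ K) h =
  trans (card-∷ (deletions? (inside ∷ X) (inside ∷ K)) (interval? (∣ K ∣ + 0) K K) (deletions? X K) (o₁ , o₂) (i₁ , i₂))
    (cong₂ _+_ (card-interval {c = 0} K K id {0} (sym (+-identityʳ _))) (card-deletions X K (drop-∷-⊆ h)))
  where
  o₁ : ∀ {F} → Deletions (inside ∷ X) (inside ∷ K) (outside ∷ F) → Interval (∣ K ∣ + 0) K K F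
  o₁ {F} (zero , _ , e) = subst (Interval (∣ K ∣ + 0) K K) (sym (trans (∷-injectiveʳ e) (p─⊥≡p K))) (sym (+-identityʳ _) , id , id)
  o₂ : ∀ {F} → Interval (∣ K ∣ + 0) K K F → Deletions (inside ∷ X) (inside ∷ K) (outside ∷ F)
  o₂ (_ , a , b) = zero , here , cong (outside ∷_) (trans (⊆-antisym b a) (sym (p─⊥≡p K)))
  i₁ : ∀ {F} → Deletions (inside ∷ X) (inside ∷ K) (inside ∷ F) → Deletions X K F
  i₁ (suc x , there m , refl) = x , m , refl
  i₂ : ∀ {F} → Deletions X K F → Deletions (inside ∷ X) (inside ∷ K) (inside ∷ F)
  i₂ (x , m , refl) = suc x , there m , refl
card-deletions {suc n} (outside ∷ X) (inside ∷ K) h =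
  trans (card-∷ (deletions? (outside ∷ X) (inside ∷ K)) never? (deletions? X K) (o₁ , λ ()) (i₁ , i₂))
    (cong₂ _+_ (card-never n) (card-deletions X K (drop-∷-⊆ {s = outside} {t = inside} h)))
  where
  o₁ : ∀ {F} → Deletions (outside ∷ X) (inside ∷ K) (outside ∷ F) → Empty.⊥
  o₁ (suc x , there m , ())
  i₁ : ∀ {F} → Deletions (outside ∷ X) (inside ∷ K) (inside ∷ F) → Deletions X K F
  i₁ (suc x , there m , refl) = x , m , refl
  i₂ : ∀ {F} → Deletions X K F → Deletions (outside ∷ X) (inside ∷ K) (inside ∷ F)
  i₂ (x , m , refl) = suc x , there m , refl
card-deletions {suc n} (outside ∷ X) (outside ∷ K) h =
  trans (card-∷ (deletions? (outside ∷ X) (outside ∷ K)) (deletions? X K) never? (i₁ , i₂) (o₁ , λ ()))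
    (trans (cong₂ _+_ (card-deletions X K (drop-∷-⊆ h)) (card-never n)) (+-identityʳ _))
  where
  o₁ : ∀ {F} → Deletions (outside ∷ X) (outside ∷ K) (inside ∷ F) → Empty.⊥
  o₁ (suc x , there m , ())
  i₁ : ∀ {F} → Deletions (outside ∷ X) (outside ∷ K) (outside ∷ F) → Deletions X K F
  i₁ (suc x , there m , refl) = x , m , refl
  i₂ : ∀ {F} → Deletions X K F → Deletions (outside ∷ X) (outside ∷ K) (outside ∷ F)
  i₂ (x , m , refl) = suc x , there m , refl

card-𝓗 : ∀ {k} (X K L : Subset n) → X ⊆ K → card (𝓗? k X K L) ≡ card (star? k X L) + ∣ X ∣
card-𝓗 {k = k} X K L X⊆K = trans
  (card-⊎ (𝓗? k X K L) (star? k X L) (deletions? X K) id inj₁ inj₂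
    λ { (_ , X⊆F , _) (x , x∈X , refl) → ∉- K x (X⊆F x∈X) })
  (cong (card (star? k X L) +_) (card-deletions X K X⊆K))

-- This is `𝓐` with the threshold tied to `∣ Z ∣` instead of `t`: removing a common first point from
-- `F` and `Z` then preserves the condition, as the induction requires.
Nearly : ℕ → Subset n → Family n
Nearly k Z F = ∣ F ∣ ≡ k × ∣ Z ∣ ≤ suc ∣ F ∩ Z ∣

nearly? : ∀ k (Z : Subset n) → Decidable (Nearly k Z)
nearly? k Z F = uniform? _ k F ×-dec (∣ Z ∣ ≤? suc ∣ F ∩ Z ∣)

∣Z∣≤∣F∩Z∣⇒Z⊆F : ∀ {F Z : Subset n} → ∣ Z ∣ ≤ ∣ F ∩ Z ∣ → Z ⊆ F
∣Z∣≤∣F∩Z∣⇒Z⊆F {F = F} {Z} h = proj₁ ∘ x∈p∩q⁻ F Z ∘ p⊆q∧∣q∣≤∣p∣⇒q⊆p (p∩q⊆q F Z) h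

Z⊆F⇒∣Z∣≤∣F∩Z∣ : ∀ {F Z : Subset n} → Z ⊆ F → ∣ Z ∣ ≤ ∣ F ∩ Z ∣
Z⊆F⇒∣Z∣≤∣F∩Z∣ {F = F} {Z} h = p⊆q⇒∣p∣≤∣q∣ λ m → x∈p∩q⁺ (h m , m)

private
  0C : ∀ c → 0 C (suc c) ≡ 0
  0C c = k>n⇒nCk≡0 {0} {suc c} (s≤s z≤n)

  1C : ∀ c → 1 C (suc (suc c)) ≡ 0
  1C c = k>n⇒nCk≡0 {1} {suc (suc c)} (s≤s (s≤s z≤n))

-- The binomial coefficient added on the left replaces a subtraction.
card-nearly : ∀ (k : ℕ) (Z : Subset n) {z c b} → ∣ Z ∣ ≡ z → suc k ≡ z + c → n ≡ z + b →
  card (nearly? k Z) + b C c ≡ z * (b C c) + suc b C c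
card-nearly zero    [] {.zero} {suc zero} {zero} refl eₖ eₙ = refl
card-nearly (suc k) [] {.zero} {suc (suc c)} {zero} refl refl eₙ = trans (0C (suc c)) (sym (1C c))
card-nearly {suc n} k (outside ∷ Z) {z} {c} {zero} e eₖ eₙ =
  ⊥-elim (<-irrefl refl (<-≤-trans (s≤s (∣p∣≤n Z)) (≤-reflexive (trans eₙ (trans (+-identityʳ z) (sym e))))))
card-nearly {suc n} zero (outside ∷ Z) {z} {c} {suc b} e eₖ eₙ =
  trans (cong (_+ suc b C c) (trans (card-∷ (nearly? zero (outside ∷ Z)) (nearly? zero Z) never? ((λ h → h) , λ h → h)
      ((λ ()) , λ ()))
    (trans (cong (card (nearly? zero Z) +_) (card-never n)) (+-identityʳ _)))) (finish z c e eₖ (card-nearly zero Z e eₖ e′))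
  where
  e′ = suc-injective (trans eₙ (+-suc z b))
  finish : ∀ z c → ∣ Z ∣ ≡ z → 1 ≡ z + c → card (nearly? zero Z) + b C c ≡ z * (b C c) + suc b C c →
    card (nearly? zero Z) + suc b C c ≡ z * (suc b C c) + suc (suc b) C c
  finish zero (suc zero) _ refl ih rewrite nC1≡n b | nC1≡n (suc b) | nC1≡n (suc (suc b)) = trans (+-suc _ b) (cong suc ih)
  finish (suc zero) zero _ refl ih = ih
card-nearly {suc n} (suc k) (outside ∷ Z) {z} {zero} {suc b} e eₖ eₙ =
  trans (cong (_+ 1) (trans (card-∷ (nearly? (suc k) (outside ∷ Z)) (nearly? (suc k) Z) never? ((λ h → h) , λ h → h)
      ((λ {F} → i {F}) , λ ()))
    (trans (cong (card (nearly? (suc k) Z) +_) (card-never n)) (+-identityʳ _)))) (card-nearly (suc k) Z {c = 0} {b} e eₖ e′)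
  where
  e′ = suc-injective (trans eₙ (+-suc z b))
  i : ∀ {F} → Nearly (suc k) (outside ∷ Z) (inside ∷ F) → Empty.⊥
  i {F} (h₁ , h₂) = <-irrefl refl (≤-trans (≤-reflexive (trans eₖ (trans (+-identityʳ z) (sym e)))) (≤-trans h₂
    (s≤s (≤-trans (∣p∩q∣≤∣p∣ F Z) (≤-reflexive (suc-injective h₁))))))
card-nearly {suc n} (suc k) (outside ∷ Z) {z} {suc c} {suc b} e eₖ eₙ =
  trans (cong₂ _+_ (card-∷ (nearly? (suc k) (outside ∷ Z)) (nearly? (suc k) Z) (nearly? k Z) ((λ h → h) , λ h → h)
    ((λ (a , h) → suc-injective a , h) , λ (a , h) → cong suc a , h)) (sym (nCk+nC[k+1]≡[n+1]C[k+1] b c)))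
  (trans (lem₁ (card (nearly? (suc k) Z)) (card (nearly? k Z)) (b C c) (b C suc c))
  (trans (cong₂ _+_ (card-nearly (suc k) Z {c = suc c} e eₖ e′) (card-nearly k Z {c = c} e
      (suc-injective (trans eₖ (+-suc z c))) e′))
  (trans (lem₂ z (b C c) (b C suc c) (suc b C c) (suc b C suc c))
    (cong₂ (λ u v → z * u + v) (nCk+nC[k+1]≡[n+1]C[k+1] b c) (nCk+nC[k+1]≡[n+1]C[k+1] (suc b) c)))))
  where
  e′ = suc-injective (trans eₙ (+-suc z b))
  lem₁ : ∀ x y p q → (x + y) + (p + q) ≡ (x + q) + (y + p)
  lem₁ = solve-∀
  lem₂ : ∀ z p q u v → (z * q + v) + (z * p + u) ≡ z * (p + q) + (u + v)
  lem₂ = solve-∀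
card-nearly {suc n} k (inside ∷ Z) {suc z} {c} {b} e eₖ eₙ = trans (cong (_+ b C c)
  (trans (card-∷ (nearly? k (inside ∷ Z)) (interval? (z + c) Z ⊤) (λ F → nearly? k (inside ∷ Z) (inside ∷ F)) (o₁ , o₂)
      ((λ h → h) , λ h → h))
    (cong (_+ card (λ F → nearly? k (inside ∷ Z) (inside ∷ F))) (card-supersets {c = c} Z e′ (suc-injective eₙ)))))
  (finish k z c e′ (suc-injective eₙ) (suc-injective eₖ))
  where
  e′ = suc-injective e
  o₁ : ∀ {F} → Nearly k (inside ∷ Z) (outside ∷ F) → Interval (z + c) Z ⊤ F
  o₁ {F} (a , s≤s h) = trans a (suc-injective eₖ) , ∣Z∣≤∣F∩Z∣⇒Z⊆F h , ⊆⊤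
  o₂ : ∀ {F} → Interval (z + c) Z ⊤ F → Nearly k (inside ∷ Z) (outside ∷ F)
  o₂ {F} (a , h , _) = trans a (sym (suc-injective eₖ)) , s≤s (Z⊆F⇒∣Z∣≤∣F∩Z∣ h)
  lem : ∀ x y p → (x + y) + p ≡ x + (y + p)
  lem = solve-∀
  finish : ∀ k z c → ∣ Z ∣ ≡ z → n ≡ z + b → k ≡ z + c →
    b C c + card (λ F → nearly? k (inside ∷ Z) (inside ∷ F)) + b C c ≡ suc z * (b C c) + suc b C c
  finish zero zero zero _ _ _ = cong (λ u → suc (u + 1)) (card-empty (λ F → nearly? zero (inside ∷ Z) (inside ∷ F)) λ ())
  finish (suc k) z c e′ eₙ e₀ = trans (cong (λ u → b C c + u + b C c)
      (card-cong (λ F → nearly? (suc k) (inside ∷ Z) (inside ∷ F)) (nearly? k Z)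
        ((λ { (a , s≤s h) → suc-injective a , h }) , λ (a , h) → cong suc a , s≤s h)))
    (trans (lem (b C c) _ (b C c)) (trans (cong (b C c +_) (card-nearly k Z {c = c} e′ e₀ eₙ)) (sym (+-assoc (b C c) _ _))))

-- The sets missing exactly one point of `Z` number `(t + 2) * (b C c)`, and those containing `Z`
-- number `suc b C c` minus `b C c`.
card-𝓐 : ∀ {t c b} (k : ℕ) (Z : Subset n) → ∣ Z ∣ ≡ t + 2 → suc k ≡ t + 2 + c → n ≡ t + 2 + b →
  card (𝓐? k t Z) + b C c ≡ (t + 2) * (b C c) + suc b C c
card-𝓐 {t = t} {c} {b} k Z e eₖ eₙ = trans (cong (_+ b C c) (card-cong (𝓐? k t Z) (nearly? k Z)
  ((λ (a , h) → a , ≤-trans (≤-reflexive (trans e (+-suc t 1))) (s≤s h)) ,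
    λ (a , h) → a , s≤s⁻¹ (≤-trans (≤-reflexive (trans (sym (+-suc t 1)) (sym e))) h)))) (card-nearly k Z e eₖ eₙ)

-- P ≼ c: some sets B such that each k-set of P contains one of them have
-- at most c supersets of size k altogether.
module Cost (n k : ℕ) where

  N : ℕ → ℕ
  N j = (n ∸ j) C (k ∸ j)

  total : List (Subset n) → ℕ
  total 𝓛 = sum (map (λ B → N ∣ B ∣) 𝓛)

  infix 4 _≼_
  record _≼_ (P : Family n) (c : ℕ) : Set where
    constructor mk≼
    field
      generators : List (Subset n)
      generate   : ∀ {F} → ∣ F ∣ ≡ k → P F → Any (_⊆ F) generators
      total≤     : total generators ≤ c

  open _≼_

  private
    variable
      P Q R : Family n
      c d : ℕ

  card-interval≤N : ∀ B → card (interval? k B ⊤) ≤ N ∣ B ∣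
  card-interval≤N B with ∣ B ∣ ≤? k
  ... | yes j≤k = ≤-reflexive (subst (λ k′ → card (interval? k′ B ⊤) ≡ N ∣ B ∣) (m+[n∸m]≡n j≤k)
    (card-supersets {c = k ∸ ∣ B ∣} B refl (sym (m+[n∸m]≡n (∣p∣≤n B)))))
  ... | no j≰k = ≤-trans (≤-reflexive (card-empty (interval? k B ⊤)
    λ (e , B⊆F , _) → j≰k (≤-trans (p⊆q⇒∣p∣≤∣q∣ B⊆F) (≤-reflexive e)))) z≤n

  card-generated≤ : ∀ 𝓛 → card (λ F → uniform? n k F ×-dec any? (_⊆? F) 𝓛) ≤ total 𝓛
  card-generated≤ [] = ≤-reflexive (card-empty (λ F → uniform? n k F ×-dec any? (_⊆? F) []) λ ())
  card-generated≤ (B ∷ 𝓛) = ≤-trans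
    (length-filter-∪ (λ F → uniform? n k F ×-dec any? (_⊆? F) (B ∷ 𝓛)) (interval? k B ⊤) (λ F → uniform? n k F ×-dec any? (_⊆? F) 𝓛)
      (λ { (e , here h) → inj₁ (e , h , ⊆⊤) ; (e , there h) → inj₂ (e , h) }) (allSubsets n))
    (+-mono-≤ (card-interval≤N B) (card-generated≤ 𝓛))

  -- The passage from costs to cardinalities. Families such as `Above` come without a decision
  -- procedure, so bounds are accumulated through `≼` and counted only for the decidable family at
  -- the end.
  card≤ : (P? : Decidable P) → P ⊆ᶠ Uniform n k → P ≼ c → card P? ≤ c
  card≤ P? u (mk≼ 𝓛 g t) = ≤-trans (card-mono P? (λ F → uniform? n k F ×-dec any? (_⊆? F) 𝓛) λ p → u p , g (u p) p)
    (≤-trans (card-generated≤ 𝓛) t)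

  total-++ : ∀ 𝓛 𝓜 → total (𝓛 ++ 𝓜) ≡ total 𝓛 + total 𝓜
  total-++ []      𝓜 = refl
  total-++ (B ∷ 𝓛) 𝓜 = trans (cong (N ∣ B ∣ +_) (total-++ 𝓛 𝓜)) (sym (+-assoc (N ∣ B ∣) (total 𝓛) (total 𝓜)))

  ≼-mono : c ≤ d → P ≼ c → P ≼ d
  ≼-mono h (mk≼ 𝓛 g t) = mk≼ 𝓛 g (≤-trans t h)

  ≼-empty : (∀ {F} → ¬ P F) → P ≼ c
  ≼-empty e = mk≼ [] (λ _ p → ⊥-elim (e p)) z≤n

  ≼-⊆ : (∀ {F} → ∣ F ∣ ≡ k → P F → Q F) → Q ≼ c → P ≼ c
  ≼-⊆ h (mk≼ 𝓛 g t) = mk≼ 𝓛 (λ u p → g u (h u p)) t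

  ≼-∪ : (∀ {F} → ∣ F ∣ ≡ k → P F → Q F ⊎ R F) → Q ≼ c → R ≼ d → P ≼ c + d
  ≼-∪ h (mk≼ 𝓛 g t) (mk≼ 𝓛′ g′ t′) = mk≼ (𝓛 ++ 𝓛′)
    (λ u p → [ (λ q → Any.++⁺ˡ (g u q)) , (λ r → Any.++⁺ʳ 𝓛 (g′ u r)) ]′ (h u p))
    (≤-trans (≤-reflexive (total-++ 𝓛 𝓛′)) (+-mono-≤ t t′))

  ≼-supersets : ∀ {j} (B : Subset n) → ∣ B ∣ ≡ j → (∀ {F} → P F → B ⊆ F) → P ≼ N j
  ≼-supersets B refl h = mk≼ (B ∷ []) (λ _ p → here (h p)) (≤-reflexive (+-identityʳ _))

  ≼-branch : ∀ {A : Set} (xs : List A) (S : A → Family n) → (∀ {F} → ∣ F ∣ ≡ k → P F → Any (λ x → S x F) xs) →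
    All (λ x → S x ≼ c) xs → P ≼ length xs * c
  ≼-branch [] S h _ = mk≼ [] (λ u p → contradiction (h u p) λ ()) z≤n
  ≼-branch {P = P} {c = c} (x ∷ xs) S h (s ∷ ss) = ≼-∪ {Q = S x} {R = λ F → Any (λ x → S x F) xs}
    (λ u p → Any.toSum (h u p)) s (≼-branch xs S (λ _ a → a) ss)

-- Peeling

C-monoˡ-≤ : ∀ s {a b} → a ≤ b → a C s ≤ b C s
C-monoˡ-≤ s {a} a≤b = subst (λ m → a C s ≤ m C s) (m+[n∸m]≡n a≤b) (go (_ ∸ a))
  where
  step : ∀ m s → m C s ≤ suc m C s
  step m zero    = ≤-refl
  step m (suc s) = ≤-trans (m≤n+m (m C suc s) (m C s)) (≤-reflexive (nCk+nC[k+1]≡[n+1]C[k+1] m s))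
  go : ∀ d → a C s ≤ (a + d) C s
  go zero    = ≤-reflexive (cong (_C s) (sym (+-identityʳ a)))
  go (suc d) = ≤-trans (go d) (≤-trans (step (a + d) s) (≤-reflexive (cong (_C s) (sym (+-suc a d)))))

module Peeling (n k t : ℕ) where

  open Cost n k

  Covers : List (Subset n) → Subset n → Set
  Covers 𝓣 R = All (λ B → t ≤ ∣ R ∩ B ∣) 𝓣

  covers? : ∀ 𝓣 → Decidable (Covers 𝓣)
  covers? 𝓣 R = all? (λ B → t ≤? ∣ R ∩ B ∣) 𝓣

  covers-swap : ∀ {𝓢 𝓣} → All (Covers 𝓣) 𝓢 → All (Covers 𝓢) 𝓣
  covers-swap {𝓢} {𝓣} c = All.tabulate λ {B} B∈ → All.tabulate λ {A} A∈ →
    ≤-trans (All.lookup (All.lookup c A∈) B∈) (≤-reflexive (∩-comm-∣∣ A B))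

  record MinimalCover (𝓣 : List (Subset n)) (q : ℕ) (B : Subset n) : Set where
    field
      covers  : Covers 𝓣 B
      size    : ∣ B ∣ ≡ q
      minimal : ∀ {R} → R ⊆ B → ∣ R ∣ < ∣ B ∣ → ¬ Covers 𝓣 R

  Above : List (Subset n) → ℕ → Subset n → Family n
  Above 𝓣 q R F = ∃[ B ] (MinimalCover 𝓣 q B × R ⊆ B × B ⊆ F)

  -- If `R` is a cover, minimality leaves nothing above it, since `R` is smaller than `q`. Otherwise
  -- some `T` in `𝓣` meets `R` in fewer than `t` points, and `branch-points` offers at most `i + 1`
  -- points of `T` outside `R`, one of which lies in the cover. After `j` such choices `R` has `q`
  -- points.
  Above-≼ : ∀ {𝓣 i q} → All (λ B → ∣ B ∣ ≤ t + i) 𝓣 → ∀ j R → ∣ R ∣ + j ≡ q → Above 𝓣 q R ≼ suc i ^ j * N q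
  Above-≼ sizes zero R e = ≼-mono (≤-reflexive (sym (+-identityʳ _)))
    (≼-supersets R (trans (sym (+-identityʳ _)) e) λ (B , _ , R⊆B , B⊆F) → B⊆F ∘ R⊆B)
  Above-≼ {𝓣} {i} {q} sizes (suc j) R e with covers? 𝓣 R
  ... | yes c = ≼-empty λ (B , m , R⊆B , _) → let open MinimalCover m in
    minimal R⊆B (<-≤-trans (m<m+n ∣ R ∣ (s≤s z≤n)) (≤-reflexive (trans e (sym size)))) c
  ... | no ¬c with find (All.¬All⇒Any¬ (λ B → t ≤? ∣ R ∩ B ∣) 𝓣 ¬c)
  ...   | T , T∈ , ¬t≤ with branch-points R T (≰⇒> ¬t≤) (All.lookup sizes T∈)
  ...     | ys , len , ∉R , hit = ≼-mono
    (≤-trans (*-monoˡ-≤ (suc i ^ j * N q) len) (≤-reflexive (sym (*-assoc (suc i) (suc i ^ j) (N q)))))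
    (≼-branch ys (λ y → Above 𝓣 q (R ∪ ⁅ y ⁆))
      (λ _ → branch)
      (All.map (λ {y} y∉R → Above-≼ sizes j (R ∪ ⁅ y ⁆) (trans (cong (_+ j) (∣p∪⁅x⁆∣ y∉R)) (trans (sym (+-suc _ j)) e))) ∉R))
    where
    branch : ∀ {F} → Above 𝓣 q R F → Any (λ y → Above 𝓣 q (R ∪ ⁅ y ⁆) F) ys
    branch {F} (B , m , R⊆B , B⊆F) = Any.map extend (hit (All.lookup (MinimalCover.covers m) T∈))
      where
      extend : ∀ {y} → y ∈ B → Above 𝓣 q (R ∪ ⁅ y ⁆) F
      extend y∈B = B , m , ∪-least R⊆B (⁅⁆⊆ y∈B) , B⊆F

  removed : ℕ → ℕ
  removed i = ((t + i) C t) * (suc i ^ i * N (t + i))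

  minimal-≼ : ∀ {𝓣 i} → 0 < t + i → All (λ B → ∣ B ∣ ≤ t + i) 𝓣 →
    (λ F → ∃[ B ] (MinimalCover 𝓣 (t + i) B × B ⊆ F)) ≼ removed i
  -- For empty `𝓣` already the empty set is a cover, so no set of positive size is a minimal one.
  minimal-≼ {[]} 0< _ = ≼-empty λ (B , m , _) → let open MinimalCover m in
    minimal {⊥} ⊥⊆ (≤-trans (s≤s (≤-reflexive (∣⊥∣≡0 n))) (≤-trans 0< (≤-reflexive (sym size)))) []
  minimal-≼ {𝓣@(T ∷ _)} {i} 0< sizes@(T≤ ∷ _) = ≼-mono
    (*-monoˡ-≤ (suc i ^ i * N (t + i)) (≤-trans (≤-reflexive (length-choose T t)) (C-monoˡ-≤ t T≤)))
    (≼-branch (choose T t) (Above 𝓣 (t + i))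
      (λ _ → branch)
      (All.map (λ {R} e → Above-≼ sizes i R (cong (_+ i) e)) (∣choose∣ T t)))
    where
    branch : ∀ {F} → ∃[ B ] (MinimalCover 𝓣 (t + i) B × B ⊆ F) → Any (λ R → Above 𝓣 (t + i) R F) (choose T t)
    branch {F} (B , m , B⊆F) = Any.map above (choose-covers B T t (All.head (MinimalCover.covers m)))
      where
      above : ∀ {R} → R ⊆ B → Above 𝓣 (t + i) R F
      above R⊆B = B , m , R⊆B , B⊆F

  shrink? : ∀ 𝓣 i → Decidable (λ A → ∣ A ∣ ≤ t + i × Covers 𝓣 A)
  shrink? 𝓣 i A = (∣ A ∣ ≤? t + i) ×-dec covers? 𝓣 A

  -- All small covers are taken, not only subsets of the current generators; cross t-intersection
  -- with `𝓣` then holds by construction.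
  shrink : List (Subset n) → ℕ → List (Subset n)
  shrink 𝓣 i = filter (shrink? 𝓣 i) (allSubsets n)

  shrink-All : ∀ 𝓣 i → All (λ A → ∣ A ∣ ≤ t + i × Covers 𝓣 A) (shrink 𝓣 i)
  shrink-All 𝓣 i = All.all-filter (shrink? 𝓣 i) (allSubsets n)

  -- If `A` contains no cover of size at most `t + i`, then no smaller subset of `A` covers, and `A`
  -- itself must have the full size `t + suc i`.
  shrink-or-minimal : ∀ 𝓣 i {A} → ∣ A ∣ ≤ t + suc i → Covers 𝓣 A → Any (_⊆ A) (shrink 𝓣 i) ⊎ MinimalCover 𝓣 (t + suc i) A
  shrink-or-minimal 𝓣 i {A} A≤ c with any? (_⊆? A) (shrink 𝓣 i)
  ... | yes a = inj₁ a
  ... | no ¬a = inj₂ record { covers = c ; size = size ; minimal = λ {R} R⊆A R<A cR →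
      none R⊆A (s≤s⁻¹ (≤-trans R<A (≤-trans A≤ (≤-reflexive (+-suc t i))))) cR }
    where
    none : ∀ {R} → R ⊆ A → ∣ R ∣ ≤ t + i → ¬ Covers 𝓣 R
    none R⊆A R≤ cR = ¬a (lose (∈-filter⁺ (shrink? 𝓣 i) (∈-allSubsets _) (R≤ , cR)) R⊆A)
    size : ∣ A ∣ ≡ t + suc i
    size = ≤-antisym A≤ (≮⇒≥ λ A< → none id (s≤s⁻¹ (≤-trans A< (≤-reflexive (+-suc t i)))) c)

  -- Up to E sets on either side, 𝓕 and 𝓖 are generated by cross t-intersecting
  -- families 𝓢 and 𝓣 of sets of size at most t + i.
  record Peeled (𝓕 𝓖 : Family n) (i E : ℕ) : Set where
    field
      𝓢 𝓣   : List (Subset n)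
      sizeˢ : All (λ A → ∣ A ∣ ≤ t + i) 𝓢
      sizeᵗ : All (λ B → ∣ B ∣ ≤ t + i) 𝓣
      cross : All (Covers 𝓣) 𝓢
      restˢ : (λ F → 𝓕 F × ¬ Any (_⊆ F) 𝓢) ≼ E
      restᵗ : (λ G → 𝓖 G × ¬ Any (_⊆ G) 𝓣) ≼ E

  rest-step : ∀ {𝓕 : Family n} {i E 𝓢 𝓣} → 0 < t → All (λ B → ∣ B ∣ ≤ t + suc i) 𝓣 → All (λ A → ∣ A ∣ ≤ t + suc i) 𝓢 →
    All (Covers 𝓣) 𝓢 → (λ F → 𝓕 F × ¬ Any (_⊆ F) 𝓢) ≼ E →
    (λ F → 𝓕 F × ¬ Any (_⊆ F) (shrink 𝓣 i)) ≼ removed (suc i) + E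
  rest-step {𝓕} {i} {E} {𝓢} {𝓣} 0<t sizeᵗ sizeˢ cross rest = ≼-∪ split (minimal-≼ (≤-trans 0<t (m≤m+n t _)) sizeᵗ) rest
    where
    split : ∀ {F} → ∣ F ∣ ≡ k → 𝓕 F × ¬ Any (_⊆ F) (shrink 𝓣 i) →
      (∃[ B ] (MinimalCover 𝓣 (t + suc i) B × B ⊆ F)) ⊎ (𝓕 F × ¬ Any (_⊆ F) 𝓢)
    split {F} _ (f , ¬a) with any? (_⊆? F) 𝓢
    ... | no ¬s = inj₂ (f , ¬s)
    ... | yes s with find s
    ...   | A , A∈ , A⊆F with shrink-or-minimal 𝓣 i (All.lookup sizeˢ A∈) (All.lookup cross A∈)
    ...     | inj₁ a = ⊥-elim (¬a (Any.map (λ R⊆A {x} m → A⊆F (R⊆A m)) a))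
    ...     | inj₂ m = inj₁ (A , m , A⊆F)

  peel-step : ∀ {𝓕 𝓖 : Family n} {i E} → 0 < t → Peeled 𝓕 𝓖 (suc i) E → Peeled 𝓕 𝓖 i (removed (suc i) + E)
  peel-step {i = i} {E} 0<t p = record
    { 𝓢     = 𝓢′
    ; 𝓣     = shrink 𝓢′ i
    ; sizeˢ = size′
    ; sizeᵗ = All.map proj₁ (shrink-All 𝓢′ i)
    ; cross = covers-swap (All.map proj₂ (shrink-All 𝓢′ i))
    ; restˢ = rest-step 0<t sizeᵗ sizeˢ cross restˢ
    -- This side is shrunk against the already shrunk `𝓢′`, whose members are smaller than
    -- `rest-step` asks; hence it too loses at most `removed (suc i)`.
    ; restᵗ = rest-step 0<t (All.map (λ h → ≤-trans h (+-monoʳ-≤ t (n≤1+n i))) size′) sizeᵗ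
        (covers-swap (All.map proj₂ (shrink-All 𝓣 i))) restᵗ
    }
    where
    open Peeled p
    𝓢′ = shrink 𝓣 i
    size′ = All.map proj₁ (shrink-All 𝓣 i)

  removedFrom : ℕ → ℕ → ℕ
  removedFrom i zero    = 0
  removedFrom i (suc d) = removed (suc i) + removedFrom (suc i) d

  peel : ∀ {𝓕 𝓖 : Family n} (𝓕? : Decidable 𝓕) (𝓖? : Decidable 𝓖) → 0 < t → 𝓕 ⊆ᶠ Uniform n k → 𝓖 ⊆ᶠ Uniform n k →
    CrossIntersecting t 𝓕 𝓖 → ∀ d i → k ≡ t + (i + d) → Peeled 𝓕 𝓖 i (removedFrom i d)
  peel 𝓕? 𝓖? 0<t 𝓕⊆ 𝓖⊆ cr zero i e = record
    { 𝓢     = members 𝓕?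
    ; 𝓣     = members 𝓖?
    ; sizeˢ = All.map (λ f → ≤-reflexive (trans (𝓕⊆ f) e′)) (All.all-filter 𝓕? (allSubsets n))
    ; sizeᵗ = All.map (λ g → ≤-reflexive (trans (𝓖⊆ g) e′)) (All.all-filter 𝓖? (allSubsets n))
    ; cross = All.map (λ f → All.map (cr f) (All.all-filter 𝓖? (allSubsets n))) (All.all-filter 𝓕? (allSubsets n))
    ; restˢ = ≼-empty λ (f , ¬a) → ¬a (lose (∈-filter⁺ 𝓕? (∈-allSubsets _) f) ⊆-refl)
    ; restᵗ = ≼-empty λ (g , ¬a) → ¬a (lose (∈-filter⁺ 𝓖? (∈-allSubsets _) g) ⊆-refl)
    }
    where
    e′ = trans e (cong (t +_) (+-identityʳ i))
  peel 𝓕? 𝓖? 0<t 𝓕⊆ 𝓖⊆ cr (suc d) i e =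
    peel-step 0<t (peel 𝓕? 𝓖? 0<t 𝓕⊆ 𝓖⊆ cr d (suc i) (trans e (cong (t +_) (+-suc i d))))

-- Estimates

-- Replaces subtracting the known inequality `A ≤ B`: its sides are added crosswise to the goal,
-- where they can be matched by a ring identity.
move : ∀ {A B x y} → A ≤ B → x + B ≤ y + A → x ≤ y
move {A} {B} {x} {y} h e = +-cancelʳ-≤ A x y (≤-trans (+-monoʳ-≤ x h) e)

absorption : ∀ n k → suc k * (suc n C suc k) ≡ suc n * (n C k)
absorption zero zero = refl
absorption zero (suc k) = trans (cong (suc (suc k) *_) (k>n⇒nCk≡0 {1} {suc (suc k)} (s≤s (s≤s z≤n))))
  (trans (*-zeroʳ (suc (suc k))) (sym (trans (*-identityˡ _) (k>n⇒nCk≡0 {0} {suc k} (s≤s z≤n)))))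
absorption (suc n) zero = trans (*-identityˡ _) (trans (nC1≡n (suc (suc n))) (sym (*-identityʳ _)))
absorption (suc n) (suc k) = trans (cong (suc (suc k) *_) (sym (nCk+nC[k+1]≡[n+1]C[k+1] (suc n) (suc k))))
  (trans (lem₁ (suc k) (suc n C suc k) (suc n C suc (suc k)))
  (trans (cong₂ (λ u v → suc n C suc k + u + v) (absorption n k) (absorption n (suc k)))
  (trans (lem₂ (suc n) (suc n C suc k) (n C k) (n C suc k)) (cong (λ u → suc n C suc k + suc n * u)
      (nCk+nC[k+1]≡[n+1]C[k+1] n k)))))
  where
  lem₁ : ∀ j p q → suc j * (p + q) ≡ p + j * p + suc j * q
  lem₁ = solve-∀
  lem₂ : ∀ s p a b → p + s * a + s * b ≡ p + s * (a + b)
  lem₂ = solve-∀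

-- Pascal's rule applied `d` times: every increment is at least the first one, `x C c`.
-- `C-increment` bounds the same increments from above by a common `y C c`.
C-convex : ∀ d x c → x C suc c + d * (x C c) ≤ (d + x) C suc c
C-convex zero    x c = ≤-reflexive (+-identityʳ _)
C-convex (suc d) x c = ≤-trans (≤-reflexive (lem (x C suc c) (x C c) (d * (x C c))))
  (≤-trans (+-mono-≤ (C-monoˡ-≤ c (m≤n+m x d)) (C-convex d x c)) (≤-reflexive (nCk+nC[k+1]≡[n+1]C[k+1] (d + x) c)))
  where
  lem : ∀ a b e → a + (b + e) ≡ b + (a + e)
  lem = solve-∀

C-increment : ∀ d x y c → d + x ≤ suc y → (d + x) C suc c ≤ x C suc c + d * (y C c)
C-increment zero    x y c _ = ≤-reflexive (sym (+-identityʳ _))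
C-increment (suc d) x y c (s≤s h) = ≤-trans (≤-reflexive (sym (nCk+nC[k+1]≡[n+1]C[k+1] (d + x) c)))
  (≤-trans (+-mono-≤ (C-monoˡ-≤ c h) (C-increment d x y c (m≤n⇒m≤1+n h))) (≤-reflexive (lem (y C c) (x C suc c) (d * (y C c)))))
  where
  lem : ∀ a b e → a + (b + e) ≡ b + (a + e)
  lem = solve-∀

-- The cleared form of `(1 + 1/j)^i ≤ 1 + i/j + (i/j)²` for `i ≤ j`. At `i = j` it yields
-- `(1 + 1/j)^j ≤ 3` without any analysis.
[1+j]^i≤ : ∀ j i → i ≤ j → suc j ^ i * (j * j) ≤ (j * j + i * j + i * i) * j ^ i
[1+j]^i≤ j zero    _ = ≤-reflexive (lem (j * j))
  where
  lem : ∀ q → 1 * q ≡ (q + 0 + 0) * 1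
  lem = solve-∀
[1+j]^i≤ j (suc i) h = begin
  suc j * suc j ^ i * (j * j)                         ≡⟨ *-assoc (suc j) (suc j ^ i) (j * j) ⟩
  suc j * (suc j ^ i * (j * j))                       ≤⟨ *-monoʳ-≤ (suc j) ([1+j]^i≤ j i (<⇒≤ h)) ⟩
  suc j * ((j * j + i * j + i * i) * j ^ i)           ≡⟨ *-assoc (suc j) (j * j + i * j + i * i) (j ^ i) ⟨
  suc j * (j * j + i * j + i * i) * j ^ i             ≤⟨ *-monoˡ-≤ (j ^ i) (poly′ j (<⇒≤ h)) ⟩
  (j * j + suc i * j + suc i * suc i) * j * j ^ i     ≡⟨ *-assoc (j * j + suc i * j + suc i * suc i) j (j ^ i) ⟩
  (j * j + suc i * j + suc i * suc i) * (j * j ^ i)   ∎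
  where
  open ≤-Reasoning
  -- With `j = i + e` the two sides differ by `i * e + (i + e)`, which has no negative term.
  poly : ∀ i e → suc (i + e) * ((i + e) * (i + e) + i * (i + e) + i * i) + (i * e + (i + e))
    ≡ ((i + e) * (i + e) + suc i * (i + e) + suc i * suc i) * (i + e)
  poly = solve-∀
  poly′ : ∀ e → i ≤ e → suc e * (e * e + i * e + i * i) ≤ (e * e + suc i * e + suc i * suc i) * e
  poly′ e i≤e = subst (λ e → suc e * (e * e + i * e + i * i) ≤ (e * e + suc i * e + suc i * suc i) * e) (m+[n∸m]≡n i≤e)
    (m+n≤o⇒m≤o _ (≤-reflexive (poly i (e ∸ i))))

[1+j]^j≤3j^j : ∀ j → suc (suc j) ^ suc j ≤ 3 * suc j ^ suc j
[1+j]^j≤3j^j j = go (suc j)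
  where
  lem : ∀ q p → (q + q + q) * p ≡ 3 * p * q
  lem = solve-∀
  go : ∀ j .{{_ : NonZero j}} → suc j ^ j ≤ 3 * j ^ j
  go j@(suc _) = *-cancelʳ-≤ (suc j ^ j) (3 * j ^ j) (j * j) (≤-trans ([1+j]^i≤ j j ≤-refl) (≤-reflexive (lem (j * j) (j ^ j))))

C-ratio : ∀ t i → ((t + suc i) C t) * suc i ≡ ((t + i) C t) * (t + suc i)
C-ratio t i = trans (cong (_* suc i) (flip-C (suc i))) (trans (*-comm _ (suc i))
  (trans (cong (λ u → suc i * (u C suc i)) (+-suc t i)) (trans (absorption (t + i) i)
    (trans (*-comm (suc (t + i)) _) (cong₂ _*_ (sym (flip-C i)) (sym (+-suc t i)))))))
  where
  flip-C : ∀ j → (t + j) C t ≡ (t + j) C j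
  flip-C j = trans (nCk≡nC[n∸k] (m≤m+n t j)) (cong ((t + j) C_) (m+n∸m≡n t j))

-- Here k - t = 2 + r′ and n - t = 4 + r′ + x, and w is an integer lower bound
-- for the factor max {30 (t + 2), 2 e k} of the threshold.
module Estimates (n k t r′ x w : ℕ)
  (k≡ : k ≡ t + suc (suc r′)) (n≡ : n ≡ t + suc (suc (suc (suc r′) + x))) (2≤t : 2 ≤ t) (w-t : 30 * (t + 2) ≤ w)
      (w-k : 5 * (t + suc (suc r′)) ≤ w)
  (w-n : w * suc (suc r′) ≤ suc (suc (suc (suc r′) + x))) where

  r m : ℕ
  r = suc (suc r′)
  m = suc (suc (r + x))

  open Cost n k
  open Peeling n k t

  N₁ N₂ : ℕ
  N₁ = N (t + 1)
  N₂ = N (t + 2)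

  N-shift : ∀ d → N (t + d) ≡ (m ∸ d) C (r ∸ d)
  N-shift d = cong₂ _C_ (trans (cong (_∸ (t + d)) n≡) ([m+n]∸[m+o]≡n∸o t m d)) (trans (cong (_∸ (t + d)) k≡)
      ([m+n]∸[m+o]≡n∸o t r d))

  0<w : 0 < w
  0<w = ≤-trans (≤-trans (s≤s z≤n) (*-monoʳ-≤ 30 (m≤n+m 2 t))) w-t

  -- The quotient of the two values is `(m - d) / (r - d)`. As `r ≤ m`, it is smallest at `d = 0`,
  -- where it equals `m / r ≥ w`.
  N-step : ∀ d → d < r → w * N (t + suc d) ≤ N (t + d)
  N-step d d<r with m≤n⇒∃[o]m+o≡n d<r
  ... | b , eb with m≤n⇒∃[o]m+o≡n (≤-trans d<r (≤-trans (≤-trans (≤-reflexive (sym (*-identityˡ r))) (*-monoˡ-≤ r 0<w)) w-n))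
  ...   | a , ea = *-cancelˡ-≤ (suc b) (begin
    suc b * (w * N (t + suc d)) ≡⟨ cong (λ u → suc b * (w * u)) (trans (N-shift (suc d)) (cong₂ _C_ (ε₁ ea) (ε₁ eb))) ⟩
    suc b * (w * (a C b))       ≡⟨ lem (suc b) w (a C b) ⟩
    (w * suc b) * (a C b)       ≤⟨ *-monoˡ-≤ (a C b) wb≤a ⟩
    suc a * (a C b)             ≡⟨ absorption a b ⟨
    suc b * (suc a C suc b)     ≡⟨ cong (suc b *_) (trans (N-shift d) (cong₂ _C_ (ε₂ ea) (ε₂ eb))) ⟨
    suc b * N (t + d)           ∎)
    where
    open ≤-Reasoning
    lem : ∀ b w z → b * (w * z) ≡ (w * b) * z
    lem = solve-∀
    ε₁ : ∀ {a m} → suc d + a ≡ m → m ∸ suc d ≡ a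
    ε₁ {a} refl = m+n∸m≡n (suc d) a
    ε₂ : ∀ {a m} → suc d + a ≡ m → m ∸ d ≡ suc a
    ε₂ {a} refl = trans (cong (_∸ d) (sym (+-suc d a))) (m+n∸m≡n d (suc a))
    wb≤a : w * suc b ≤ suc a
    wb≤a = +-cancelˡ-≤ (w * d) _ _ (begin
      w * d + w * suc b ≡⟨ *-distribˡ-+ w d (suc b) ⟨
      w * (d + suc b)   ≡⟨ cong (w *_) (trans (+-suc d b) eb) ⟩
      w * r             ≤⟨ w-n ⟩
      m                 ≡⟨ trans (+-suc d a) ea ⟨
      d + suc a         ≤⟨ +-monoˡ-≤ (suc a) (≤-trans (≤-reflexive (sym (*-identityˡ d))) (*-monoˡ-≤ d 0<w)) ⟩
      w * d + suc a     ∎)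

  N-decay : ∀ c → suc c ≤ r → w ^ c * N (t + suc c) ≤ N₁
  N-decay zero    _ = ≤-reflexive (*-identityˡ N₁)
  N-decay (suc c) h = ≤-trans (≤-reflexive (lem w (w ^ c) _))
    (≤-trans (*-monoʳ-≤ (w ^ c) (N-step (suc c) h)) (N-decay c (<⇒≤ h)))
    where
    lem : ∀ a b z → (a * b) * z ≡ b * (a * z)
    lem = solve-∀

  wN₂≤N₁ : w * N₂ ≤ N₁
  wN₂≤N₁ = N-step 1 (s≤s (s≤s z≤n))

  N₁≡ : N₁ ≡ suc (r + x) C suc r′
  N₁≡ = N-shift 1

  N₂≡ : N₂ ≡ (r + x) C r′
  N₂≡ = N-shift 2

  0<N₁ : 0 < N₁
  0<N₁ = ≤-trans (s≤s z≤n) (≤-trans (≤-reflexive (sym (nCn≡1 (suc r′))))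
    (≤-trans (C-monoˡ-≤ (suc r′) (≤-trans (n≤1+n _) (≤-trans (m≤m+n r x) (n≤1+n _)))) (≤-reflexive (sym N₁≡))))

  -- From `i` to `i + 1` the binomial grows by `(t + i + 1) / (i + 1)`, the power by at most
  -- `3 (i + 1)`, and `N` shrinks by `w`; the factor `i + 1` cancels.
  removed-ratio : ∀ i → suc i ≤ r → w * removed (suc i) ≤ 3 * (t + suc i) * removed i
  removed-ratio i h = begin
    w * (((t + suc i) C t) * (suc (suc i) ^ suc i * N (t + suc i)))   ≡⟨ lem₁ w ((t + suc i) C t) (suc (suc i) ^ suc i)
        (N (t + suc i)) ⟩
    ((t + suc i) C t) * (suc (suc i) ^ suc i * (w * N (t + suc i)))   ≤⟨ *-monoʳ-≤ ((t + suc i) C t)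
        (*-mono-≤ ([1+j]^j≤3j^j i) (N-step i h)) ⟩
    ((t + suc i) C t) * ((3 * (suc i * suc i ^ i)) * N (t + i))       ≡⟨ lem₂ ((t + suc i) C t) (suc i) (suc i ^ i) (N (t + i)) ⟩
    (((t + suc i) C t) * suc i) * (3 * (suc i ^ i * N (t + i)))       ≡⟨ cong (_* (3 * (suc i ^ i * N (t + i)))) (C-ratio t i) ⟩
    (((t + i) C t) * (t + suc i)) * (3 * (suc i ^ i * N (t + i)))     ≡⟨ lem₃ ((t + i) C t) (t + suc i) (suc i ^ i * N (t + i)) ⟩
    3 * (t + suc i) * removed i                                       ∎
    where
    open ≤-Reasoning
    lem₁ : ∀ w c s z → w * (c * (s * z)) ≡ c * (s * (w * z))
    lem₁ = solve-∀
    lem₂ : ∀ c j s z → c * ((3 * (j * s)) * z) ≡ (c * j) * (3 * (s * z))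
    lem₂ = solve-∀
    lem₃ : ∀ c j z → (c * j) * (3 * z) ≡ 3 * j * (c * z)
    lem₃ = solve-∀

  5removed≤3removed : ∀ i → suc i ≤ r → 5 * removed (suc i) ≤ 3 * removed i
  5removed≤3removed i h = *-cancelˡ-≤ (suc (t + i)) (begin
    suc (t + i) * (5 * removed (suc i)) ≡⟨ lem (suc (t + i)) (removed (suc i)) ⟩
    5 * suc (t + i) * removed (suc i)   ≡⟨ cong (λ u → 5 * u * removed (suc i)) (sym (+-suc t i)) ⟩
    5 * (t + suc i) * removed (suc i)   ≤⟨ *-monoˡ-≤ (removed (suc i)) (≤-trans (*-monoʳ-≤ 5 (+-monoʳ-≤ t h)) w-k) ⟩
    w * removed (suc i)                 ≤⟨ removed-ratio i h ⟩
    3 * (t + suc i) * removed i         ≡⟨ cong (λ u → 3 * u * removed i) (+-suc t i) ⟩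
    3 * suc (t + i) * removed i         ≡⟨ lem′ (suc (t + i)) (removed i) ⟩
    suc (t + i) * (3 * removed i)       ∎)
    where
    open ≤-Reasoning
    lem : ∀ a b → a * (5 * b) ≡ 5 * a * b
    lem = solve-∀
    lem′ : ∀ a b → 3 * a * b ≡ a * (3 * b)
    lem′ = solve-∀

  -- The first ratio is bounded with `30 (t + 2)` instead of `5 k`:
  -- `3 (t + 3) / (30 (t + 2)) ≤ 1/8`, with equality at `t = 2`.
  8removed₃≤removed₂ : 3 ≤ r → 8 * removed 3 ≤ removed 2
  8removed₃≤removed₂ h = *-cancelˡ-≤ (3 * suc (t + 2)) (begin
    3 * suc (t + 2) * (8 * removed 3)   ≡⟨ lem t (removed 3) ⟩
    (24 * t + 72) * removed 3           ≤⟨ *-monoˡ-≤ (removed 3) 24t+72≤ ⟩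
    30 * (t + 2) * removed 3            ≤⟨ *-monoˡ-≤ (removed 3) w-t ⟩
    w * removed 3                       ≤⟨ removed-ratio 2 h ⟩
    3 * (t + 3) * removed 2             ≡⟨ cong (λ u → 3 * u * removed 2) (+-suc t 2) ⟩
    3 * suc (t + 2) * removed 2         ∎)
    where
    open ≤-Reasoning
    lem : ∀ t z → 3 * suc (t + 2) * (8 * z) ≡ (24 * t + 72) * z
    lem = solve-∀
    lem′ : ∀ t → 24 * t + 72 + 6 * t ≡ 30 * (t + 2) + 6 * 2
    lem′ = solve-∀
    24t+72≤ : 24 * t + 72 ≤ 30 * (t + 2)
    24t+72≤ = move (*-monoʳ-≤ 6 2≤t) (≤-reflexive (lem′ t))

  -- `removed 2` is `(t + 1) (t + 2) / 2` times `9 N₂`, and `N₂ ≤ N₁ / (30 (t + 2))`; the constant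
  -- is `9/60 = 3/20`.
  20removed₂≤ : 20 * removed 2 ≤ 3 * (t + 1) * N₁
  20removed₂≤ = begin
    20 * (((t + 2) C t) * (9 * N₂))         ≡⟨ lem₁ ((t + 2) C t) N₂ ⟩
    (((t + 2) C t) * 2) * (90 * N₂)         ≡⟨ cong (_* (90 * N₂)) (trans (C-ratio t 1) (cong (_* (t + 2)) tC1)) ⟩
    ((t + 1) * (t + 2)) * (90 * N₂)         ≡⟨ lem₂ (t + 1) (t + 2) N₂ ⟩
    3 * (t + 1) * (30 * (t + 2) * N₂)       ≤⟨ *-monoʳ-≤ (3 * (t + 1)) (≤-trans (*-monoˡ-≤ N₂ w-t) wN₂≤N₁) ⟩
    3 * (t + 1) * N₁                        ∎
    where
    open ≤-Reasoning
    lem₁ : ∀ c z → 20 * (c * (9 * z)) ≡ (c * 2) * (90 * z)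
    lem₁ = solve-∀
    lem₂ : ∀ a b z → (a * b) * (90 * z) ≡ 3 * a * (30 * b * z)
    lem₂ = solve-∀
    tC1 : (t + 1) C t ≡ t + 1
    tC1 = trans (sym (*-identityʳ _))
        (trans (C-ratio t 0) (trans (cong (_* (t + 1)) (trans (cong (_C t) (+-identityʳ t)) (nCn≡1 t))) (*-identityˡ _)))

  -- A geometric series of ratio `3/5`, whose sum is at most `5/2` times its first term.
  removedFrom-≤ : ∀ i d → suc i + d ≡ r → 2 * removedFrom (suc i) d ≤ 5 * removed (suc (suc i))
  removedFrom-≤ i zero    _ = z≤n
  removedFrom-≤ i (suc zero) _ = m+n≤o⇒m≤o _ (≤-reflexive (lem (removed (suc (suc i)))))
    where
    lem : ∀ z → 2 * (z + 0) + 3 * z ≡ 5 * z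
    lem = solve-∀
  removedFrom-≤ i (suc d@(suc d′)) e = ≤-trans (≤-reflexive (*-distribˡ-+ 2 (removed (suc (suc i))) (removedFrom (suc (suc i)) d)))
    (≤-trans (+-monoʳ-≤ (2 * removed (suc (suc i))) (≤-trans (removedFrom-≤ (suc i) d (trans (sym (+-suc (suc i) d)) e))
      (5removed≤3removed (suc (suc i)) (≤-trans (m≤m+n (3 + i) d′) (≤-reflexive (trans (lem i d′) e))))))
    (≤-reflexive (lem′ (removed (suc (suc i))))))
    where
    lem : ∀ i d → 3 + i + d ≡ suc i + suc (suc d)
    lem = solve-∀
    lem′ : ∀ z → 2 * z + 3 * z ≡ 5 * z
    lem′ = solve-∀

  E : ℕ
  E = removedFrom 1 (suc r′)

  -- `1 + (5/2) (1/8) = 21/16`: the first term, and a tail of at most `5/2` times `removed 3`.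
  16E≤21removed₂ : 16 * E ≤ 21 * removed 2
  16E≤21removed₂ = go r′ refl
    where
    lem : ∀ a b → 16 * (a + b) ≡ 16 * a + 8 * (2 * b)
    lem = solve-∀
    lem₁ : ∀ a → 8 * (5 * a) ≡ 5 * (8 * a)
    lem₁ = solve-∀
    lem₂ : ∀ a → 16 * a + 5 * a ≡ 21 * a
    lem₂ = solve-∀
    go : ∀ d → d ≡ r′ → 16 * (removed 2 + removedFrom 2 d) ≤ 21 * removed 2
    go zero    _ = ≤-trans (≤-reflexive (cong (16 *_) (+-identityʳ (removed 2)))) (*-monoˡ-≤ (removed 2) (m≤n+m 16 5))
    go (suc d) e = ≤-trans (≤-reflexive (lem (removed 2) _)) (≤-trans (+-monoʳ-≤ (16 * removed 2)
      (≤-trans (*-monoʳ-≤ 8 (removedFrom-≤ 1 (suc d) (cong (λ u → suc (suc u)) e)))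
      (≤-trans (≤-reflexive (lem₁ (removed 3)))
          (*-monoʳ-≤ 5 (8removed₃≤removed₂ (s≤s (s≤s (≤-trans (s≤s z≤n) (≤-reflexive e)))))))))
      (≤-reflexive (lem₂ (removed 2))))

  -- `(21/16) (3/20) = 63/320`, just below `1/5 = 64/320`.
  5E≤ : 5 * E ≤ (t + 1) * N₁
  5E≤ = *-cancelˡ-≤ 64 (begin
    64 * (5 * E)               ≡⟨ lem₁ E ⟩
    20 * (16 * E)              ≤⟨ *-monoʳ-≤ 20 16E≤21removed₂ ⟩
    20 * (21 * removed 2)      ≡⟨ lem₂ (removed 2) ⟩
    21 * (20 * removed 2)      ≤⟨ *-monoʳ-≤ 21 20removed₂≤ ⟩
    21 * (3 * (t + 1) * N₁)    ≤⟨ m≤m+n _ ((t + 1) * N₁) ⟩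
    21 * (3 * (t + 1) * N₁) + (t + 1) * N₁ ≡⟨ lem₃ (t + 1) N₁ ⟩
    64 * ((t + 1) * N₁)        ∎)
    where
    open ≤-Reasoning
    lem₁ : ∀ e → 64 * (5 * e) ≡ 20 * (16 * e)
    lem₁ = solve-∀
    lem₂ : ∀ e → 20 * (21 * e) ≡ 21 * (20 * e)
    lem₂ = solve-∀
    lem₃ : ∀ a b → 21 * (3 * a * b) + a * b ≡ 64 * (a * b)
    lem₃ = solve-∀

  -- The k-sets containing a (t + 1)-set and avoiding r + 1 further points.
  N₁′ : ℕ
  N₁′ = x C suc r′

  -- Avoiding `r + 1` points costs at most `(r + 1) N₂`, and `w ≥ 5 (t + r) ≥ 5 (r + 1)` makes this
  -- at most a fifth of `N₁`.
  4N₁≤5N₁′ : 4 * N₁ ≤ 5 * N₁′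
  4N₁≤5N₁′ = move {A = 5 * (suc r) * N₂} {B = N₁} {x = 4 * N₁}
    (≤-trans (*-monoˡ-≤ N₂ (≤-trans (*-monoʳ-≤ 5 (≤-trans (+-monoˡ-≤ r (≤-trans (s≤s z≤n) 2≤t)) ≤-refl)) w-k)) wN₂≤N₁)
    (≤-trans (≤-reflexive (lem N₁)) (≤-trans (*-monoʳ-≤ 5 incr) (≤-reflexive (lem′ N₁′ (suc r) N₂))))
    where
    lem : ∀ a → 4 * a + a ≡ 5 * a
    lem = solve-∀
    lem′ : ∀ a r b → 5 * (a + r * b) ≡ 5 * a + 5 * r * b
    lem′ = solve-∀
    incr : N₁ ≤ N₁′ + suc r * N₂
    incr = subst₂ (λ u v → u ≤ N₁′ + suc r * v) (sym N₁≡) (sym N₂≡) (C-increment (suc r) x (r + x) r′ ≤-refl)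

  -- By `C-convex` the star has at least `(r + 1) N₁′` members.
  star-size≥ : ∀ {s} → s + suc x C r ≡ (suc r + suc x) C r → 4 * suc r * N₁ ≤ 5 * s
  star-size≥ {s} e = begin
    4 * suc r * N₁          ≡⟨ lem (suc r) N₁ ⟩
    suc r * (4 * N₁)        ≤⟨ *-monoʳ-≤ (suc r) (≤-trans 4N₁≤5N₁′ (*-monoʳ-≤ 5 (C-monoˡ-≤ (suc r′) (n≤1+n x)))) ⟩
    suc r * (5 * (suc x C suc r′)) ≡⟨ lem′ (suc r) (suc x C suc r′) ⟩
    5 * (suc r * (suc x C suc r′)) ≤⟨ *-monoʳ-≤ 5 (+-cancelʳ-≤ (suc x C r) _ _ (≤-trans (≤-reflexive (+-comm _ (suc x C r)))
                                   (≤-trans (C-convex (suc r) (suc x) (suc r′)) (≤-reflexive (sym e))))) ⟩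
    5 * s                   ∎
    where
    open ≤-Reasoning
    lem : ∀ a b → 4 * a * b ≡ a * (4 * b)
    lem = solve-∀
    lem′ : ∀ a b → a * (5 * b) ≡ 5 * (a * b)
    lem′ = solve-∀

  -- With `Q = N₁ - N₂` the size of `𝓐` is `(t + 1) Q + N₁`, hence at least
  -- `(t + 2) N₁ - (t + 2) N₂`, and `(t + 2) N₂ ≤ N₁ / 30`.
  nearly-size≥ : ∀ {a} → a + (r + x) C suc r′ ≡ (t + 2) * ((r + x) C suc r′) + suc (r + x) C suc r′ → 30 *
      (t + 2) * N₁ ≤ 30 * a + N₁
  nearly-size≥ {a} e = bound ((r + x) C suc r′) (trans (cong (_+ (r + x) C suc r′) N₂≡)
      (trans (nCk+nC[k+1]≡[n+1]C[k+1] (r + x) r′) (sym N₁≡)))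
    (subst (λ u → a + (r + x) C suc r′ ≡ (t + 2) * ((r + x) C suc r′) + u) (sym N₁≡) e)
    where
    bound : ∀ Q → N₂ + Q ≡ N₁ → a + Q ≡ (t + 2) * Q + N₁ → 30 * (t + 2) * N₁ ≤ 30 * a + N₁
    bound Q e₁ e₂ = move (≤-trans (*-monoˡ-≤ N₂ w-t) wN₂≤N₁) (≤-trans (m≤m+n _ (30 * N₂))
        (≤-reflexive (+-cancelʳ-≡ (30 * Q) _ _ (begin-equality
      30 * (t + 2) * N₁ + N₁ + 30 * N₂ + 30 * Q           ≡⟨ l₁ (30 * (t + 2) * N₁ + N₁) N₂ Q ⟩
      30 * (t + 2) * N₁ + N₁ + 30 * (N₂ + Q)              ≡⟨ cong₂ (λ u v → 30 * (t + 2) * u + N₁ + 30 * v) (sym e₁) e₁ ⟩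
      30 * (t + 2) * (N₂ + Q) + N₁ + 30 * N₁              ≡⟨ l₂ t N₂ Q N₁ ⟩
      30 * ((t + 2) * Q + N₁) + N₁ + 30 * (t + 2) * N₂    ≡⟨ cong (λ u → 30 * u + N₁ + 30 * (t + 2) * N₂) e₂ ⟨
      30 * (a + Q) + N₁ + 30 * (t + 2) * N₂               ≡⟨ l₃ a Q N₁ (30 * (t + 2) * N₂) ⟩
      30 * a + N₁ + 30 * (t + 2) * N₂ + 30 * Q            ∎))))
      where
      open ≤-Reasoning
      l₁ : ∀ s p q → s + 30 * p + 30 * q ≡ s + 30 * (p + q)
      l₁ = solve-∀
      l₂ : ∀ t p q z → 30 * (t + 2) * (p + q) + z + 30 * z ≡ 30 * ((t + 2) * q + z) + z + 30 * (t + 2) * p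
      l₂ = solve-∀
      l₃ : ∀ a q z y → 30 * (a + q) + z + y ≡ 30 * a + z + y + 30 * q
      l₃ = solve-∀

-- Cross t-intersecting families of (t + 1)-sets

module Structure (n k t : ℕ) where

  open Cost n k
  open Peeling n k t using (Covers; covers-swap)

  Generated : List (Subset n) → Family n
  Generated 𝓢 F = Any (_⊆ F) 𝓢

  -- The number three is dictated by `occurs`, where three of four candidate generators remain once
  -- one is absent.
  Rich : List (Subset n) → Set
  Rich 𝓢 = ¬ (Generated 𝓢 ≼ 3 * N (t + 1))

  Exact : List (Subset n) → Set
  Exact = All (λ A → ∣ A ∣ ≡ t + 1)

  t+1≤ : t + 1 ≤ suc t
  t+1≤ = ≤-reflexive (+-comm t 1)

  generated-by : ∀ {𝓢 𝓑} → All (λ A → Any (_⊆ A) 𝓑) 𝓢 → ∀ {F} → Generated 𝓢 F → Generated 𝓑 F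
  generated-by h g with find g
  ... | A , A∈ , A⊆F = Any.map (λ B⊆A {x} m → A⊆F (B⊆A m)) (All.lookup h A∈)

  generated-≼ : ∀ {j} 𝓑 → All (λ B → ∣ B ∣ ≡ j) 𝓑 → Generated 𝓑 ≼ length 𝓑 * N j
  generated-≼ 𝓑 sizes = ≼-branch 𝓑 (λ B F → B ⊆ F) (λ _ g → g) (All.map (λ {B} e → ≼-supersets B e id) sizes)

  ≤3N₁ : ∀ {c} → c ≤ 3 → c * N (t + 1) ≤ 3 * N (t + 1)
  ≤3N₁ = *-monoˡ-≤ (N (t + 1))

  -- Otherwise `𝓑` would generate everything that `𝓢` generates. Empty `𝓑` yields a member of `𝓢`,
  -- and a singleton yields a member different from it.
  escape : ∀ {𝓢} 𝓑 → Rich 𝓢 → Exact 𝓑 → length 𝓑 ≤ 3 → ∃[ A ] (A ∈ˡ 𝓢 × ¬ Any (_⊆ A) 𝓑)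
  escape {𝓢} 𝓑 rich sizes len with any? (λ A → ¬? (any? (_⊆? A) 𝓑)) 𝓢
  ... | yes h = find h
  ... | no ¬h = ⊥-elim (rich (≼-mono (≤3N₁ len) (≼-⊆ (λ _ → generated-by
    (All.map (λ {A} → decidable-stable (any? (_⊆? A) 𝓑)) (All.¬Any⇒All¬ 𝓢 ¬h))) (generated-≼ 𝓑 sizes))))

  HasStar : List (Subset n) → List (Subset n) → Set
  HasStar 𝓢 𝓣 = ∃[ X ] (∣ X ∣ ≡ t × All (X ⊆_) 𝓢 × All (X ⊆_) 𝓣)

  HasClique : List (Subset n) → List (Subset n) → Set
  HasClique 𝓢 𝓣 = ∃[ Z ] (∣ Z ∣ ≡ t + 2 × All (_⊆ Z) 𝓢 × All (_⊆ Z) 𝓣)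

  -- All of `𝓣` contains `X`. If some `A` in `𝓢` missed a point `x` of `X`, each `B` in `𝓣` would
  -- lie in `A ∪ ⁅ x ⁆` and properly contain `X`, so at most three sets `X ∪ ⁅ y ⁆` would generate
  -- `𝓣`.
  small⇒star : ∀ {𝓢 𝓣} → All (λ A → ∣ A ∣ ≤ t + 1) 𝓢 → All (λ B → ∣ B ∣ ≤ t + 1) 𝓣 → All (Covers 𝓣) 𝓢 → Rich 𝓣 →
    ∀ {X} → X ∈ˡ 𝓢 → ∣ X ∣ ≤ t → HasStar 𝓢 𝓣
  small⇒star {𝓢} {𝓣} sizeˢ sizeᵗ cross rich {X} X∈ X≤t =
    X , X≡t , All.tabulate (λ {A} A∈ → ⊆-stable A (inS A∈)) , X⊆T
    where
    X⊆T : All (X ⊆_) 𝓣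
    X⊆T = All.map {Q = X ⊆_} (λ {B} t≤ → ∣Z∣≤∣F∩Z∣⇒Z⊆F {F = B} (≤-trans X≤t (≤-trans t≤ (≤-reflexive (∩-comm-∣∣ X B)))))
        (All.lookup cross X∈)
    X≡t : ∣ X ∣ ≡ t
    X≡t with escape [] rich [] z≤n
    ... | B , B∈ , _ = ≤-antisym X≤t (≤-trans (All.lookup (All.lookup cross X∈) B∈) (∣p∩q∣≤∣p∣ X B))
    ⊆-stable : ∀ A → ¬ ¬ (X ⊆ A) → X ⊆ A
    ⊆-stable A = decidable-stable (X ⊆? A)
    inS : ∀ {A} → A ∈ˡ 𝓢 → ¬ ¬ (X ⊆ A)
    inS {A} A∈ X⊈A with ⊈⇒∃ X A X⊈A
    ... | x , x∈X , x∉A = rich (≼-mono (≤3N₁ len) (≼-branch (elements (U ─ X)) (λ y F → X ∪ ⁅ y ⁆ ⊆ F) (λ _ → branch)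
        (All.map (λ {y} y∈ → ≼-supersets (X ∪ ⁅ y ⁆) (trans (∣p∪⁅x⁆∣ (x∈p─q⇒x∉q U X y∈))
            (trans (cong suc X≡t) (+-comm 1 t))) id) (elements⊆ (U ─ X)))))
      where
      U = A ∪ ⁅ x ⁆
      X⊆B : ∀ {B} → B ∈ˡ 𝓣 → X ⊆ B
      X⊆B B∈ = All.lookup X⊆T B∈
      B⊆U : ∀ {B} → B ∈ˡ 𝓣 → B ⊆ U
      B⊆U B∈ {y} y∈B with y ≟ᶠ x
      ... | yes refl = q⊆p∪q A ⁅ x ⁆ (x∈⁅x⁆ x)
      ... | no y≢x = p⊆p∪q ⁅ x ⁆ (one-of-two (All.lookup (All.lookup cross A∈) B∈) (≤-trans (All.lookup sizeᵗ B∈) t+1≤)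
        (X⊆B B∈ x∈X) y∈B (y≢x ∘ sym) x∉A)
      X⊆U : X ⊆ U
      X⊆U with escape [] rich [] z≤n
      ... | B , B∈ , _ = B⊆U B∈ ∘ X⊆B B∈
      len : length (elements (U ─ X)) ≤ 3
      len = ≤-trans (≤-reflexive (length-elements (U ─ X))) (+-cancelʳ-≤ t _ _ (≤-trans
        (≤-reflexive (trans (cong (∣ U ─ X ∣ +_) (sym (trans (∩-comm-∣∣ U X) (trans (∣p∩q∣≡∣p∣ X⊆U) X≡t)))) (∣p─q∣+∣p∩q∣≡∣p∣ U X)))
        (≤-trans (≤-reflexive (∣p∪⁅x⁆∣ x∉A)) (≤-trans (s≤s (All.lookup sizeˢ A∈)) (s≤s (≤-trans t+1≤ (n≤1+n _)))))))
      branch : ∀ {F} → Generated 𝓣 F → Any (λ y → X ∪ ⁅ y ⁆ ⊆ F) (elements (U ─ X))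
      branch {F} g with find g
      ... | B , B∈ , B⊆F with nonempty? (B ─ X)
      ...   | yes (y , y∈) = let (y∈B , y∉X) = x∈p─q⁻ B X y∈ in
        lose (∈⇒∈-elements (x∈p∧x∉q⇒x∈p─q (B⊆U B∈ y∈B) y∉X)) (λ {z} → ∪-least (B⊆F ∘ X⊆B B∈) (⁅⁆⊆ (B⊆F y∈B)) {z})
      ...   | no ¬e = ⊥-elim (x∉A (∣Z∣≤∣F∩Z∣⇒Z⊆F {F = A} {B} (≤-trans B≤t (All.lookup (All.lookup cross A∈) B∈)) (X⊆B B∈ x∈X)))
        where
        B≤t : ∣ B ∣ ≤ t
        B≤t = ≤-trans (p⊆q⇒∣p∣≤∣q∣ λ {z} z∈B → decidable-stable (z ∈? X) λ z∉X → ¬e (z , x∈p∧x∉q⇒x∈p─q z∈B z∉X)) X≤t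

  -- B loses at most one point of A₁ and at most one of A₂.
  core-bound : ∀ {A₁ A₂ B : Subset n} → ∣ B ∣ ≤ t + 1 → t ≤ ∣ B ∩ A₁ ∣ → t ≤ ∣ B ∩ A₂ ∣ →
    t ≤ suc ∣ B ∩ (A₁ ∩ A₂) ∣
  core-bound {A₁} {A₂} {B} B≤ h₁ h₂ = +-cancelˡ-≤ t _ _ (begin
    t + t                                            ≤⟨ +-mono-≤ h₁ h₂ ⟩
    ∣ B ∩ A₁ ∣ + ∣ B ∩ A₂ ∣                          ≡⟨ ∣p∪q∣+∣p∩q∣≡∣p∣+∣q∣ (B ∩ A₁) (B ∩ A₂) ⟨
    ∣ B ∩ A₁ ∪ B ∩ A₂ ∣ + ∣ (B ∩ A₁) ∩ (B ∩ A₂) ∣    ≤⟨ +-mono-≤ (p⊆q⇒∣p∣≤∣q∣ (∪-least (p∩q⊆p B A₁) (p∩q⊆p B A₂)))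
        (p⊆q⇒∣p∣≤∣q∣ sub) ⟩
    ∣ B ∣ + ∣ B ∩ (A₁ ∩ A₂) ∣                        ≤⟨ +-monoˡ-≤ _ B≤ ⟩
    t + 1 + ∣ B ∩ (A₁ ∩ A₂) ∣                        ≡⟨ +-assoc t 1 _ ⟩
    t + suc ∣ B ∩ (A₁ ∩ A₂) ∣                        ∎)
    where
    open ≤-Reasoning
    sub : (B ∩ A₁) ∩ (B ∩ A₂) ⊆ B ∩ (A₁ ∩ A₂)
    sub m = let (m₁ , m₂) = x∈p∩q⁻ (B ∩ A₁) (B ∩ A₂) m in
      x∈p∩q⁺ (proj₁ (x∈p∩q⁻ B A₁ m₁) , x∈p∩q⁺ (proj₂ (x∈p∩q⁻ B A₁ m₁) , proj₂ (x∈p∩q⁻ B A₂ m₂)))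

  core⊆ : ∀ {A₁ A₂ B : Subset n} → ∣ B ∣ ≤ t + 1 → t ≤ ∣ B ∩ A₁ ∣ → t ≤ ∣ B ∩ A₂ ∣ → ∣ A₁ ∩ A₂ ∣ < t → A₁ ∩ A₂ ⊆ B
  core⊆ {A₁} {A₂} {B} B≤ h₁ h₂ h = ∣Z∣≤∣F∩Z∣⇒Z⊆F {F = B} (s≤s⁻¹ (≤-trans h (core-bound {A₁} {A₂} {B} B≤ h₁ h₂)))

  -- If A₁ and A₂ had fewer than t common points, then all members of 𝓣 would
  -- be of the form (A₁ ∩ A₂) ∪ {x, y} with x ∈ A₁ ─ A₂ and y ∈ A₂ ─ A₁, two
  -- choices for each; as 𝓣 is rich all four occur, but then the members of 𝓢
  -- contain A₁ or A₂.
  module _ {𝓢 𝓣} (exactˢ : Exact 𝓢) (exactᵗ : Exact 𝓣) (cross : All (Covers 𝓣) 𝓢) (richˢ : Rich 𝓢) (richᵗ : Rich 𝓣) where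

    private
      t≤ : ∀ {A B} → A ∈ˡ 𝓢 → B ∈ˡ 𝓣 → t ≤ ∣ A ∩ B ∣
      t≤ A∈ B∈ = All.lookup (All.lookup cross A∈) B∈

      t≤′ : ∀ {A B} → A ∈ˡ 𝓢 → B ∈ˡ 𝓣 → t ≤ ∣ B ∩ A ∣
      t≤′ {A} {B} A∈ B∈ = ≤-trans (t≤ A∈ B∈) (≤-reflexive (∩-comm-∣∣ A B))

    intersecting : ∀ {A₁ A₂} → A₁ ∈ˡ 𝓢 → A₂ ∈ˡ 𝓢 → t ≤ ∣ A₁ ∩ A₂ ∣
    intersecting {A₁} {A₂} A₁∈ A₂∈ = ≮⇒≥ λ small → contra small
      where
      I U₁ U₂ : Subset n
      I  = A₁ ∩ A₂
      U₁ = A₁ ─ A₂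
      U₂ = A₂ ─ A₁

      G : Fin n → Fin n → Subset n
      G x y = (I ∪ ⁅ x ⁆) ∪ ⁅ y ⁆

      ∉I₁ : ∀ {x} → x ∈ U₁ → x ∉ I
      ∉I₁ x∈ m = x∈p─q⇒x∉q A₁ A₂ x∈ (p∩q⊆q A₁ A₂ m)

      ∉A₁ : ∀ {y} → y ∈ U₂ → y ∉ A₁
      ∉A₁ = x∈p─q⇒x∉q A₂ A₁

      ∈A₁ : ∀ {x} → x ∈ U₁ → x ∈ A₁
      ∈A₁ = p─q⊆p A₁ A₂

      Ix⊆A₁ : ∀ {x} → x ∈ U₁ → I ∪ ⁅ x ⁆ ⊆ A₁
      Ix⊆A₁ x∈ = ∪-least (p∩q⊆p A₁ A₂) (⁅⁆⊆ (∈A₁ x∈))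

      x∈G : ∀ x y → x ∈ G x y
      x∈G x y = p⊆p∪q ⁅ y ⁆ (q⊆p∪q I ⁅ x ⁆ (x∈⁅x⁆ x))

      y∈G : ∀ x y → y ∈ G x y
      y∈G x y = q⊆p∪q (I ∪ ⁅ x ⁆) ⁅ y ⁆ (x∈⁅x⁆ y)

      I⊆G : ∀ x y → I ⊆ G x y
      I⊆G x y m = p⊆p∪q ⁅ y ⁆ (p⊆p∪q ⁅ x ⁆ m)

      G⁻ : ∀ {x y z} → z ∈ G x y → z ∈ I ⊎ (z ≡ x ⊎ z ≡ y)
      G⁻ {x} {y} m with x∈p∪q⁻ (I ∪ ⁅ x ⁆) ⁅ y ⁆ m
      ... | inj₂ m′ = inj₂ (inj₂ (x∈⁅y⁆⇒x≡y y m′))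
      ... | inj₁ m′ with x∈p∪q⁻ I ⁅ x ⁆ m′
      ...   | inj₁ m″ = inj₁ m″
      ...   | inj₂ m″ = inj₂ (inj₁ (x∈⁅y⁆⇒x≡y x m″))

      contra : ¬ (∣ I ∣ < t)
      contra small = richˢ (≼-mono (≤3N₁ (s≤s (s≤s z≤n))) (≼-⊆ (λ _ → generated-by (All.tabulate A₁or₂))
          (generated-≼ (A₁ ∷ A₂ ∷ []) (All.lookup exactˢ A₁∈ ∷ All.lookup exactˢ A₂∈ ∷ []))))
        where
        I⊆T : ∀ {B} → B ∈ˡ 𝓣 → I ⊆ B
        I⊆T B∈ = core⊆ (≤-reflexive (All.lookup exactᵗ B∈)) (t≤′ A₁∈ B∈) (t≤′ A₂∈ B∈) small

        suc∣I∣≡t : suc ∣ I ∣ ≡ t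
        suc∣I∣≡t with escape [] richᵗ [] z≤n
        ... | B , B∈ , _ = ≤-antisym small (≤-trans (core-bound {A₁} {A₂} {B} (≤-reflexive (All.lookup exactᵗ B∈))
            (t≤′ A₁∈ B∈) (t≤′ A₂∈ B∈))
          (s≤s (∣p∩q∣≤∣q∣ B I)))

        ∣Gxy∣ : ∀ {x y} → x ∈ U₁ → y ∈ U₂ → ∣ G x y ∣ ≡ t + 1
        ∣Gxy∣ x∈ y∈ = trans (∣p∪⁅x⁆∣ (∉A₁ y∈ ∘ Ix⊆A₁ x∈)) (trans (cong suc (trans (∣p∪⁅x⁆∣ (∉I₁ x∈)) suc∣I∣≡t)) (+-comm 1 t))

        two : ∀ {A A′} → ∣ A ∣ ≡ t + 1 → suc ∣ A ∩ A′ ∣ ≡ t → ∣ A ─ A′ ∣ ≡ 2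
        two {A} {A′} e e′ = +-cancelʳ-≡ ∣ A ∩ A′ ∣ _ _ (trans (∣p─q∣+∣p∩q∣≡∣p∣ A A′)
            (trans e (trans (+-comm t 1) (cong suc (sym e′)))))

        ∣U₁∣ : ∣ U₁ ∣ ≡ 2
        ∣U₁∣ = two {A₁} {A₂} (All.lookup exactˢ A₁∈) suc∣I∣≡t

        ∣U₂∣ : ∣ U₂ ∣ ≡ 2
        ∣U₂∣ = two {A₂} {A₁} (All.lookup exactˢ A₂∈) (trans (cong suc (∩-comm-∣∣ A₂ A₁)) suc∣I∣≡t)

        hit₁ : ∀ {B} → B ∈ˡ 𝓣 → ∃[ x ] (x ∈ U₁ × x ∈ B)
        hit₁ {B} B∈ with ∣q∣<∣p∣⇒∃∈p∉q (B ∩ A₁) I (<-≤-trans small (t≤′ A₁∈ B∈))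
        ... | x , m , x∉I = let (x∈B , x∈A₁) = x∈p∩q⁻ B A₁ m in
          x , x∈p∧x∉q⇒x∈p─q x∈A₁ (λ x∈A₂ → x∉I (x∈p∩q⁺ (x∈A₁ , x∈A₂))) , x∈B

        hit₂ : ∀ {B} → B ∈ˡ 𝓣 → ∃[ y ] (y ∈ U₂ × y ∈ B)
        hit₂ {B} B∈ with ∣q∣<∣p∣⇒∃∈p∉q (B ∩ A₂) I (<-≤-trans small (t≤′ A₂∈ B∈))
        ... | x , m , x∉I = let (x∈B , x∈A₂) = x∈p∩q⁻ B A₂ m in
          x , x∈p∧x∉q⇒x∈p─q x∈A₂ (λ x∈A₁ → x∉I (x∈p∩q⁺ (x∈A₁ , x∈A₂))) , x∈B

        G⊆ : ∀ {B x y} → B ∈ˡ 𝓣 → x ∈ B → y ∈ B → G x y ⊆ B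
        G⊆ B∈ x∈B y∈B = ∪-least (∪-least (I⊆T B∈) (⁅⁆⊆ x∈B)) (⁅⁆⊆ y∈B)

        occurs : ∀ {x y} → x ∈ U₁ → y ∈ U₂ → G x y ∈ˡ 𝓣
        occurs {x} {y} x∈ y∈ with any? (G x y ⊆?_) 𝓣
        ... | yes a with find a
        ...   | B , B∈ , G⊆B = subst (_∈ˡ 𝓣) (sym (p⊆q∧∣q∣≤∣p∣⇒p≡q G⊆B
          (≤-reflexive (trans (All.lookup exactᵗ B∈) (sym (∣Gxy∣ x∈ y∈)))))) B∈
        -- Without `G x y` three candidates remain: two whose first point is not `x`, and one with
        -- first point `x` and the other second point.
        occurs {x} {y} x∈ y∈ | no ¬a = ⊥-elim (richᵗ (≼-mono
            (≤-reflexive (trans (cong₂ (λ u v → u * (v * N (t + 1)) + (u * N (t + 1))) (len U₁ x∈ ∣U₁∣)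
                (trans (length-elements U₂) ∣U₂∣))
              (trans (cong (_+ (1 * N (t + 1))) (*-identityˡ (2 * N (t + 1)))) (sym (*-distribʳ-+ (N (t + 1)) 2 1)))))
            (≼-∪ {Q = Q₁} {Q₂} (λ _ → split)
              (≼-branch (elements (U₁ - x)) (λ x′ F → Any (λ y′ → G x′ y′ ⊆ F) (elements U₂)) (λ _ q → q)
                (All.map (λ {x′} x′∈ → ≼-branch (elements U₂) (λ y′ F → G x′ y′ ⊆ F) (λ _ q → q)
                  (All.map (λ {y′} y′∈ → ≼-supersets (G x′ y′) (∣Gxy∣ (p─q⊆p U₁ ⁅ x ⁆ x′∈) y′∈) id) (elements⊆ U₂)))
                      (elements⊆ (U₁ - x))))
              (≼-mono (≤-reflexive (cong (_* N (t + 1)) (trans (len U₂ y∈ ∣U₂∣) (sym (len U₁ x∈ ∣U₁∣)))))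
                (≼-branch (elements (U₂ - y)) (λ y′ F → G x y′ ⊆ F) (λ _ q → q)
                (All.map (λ {y′} y′∈ → ≼-supersets (G x y′) (∣Gxy∣ x∈ (p─q⊆p U₂ ⁅ y ⁆ y′∈)) id) (elements⊆ (U₂ - y))))))))
          where
          Q₁ Q₂ : Family n
          Q₁ F = Any (λ x′ → Any (λ y′ → G x′ y′ ⊆ F) (elements U₂)) (elements (U₁ - x))
          Q₂ F = Any (λ y′ → G x y′ ⊆ F) (elements (U₂ - y))
          len : ∀ (U : Subset n) {z} → z ∈ U → ∣ U ∣ ≡ 2 → length (elements (U - z)) ≡ 1
          len U {z} z∈ e = trans (length-elements (U - z)) (suc-injective (trans (suc∣p-x∣ z∈) e))
          split : ∀ {F} → Generated 𝓣 F → Q₁ F ⊎ Q₂ F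
          split {F} g with find g
          ... | B , B∈ , B⊆F with hit₁ B∈ | hit₂ B∈
          ...   | x′ , x′∈ , x′∈B | y′ , y′∈ , y′∈B = go (x′ ≟ᶠ x) (y′ ≟ᶠ y)
            where
            G⊆F : G x′ y′ ⊆ F
            G⊆F = B⊆F ∘ G⊆ B∈ x′∈B y′∈B
            go : Dec (x′ ≡ x) → Dec (y′ ≡ y) → Q₁ F ⊎ Q₂ F
            go (no x′≢x) _ = inj₁ (lose (∈⇒∈-elements (x∈p∧x≢y⇒x∈p-y x′∈ x′≢x)) (lose (∈⇒∈-elements y′∈) G⊆F))
            go (yes refl) (no y′≢y) = inj₂ (lose (∈⇒∈-elements (x∈p∧x≢y⇒x∈p-y y′∈ y′≢y)) G⊆F)
            go (yes refl) (yes refl) = ⊥-elim (¬a (lose B∈ (G⊆ B∈ x′∈B y′∈B)))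

        pair : ∀ {A x y} → A ∈ˡ 𝓢 → x ∈ U₁ → y ∈ U₂ → x ∉ A → y ∈ A
        pair {A} {x} {y} A∈ x∈ y∈ = one-of-two {q = G x y} (t≤ A∈ (occurs x∈ y∈)) (≤-trans (≤-reflexive (∣Gxy∣ x∈ y∈)) t+1≤)
          (x∈G x y) (y∈G x y) λ { refl → ∉A₁ y∈ (∈A₁ x∈) }

        I⊆S : ∀ {A} → A ∈ˡ 𝓢 → I ⊆ A
        I⊆S {A} A∈ with ∣p∣>0⇒nonempty U₁ (≤-trans (s≤s z≤n) (≤-reflexive (sym ∣U₁∣))) | ∣p∣>0⇒nonempty U₂
            (≤-trans (s≤s z≤n) (≤-reflexive (sym ∣U₂∣)))
        ... | x , x∈ | y , y∈ with ∣p∣>0⇒nonempty (U₁ - x) (rest x∈ ∣U₁∣) | ∣p∣>0⇒nonempty (U₂ - y) (rest y∈ ∣U₂∣)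
          where
          rest : ∀ {U : Subset n} {z} → z ∈ U → ∣ U ∣ ≡ 2 → 0 < ∣ U - z ∣
          rest z∈ e = ≤-reflexive (sym (suc-injective (trans (suc∣p-x∣ z∈) e)))
        -- The opposite candidates `G x y` and `G x′ y′` both belong to `𝓣` and meet only in `I`, so
        -- `core⊆` applies with the two families exchanged.
        ...   | x′ , x′∈- | y′ , y′∈- = core⊆ {G x y} {G x′ y′} (≤-reflexive (All.lookup exactˢ A∈))
          (t≤ A∈ (occurs x∈ y∈)) (t≤ A∈ (occurs x′∈ y′∈)) (≤-trans (s≤s (p⊆q⇒∣p∣≤∣q∣ sub)) small)
          ∘ λ m → x∈p∩q⁺ (I⊆G x y m , I⊆G x′ y′ m)
          where
          x′∈ = p─q⊆p U₁ ⁅ x ⁆ x′∈-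
          y′∈ = p─q⊆p U₂ ⁅ y ⁆ y′∈-
          sub : G x y ∩ G x′ y′ ⊆ I
          sub {z} m with x∈p∩q⁻ (G x y) (G x′ y′) m
          ... | m₁ , m₂ with G⁻ m₁ | G⁻ m₂
          ... | inj₁ a | _ = a
          ... | inj₂ _ | inj₁ a = a
          ... | inj₂ (inj₁ refl) | inj₂ (inj₁ refl) = ⊥-elim (∉- U₁ x x′∈-)
          ... | inj₂ (inj₁ refl) | inj₂ (inj₂ refl) = ⊥-elim (∉A₁ y′∈ (∈A₁ x∈))
          ... | inj₂ (inj₂ refl) | inj₂ (inj₁ refl) = ⊥-elim (∉A₁ y∈ (∈A₁ x′∈))
          ... | inj₂ (inj₂ refl) | inj₂ (inj₂ refl) = ⊥-elim (∉- U₂ y y′∈-)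

        -- A member missing some `x` in `U₁` contains every `y` in `U₂`, because it misses at most
        -- one point of `G x y`.
        A₁or₂ : ∀ {A} → A ∈ˡ 𝓢 → Any (_⊆ A) (A₁ ∷ A₂ ∷ [])
        A₁or₂ {A} A∈ with U₁ ⊆? A
        ... | yes U₁⊆A = here λ {z} z∈ → into z∈ (z ∈? A₂)
          where
          into : ∀ {z} → z ∈ A₁ → Dec (z ∈ A₂) → z ∈ A
          into z∈ (yes z∈′) = I⊆S A∈ (x∈p∩q⁺ (z∈ , z∈′))
          into z∈ (no z∉) = U₁⊆A (x∈p∧x∉q⇒x∈p─q z∈ z∉)
        ... | no U₁⊈A with ⊈⇒∃ U₁ A U₁⊈A
        ...   | x , x∈ , x∉A = there (here λ {z} z∈ → into z∈ (z ∈? A₁))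
          where
          into : ∀ {z} → z ∈ A₂ → Dec (z ∈ A₁) → z ∈ A
          into z∈ (yes z∈′) = I⊆S A∈ (x∈p∩q⁺ (z∈′ , z∈))
          into z∈ (no z∉) = pair A∈ x∈ (x∈p∧x∉q⇒x∈p─q z∈ z∉) x∉A

  -- By `intersecting` on both sides, all members of `𝓢` and `𝓣` together are pairwise
  -- t-intersecting (t + 1)-sets, and the classical alternative for such a family applies: a common
  -- t-set, or a (t + 2)-set containing all.
  clique : ∀ {𝓢 𝓣} → Exact 𝓢 → Exact 𝓣 → All (Covers 𝓣) 𝓢 → Rich 𝓢 → Rich 𝓣 → HasStar 𝓢 𝓣 ⊎ HasClique 𝓢 𝓣
  clique {𝓢} {𝓣} exactˢ exactᵗ cross richˢ richᵗ with escape [] richˢ [] z≤n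
  ... | A₁ , A₁∈ , _ with escape (A₁ ∷ []) richˢ (All.lookup exactˢ A₁∈ ∷ []) (s≤s z≤n)
  ...   | A₂ , A₂∈ , A₁⊈A₂ = decide
    where
    𝓥 = 𝓢 ++ 𝓣
    X Z : Subset n
    X = A₁ ∩ A₂
    Z = A₁ ∪ A₂

    exact : Exact 𝓥
    exact = All.++⁺ exactˢ exactᵗ

    pairwise : All (λ A → All (λ B → t ≤ ∣ A ∩ B ∣) 𝓥) 𝓥
    pairwise = All.++⁺
      (All.tabulate λ A∈ → All.++⁺ (All.tabulate (intersecting exactˢ exactᵗ cross richˢ richᵗ A∈)) (All.lookup cross A∈))
      (All.tabulate λ B∈ → All.++⁺ (All.lookup (covers-swap cross) B∈)
        (All.tabulate (intersecting exactᵗ exactˢ (covers-swap cross) richᵗ richˢ B∈)))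

    t≤ : ∀ {A B} → A ∈ˡ 𝓥 → B ∈ˡ 𝓥 → t ≤ ∣ A ∩ B ∣
    t≤ A∈ B∈ = All.lookup (All.lookup pairwise A∈) B∈

    ∈𝓥 : ∀ {A} → A ∈ˡ 𝓢 → A ∈ˡ 𝓥
    ∈𝓥 = ∈-++⁺ˡ

    size : ∀ {A} → A ∈ˡ 𝓥 → ∣ A ∣ ≤ suc t
    size A∈ = ≤-trans (≤-reflexive (All.lookup exact A∈)) t+1≤

    ∣X∣ : ∣ X ∣ ≡ t
    ∣X∣ with ⊈⇒∃ A₁ A₂ (λ h → A₁⊈A₂ (here h))
    ... | x , x∈ , x∉ = ≤-antisym (s≤s⁻¹ (≤-trans (∣p∩q∣<∣p∣ x∈ x∉) (size (∈𝓥 A₁∈)))) (t≤ (∈𝓥 A₁∈) (∈𝓥 A₂∈))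

    ∣Z∣ : ∣ Z ∣ ≡ t + 2
    ∣Z∣ = +-cancelʳ-≡ t _ _ (trans (cong (∣ Z ∣ +_) (sym ∣X∣)) (trans (∣p∪q∣+∣p∩q∣≡∣p∣+∣q∣ A₁ A₂)
      (trans (cong₂ _+_ (All.lookup exactˢ A₁∈) (All.lookup exactˢ A₂∈)) (lem t))))
      where
      lem : ∀ t → (t + 1) + (t + 1) ≡ (t + 2) + t
      lem = solve-∀

    -- Missing `x`, the set `A` contains the rest of `A₁` and of `A₂`, that is `Z - x`, which
    -- already has `t + 1` points.
    misses⇒⊆Z : ∀ {A x} → A ∈ˡ 𝓥 → x ∈ X → x ∉ A → A ⊆ Z
    misses⇒⊆Z {A} {x} A∈ x∈X x∉A = p─q⊆p Z ⁅ x ⁆ ∘ p⊆q∧∣q∣≤∣p∣⇒q⊆p sub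
      (≤-trans (≤-reflexive (trans (All.lookup exact A∈)
          (suc-injective (trans (sym (+-suc t 1)) (trans (sym ∣Z∣) (sym (suc∣p-x∣ x∈Z))))))) ≤-refl)
      where
      x∈Z : x ∈ Z
      x∈Z = p⊆p∪q A₂ (p∩q⊆p A₁ A₂ x∈X)
      from : ∀ {B z} → B ∈ˡ 𝓥 → x ∈ B → z ∈ B → z ≢ x → z ∈ A
      from B∈ x∈B z∈B z≢x = one-of-two (t≤ A∈ B∈) (size B∈) x∈B z∈B (z≢x ∘ sym) x∉A
      sub : Z - x ⊆ A
      sub {z} m with x∈p─q⁻ Z ⁅ x ⁆ m
      ... | z∈Z , z∉x with x∈p∪q⁻ A₁ A₂ z∈Z
      ...   | inj₁ z∈ = from (∈𝓥 A₁∈) (p∩q⊆p A₁ A₂ x∈X) z∈ (x∉⁅y⁆⇒x≢y z∉x)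
      ...   | inj₂ z∈ = from (∈𝓥 A₂∈) (p∩q⊆q A₁ A₂ x∈X) z∈ (x∉⁅y⁆⇒x≢y z∉x)

    decide : HasStar 𝓢 𝓣 ⊎ HasClique 𝓢 𝓣
    decide with all? (X ⊆?_) 𝓥
    ... | yes h = inj₁ (X , ∣X∣ , All.++⁻ˡ 𝓢 h , All.++⁻ʳ 𝓢 h)
    ... | no ¬h with find (All.¬All⇒Any¬ (X ⊆?_) 𝓥 ¬h)
    ...   | A₃ , A₃∈ , X⊈A₃ with ⊈⇒∃ X A₃ X⊈A₃
    ...     | x , x∈X , x∉A₃ = inj₂ (Z , ∣Z∣ , All.++⁻ˡ 𝓢 inZ , All.++⁻ʳ 𝓢 inZ)
      where
      ⊆Z : ∀ {A} → A ∈ˡ 𝓥 → A ⊆ Z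
      ⊆Z {A} A∈ {u} u∈A with x ∈? A
      ... | no x∉A = misses⇒⊆Z A∈ x∈X x∉A u∈A
      -- Here `A₃` misses the point `x` of `A`, hence contains all its other points, and `A₃ ⊆ Z`.
      ... | yes x∈A = decidable-stable (u ∈? Z) λ u∉Z → u∉Z (misses⇒⊆Z A₃∈ x∈X x∉A₃
        (one-of-two (t≤ A₃∈ A∈) (size A∈) x∈A u∈A (λ { refl → u∉Z (p⊆p∪q A₂ (p∩q⊆p A₁ A₂ x∈X)) }) x∉A₃))
      inZ : All (_⊆ Z) 𝓥
      inZ = All.tabulate ⊆Z

  exact-or-small : ∀ 𝓢 → All (λ A → ∣ A ∣ ≤ t + 1) 𝓢 → Exact 𝓢 ⊎ (∃[ X ] (X ∈ˡ 𝓢 × ∣ X ∣ ≤ t))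
  exact-or-small 𝓢 sizes with any? (λ A → ∣ A ∣ ≤? t) 𝓢
  ... | yes a = inj₂ (find a)
  ... | no ¬a = inj₁ (All.map (λ (h , h′) → ≤-antisym h (≤-trans (≤-reflexive (+-comm t 1)) (≰⇒> h′)))
    (All.zip (sizes , All.¬Any⇒All¬ 𝓢 ¬a)))

  star-or-clique : ∀ {𝓢 𝓣} → All (λ A → ∣ A ∣ ≤ t + 1) 𝓢 → All (λ B → ∣ B ∣ ≤ t + 1) 𝓣 → All (Covers 𝓣) 𝓢 →
    Rich 𝓢 → Rich 𝓣 → HasStar 𝓢 𝓣 ⊎ (Exact 𝓢 × Exact 𝓣 × HasClique 𝓢 𝓣)
  star-or-clique {𝓢} {𝓣} sizeˢ sizeᵗ cross richˢ richᵗ with exact-or-small 𝓢 sizeˢ | exact-or-small 𝓣 sizeᵗ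
  ... | inj₂ (X , X∈ , X≤) | _ = inj₁ (small⇒star sizeˢ sizeᵗ cross richᵗ X∈ X≤)
  ... | inj₁ _ | inj₂ (X , X∈ , X≤) with small⇒star sizeᵗ sizeˢ (covers-swap cross) richˢ X∈ X≤
  ...   | Y , e , a , b = inj₁ (Y , e , b , a)
  star-or-clique {𝓢} {𝓣} sizeˢ sizeᵗ cross richˢ richᵗ | inj₁ eˢ | inj₁ eᵗ with clique eˢ eᵗ cross richˢ richᵗ
  ... | inj₁ s = inj₁ s
  ... | inj₂ c = inj₂ (eˢ , eᵗ , c)

-- With A ≤ B a linear combination of inequalities, u is its right-hand side.
refute : ∀ {A B N} u v → 0 < N → A ≤ B → A ≡ u + (N + v) → B ≡ u → Empty.⊥
refute {N = N} u v 0<N h refl refl = <-irrefl refl (<-≤-trans (m<m+n u (≤-trans 0<N (m≤m+n N v))) h)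

-- Powers of `w` against branching factors, and the numerical contradictions

^-distribʳ-* : ∀ o m n → (m * n) ^ o ≡ m ^ o * n ^ o
^-distribʳ-* zero    m n = refl
^-distribʳ-* (suc o) m n = trans (cong (m * n *_) (^-distribʳ-* o m n)) (lem m n (m ^ o) (n ^ o))
  where
  lem : ∀ m n p q → m * n * (p * q) ≡ m * p * (n * q)
  lem = solve-∀

-- Serves `r ≤ 2 c + 1 = 7 + 2 d` with `c = 3 + d`. The factor 24 is chosen because
-- `5 * 24 = 4 * 30`, so that `30 (t + 2) ≤ w` can absorb it.
cubic≤exponential : ∀ d → (7 + 2 * d) ^ 3 ≤ 24 * 5 ^ (2 + d)
cubic≤exponential zero    = m≤m+n 343 257
cubic≤exponential (suc d) = begin
  (7 + 2 * suc d) ^ 3        ≤⟨ m+n≤o⇒m≤o _ (≤-reflexive (lem d)) ⟩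
  5 * (7 + 2 * d) ^ 3        ≤⟨ *-monoʳ-≤ 5 (cubic≤exponential d) ⟩
  5 * (24 * 5 ^ (2 + d))     ≡⟨ lem′ (5 ^ (2 + d)) ⟩
  24 * (5 * 5 ^ (2 + d))     ∎
  where
  open ≤-Reasoning
  lem : ∀ d → (7 + 2 * suc d) * ((7 + 2 * suc d) * ((7 + 2 * suc d) * 1)) + (986 + 984 * d + 312 * (d * d) + 32 * (d * d * d))
    ≡ 5 * ((7 + 2 * d) * ((7 + 2 * d) * ((7 + 2 * d) * 1)))
  lem = solve-∀
  lem′ : ∀ p → 5 * (24 * p) ≡ 24 * (5 * p)
  lem′ = solve-∀

-- For `c ≥ 3`, `c - 1` factors `w` pay for as many factors `5 r`, the last `w` pays for `30 t`, and
-- the left-over `r ^ 3` is at most `24 * 5 ^ (c - 1)`. For small `c` the numbers are checked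
-- directly: `24 t + 23 ≤ 30 r` excludes `c = 0` and forces `t ≤ 2` when `c = 1`.
power-bound : ∀ {t r w} c → 2 ≤ t → 30 * (t + 2) ≤ w → 5 * r ≤ w → 24 * t + 23 ≤ 30 * r → 2 * c ≤ r → r ≤ suc (2 * c) →
  5 * (t * r ^ (c + 2)) < 4 * w ^ c
power-bound {t} {r} {w} zero 2≤t w-t w-r h _ r≤ =
  contradiction (≤-trans (≤-trans (+-monoˡ-≤ 23 (*-monoʳ-≤ 24 2≤t)) h) (*-monoʳ-≤ 30 r≤)) (<⇒≱ (m≤m+n 31 40))
power-bound {t} {r} {w} 1 2≤t w-t w-r h _ r≤ = begin-strict
  5 * (t * r ^ 3)      ≤⟨ *-monoʳ-≤ 5 (*-monoʳ-≤ t (^-monoˡ-≤ 3 r≤)) ⟩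
  5 * (t * 27)         ≡⟨ lem t ⟩
  120 * t + 15 * t     ≤⟨ +-monoʳ-≤ (120 * t) (*-monoʳ-≤ 15 t≤2) ⟩
  120 * t + 15 * 2     <⟨ +-monoʳ-< (120 * t) (m≤m+n 31 209) ⟩
  120 * t + 240        ≡⟨ lem′ t ⟩
  4 * (30 * (t + 2))   ≤⟨ *-monoʳ-≤ 4 w-t ⟩
  4 * w                ≡⟨ cong (4 *_) (*-identityʳ w) ⟨
  4 * w ^ 1            ∎
  where
  open ≤-Reasoning
  lem : ∀ t → 5 * (t * 27) ≡ 120 * t + 15 * t
  lem = solve-∀
  lem′ : ∀ t → 120 * t + 240 ≡ 4 * (30 * (t + 2))
  lem′ = solve-∀
  t≤2 : t ≤ 2
  t≤2 = ≮⇒≥ λ 3≤t → <⇒≱ (m≤m+n 91 4) (≤-trans (+-monoˡ-≤ 23 (*-monoʳ-≤ 24 3≤t)) (≤-trans h (*-monoʳ-≤ 30 r≤)))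
power-bound {t} {r} {w} 2 2≤t w-t w-r h _ r≤ = begin-strict
  5 * (t * r ^ 4)             ≤⟨ *-monoʳ-≤ 5 (*-monoʳ-≤ t (^-monoˡ-≤ 4 r≤)) ⟩
  5 * (t * 625)               ≡⟨ lem t ⟩
  3125 * t                    <⟨ m<m+n (3125 * t) (s≤s z≤n) ⟩
  3125 * t + (14400 + 4075 * t) ≡⟨ lem′ t ⟩
  4 * (30 * (t + 2) * 60)     ≤⟨ *-monoʳ-≤ 4 (*-mono-≤ w-t (≤-trans (*-monoʳ-≤ 30 (m≤n+m 2 t)) w-t)) ⟩
  4 * (w * w)                 ≡⟨ cong (λ u → 4 * (w * u)) (*-identityʳ w) ⟨
  4 * w ^ 2                   ∎
  where
  open ≤-Reasoning
  lem : ∀ t → 5 * (t * 625) ≡ 3125 * t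
  lem = solve-∀
  lem′ : ∀ t → 3125 * t + (14400 + 4075 * t) ≡ 4 * (30 * (t + 2) * 60)
  lem′ = solve-∀
power-bound {t} {r} {w} (suc (suc (suc d))) 2≤t w-t w-r h _ r≤ = begin-strict
  5 * (t * r ^ (c + 2))                    ≡⟨ cong (λ u → 5 * (t * u)) (trans (cong (r ^_) (lem₀ d)) (^-distribˡ-+-* r 3 (2 + d))) ⟩
  5 * (t * (r ^ 3 * r ^ (2 + d)))          ≤⟨ *-monoʳ-≤ 5 (*-monoʳ-≤ t (*-monoˡ-≤ (r ^ (2 + d)) r³≤)) ⟩
  5 * (t * (24 * 5 ^ (2 + d) * r ^ (2 + d))) ≡⟨ lem₁ t (5 ^ (2 + d)) (r ^ (2 + d)) ⟩
  120 * t * (5 ^ (2 + d) * r ^ (2 + d))    ≡⟨ cong (120 * t *_) (^-distribʳ-* (2 + d) 5 r) ⟨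
  120 * t * (5 * r) ^ (2 + d)              ≤⟨ *-monoʳ-≤ (120 * t) (^-monoˡ-≤ (2 + d) w-r) ⟩
  120 * t * w ^ (2 + d)                    <⟨ m<m+n (120 * t * w ^ (2 + d)) (m^n>0 w (2 + d)) ⟩
  120 * t * w ^ (2 + d) + w ^ (2 + d)      ≤⟨ m≤m+n _ (239 * w ^ (2 + d)) ⟩
  120 * t * w ^ (2 + d) + w ^ (2 + d) + 239 * w ^ (2 + d) ≡⟨ lem₂ t (w ^ (2 + d)) ⟩
  4 * (30 * (t + 2) * w ^ (2 + d))         ≤⟨ *-monoʳ-≤ 4 (*-monoˡ-≤ (w ^ (2 + d)) w-t) ⟩
  4 * (w * w ^ (2 + d))                    ∎
  where
  open ≤-Reasoning
  c = 3 + d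
  instance
    w≢0 : NonZero w
    w≢0 = >-nonZero (≤-trans (≤-trans (s≤s z≤n) (*-monoʳ-≤ 30 (m≤n+m 2 t))) w-t)
  lem₀ : ∀ d → 3 + d + 2 ≡ 3 + (2 + d)
  lem₀ = solve-∀
  lem₁ : ∀ t p q → 5 * (t * (24 * p * q)) ≡ 120 * t * (p * q)
  lem₁ = solve-∀
  lem₂ : ∀ t p → 120 * t * p + p + 239 * p ≡ 4 * (30 * (t + 2) * p)
  lem₂ = solve-∀
  lem₃ : ∀ d → suc (2 * (3 + d)) ≡ 7 + 2 * d
  lem₃ = solve-∀
  r³≤ : r ^ 3 ≤ 24 * 5 ^ (2 + d)
  r³≤ = ≤-trans (^-monoˡ-≤ 3 (≤-trans r≤ (≤-reflexive (lem₃ d)))) (cubic≤exponential d)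

-- N, N′ and E are the values of N₁, N₂ and E in Estimates, and t = 2 + s.
module Contradictions (s r M N N′ E : ℕ) (0<N : 0 < N)
  (M-𝓐 : 30 * (2 + s + 2) * N ≤ 30 * M + N) (M-𝓗 : 4 * suc r * N ≤ 5 * M)
  (E≤ : 5 * E ≤ (2 + s + 1) * N) (N′≤ : 5 * suc r * N′ ≤ N) where

  -- `t + 2 - 1/30` exceeds `3 + (t + 1)/5` from `t = 2` on.
  ¬M≤3N : ¬ (M ≤ 3 * N + E)
  ¬M≤3N h = refute (30 * M + N + 30 * (3 * N + E) + 6 * ((2 + s + 1) * N)) (10 * N + 24 * (s * N)) 0<N
    (+-mono-≤ (+-mono-≤ M-𝓐 (*-monoʳ-≤ 30 h)) (*-monoʳ-≤ 6 E≤)) (lem s M N E) refl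
    where
    lem : ∀ s M N E → 30 * (2 + s + 2) * N + 30 * M + 6 * (5 * E)
      ≡ 30 * M + N + 30 * (3 * N + E) + 6 * ((2 + s + 1) * N) + (N + (10 * N + 24 * (s * N)))
    lem = solve-∀

  ¬M≤𝓐 : ¬ (M ≤ 2 * N + (2 + s) * (suc r * N′) + E)
  ¬M≤𝓐 h = refute (30 * M + N + 30 * (2 * N + (2 + s) * (suc r * N′) + E) + 6 * ((2 + s + 1) * N) + 6 * (2 + s) * N)
      (28 * N + 18 * (s * N)) 0<N
    (+-mono-≤ (+-mono-≤ (+-mono-≤ M-𝓐 (*-monoʳ-≤ 30 h)) (*-monoʳ-≤ 6 E≤)) (*-monoʳ-≤ (6 * (2 + s)) N′≤)) (lem s r M N N′ E) refl
    where
    lem : ∀ s r M N N′ E → 30 * (2 + s + 2) * N + 30 * M + 6 * (5 * E) + 6 * (2 + s) * (5 * suc r * N′)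
      ≡ 30 * M + N + 30 * (2 * N + (2 + s) * (suc r * N′) + E) + 6 * ((2 + s + 1) * N) + 6 * (2 + s) * N +
          (N + (28 * N + 18 * (s * N)))
    lem = solve-∀

  -- Both lower bounds for `M` are combined, as `r` and `t` are unrelated: in
  -- `40 M = 30 M + 2 (5 M)` the part from `𝓗` cancels the terms in `r + 1`, and the part from `𝓐`
  -- outweighs `E`.
  ¬M≤R²N′ : ¬ (M ≤ suc r * (suc r * N′) + E)
  ¬M≤R²N′ h = refute (30 * M + N + 2 * (5 * M) + 40 * (suc r * (suc r * N′) + E) + 8 *
      ((2 + s + 1) * N) + 8 * suc r * N) (94 * N + 22 * (s * N)) 0<N
    (+-mono-≤ (+-mono-≤ (+-mono-≤ (+-mono-≤ M-𝓐 (*-monoʳ-≤ 2 M-𝓗)) (*-monoʳ-≤ 40 h)) (*-monoʳ-≤ 8 E≤))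
        (*-monoʳ-≤ (8 * suc r) N′≤)) (lem s r M N N′ E) refl
    where
    lem : ∀ s r M N N′ E → 30 * (2 + s + 2) * N + 2 * (4 * suc r * N) + 40 * M + 8 * (5 * E) + 8 * suc r * (5 * suc r * N′)
      ≡ 30 * M + N + 2 * (5 * M) + 40 * (suc r * (suc r * N′) + E) + 8 * ((2 + s + 1) * N) + 8 * suc r * N +
          (N + (94 * N + 22 * (s * N)))
    lem = solve-∀

  -- In `150 M = 30 M + 24 (5 M)` the terms in `t` cancel against `150 E`, and `96 r` from `𝓗`
  -- stands against `150 c ≤ 75 r`; the surplus `21 r` with `r ≥ 2` covers the constants.
  ¬M≤[c+1]N : ∀ c → 2 ≤ r → 2 * c ≤ r → ¬ (M ≤ suc c * N + E)
  ¬M≤[c+1]N c 2≤r 2c≤r h = refute (30 * M + N + 24 * (5 * M) + 150 * (suc c * N + E) + 30 *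
      ((2 + s + 1) * N) + 75 * N * r + 21 * N * r) (16 * N) 0<N
    (+-mono-≤ (+-mono-≤ (+-mono-≤ (+-mono-≤ (+-mono-≤ M-𝓐 (*-monoʳ-≤ 24 M-𝓗)) (*-monoʳ-≤ 150 h)) (*-monoʳ-≤ 30 E≤))
        (*-monoʳ-≤ (75 * N) 2c≤r)) (*-monoʳ-≤ (21 * N) 2≤r)) (lem s r M N E c) refl
    where
    lem : ∀ s r M N E c → 30 * (2 + s + 2) * N + 24 * (4 * suc r * N) + 150 * M + 30 * (5 * E) + 75 * N * (2 * c) + 21 * N * 2
      ≡ 30 * M + N + 24 * (5 * M) + 150 * (suc c * N + E) + 30 * ((2 + s + 1) * N) + 75 * N * r + 21 * N * r + (N + 16 * N)
    lem = solve-∀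

  M≤RN⇒ : M ≤ suc r * N + E → 24 * (2 + s) + 23 ≤ 30 * r
  M≤RN⇒ h = *-cancelˡ-≤ N {{>-nonZero 0<N}} (move {A = 30 * (2 + s + 2) * N + 30 * M + 6 * (5 * E)}
    (+-mono-≤ (+-mono-≤ M-𝓐 (*-monoʳ-≤ 30 h)) (*-monoʳ-≤ 6 E≤)) (≤-reflexive (lem s r M N E)))
    where
    lem : ∀ s r M N E → N * (24 * (2 + s) + 23) + (30 * M + N + 30 * (suc r * N + E) + 6 * ((2 + s + 1) * N))
      ≡ N * (30 * r) + (30 * (2 + s + 2) * N + 30 * M + 6 * (5 * E))
    lem = solve-∀

-- The extremal families

too-small : ∀ {p q t N N′ N″} → 0 < N → 5 * (t * q) < 4 * p → 4 * N ≤ 5 * N′ → N′ ≤ t * (q * N″) → ¬ (p * N″ ≤ N)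
too-small {p} {q} {t} {N} {N′} {N″} 0<N h₁ h₂ h₃ h₄ = <-irrefl refl (begin-strict
  5 * (t * q) * N              <⟨ *-monoˡ-< N {{>-nonZero 0<N}} h₁ ⟩
  4 * p * N                    ≡⟨ lem₁ p N ⟩
  p * (4 * N)                  ≤⟨ *-monoʳ-≤ p (≤-trans h₂ (*-monoʳ-≤ 5 h₃)) ⟩
  p * (5 * (t * (q * N″)))     ≡⟨ lem₂ p t q N″ ⟩
  5 * (t * q) * (p * N″)       ≤⟨ *-monoʳ-≤ (5 * (t * q)) h₄ ⟩
  5 * (t * q) * N              ∎)
  where
  open ≤-Reasoning
  lem₁ : ∀ p z → 4 * p * z ≡ p * (4 * z)
  lem₁ = solve-∀
  lem₂ : ∀ p t q z → p * (5 * (t * (q * z))) ≡ 5 * (t * q) * (p * z)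
  lem₂ = solve-∀

halves : ∀ m → 2 * ⌊ m /2⌋ ≤ m × m ≤ suc (2 * ⌊ m /2⌋)
halves zero          = z≤n , z≤n
halves (suc zero)    = z≤n , s≤s z≤n
halves (suc (suc m)) = ≤-trans (≤-reflexive (*-suc 2 ⌊ m /2⌋)) (s≤s (s≤s (proj₁ (halves m)))) ,
  ≤-trans (s≤s (s≤s (proj₂ (halves m)))) (s≤s (≤-reflexive (sym (*-suc 2 ⌊ m /2⌋))))

remainder : ∀ {N t S M a b} → a + N ≤ S → S + t ≤ M → M ≤ a + b → N ≤ b
remainder {N} {t} {S} {M} {a} {b} h₁ h₂ h₃ = +-cancelˡ-≤ a N b (≤-trans h₁ (≤-trans (m≤m+n S t) (≤-trans h₂ h₃)))

module Extremal (n k s r′ x w : ℕ)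
  (k≡ : k ≡ suc (suc s) + suc (suc r′)) (n≡ : n ≡ suc (suc s) + suc (suc (suc (suc r′) + x)))
  (w-t : 30 * (suc (suc s) + 2) ≤ w) (w-k : 5 * (suc (suc s) + suc (suc r′)) ≤ w)
  (w-n : w * suc (suc r′) ≤ suc (suc (suc (suc r′) + x))) where

  t : ℕ
  t = suc (suc s)

  2≤t : 2 ≤ t
  2≤t = s≤s (s≤s z≤n)

  open Cost n k
  open Peeling n k t
  open Estimates n k t r′ x w k≡ n≡ 2≤t w-t w-k w-n

  module Bounded (M : ℕ) (M-𝓐 : 30 * (t + 2) * N₁ ≤ 30 * M + N₁)
    (star≤M : ∀ {X L : Subset n} → X ⊆ L → ∣ X ∣ ≡ t → ∣ L ∣ ≡ t + suc r → card (star? k X L) + t ≤ M)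
    (𝓐≤M : ∀ {Z : Subset n} → ∣ Z ∣ ≡ t + 2 → card (𝓐? k t Z) ≤ M)
    (M-𝓗 : 4 * suc r * N₁ ≤ 5 * M) where

    5[r+1]N₂≤N₁ : 5 * suc r * N₂ ≤ N₁
    5[r+1]N₂≤N₁ = ≤-trans (*-monoˡ-≤ N₂ (≤-trans (*-monoʳ-≤ 5 (+-monoˡ-≤ r {1} {t} (s≤s z≤n))) w-k)) wN₂≤N₁

    open Contradictions s r M N₁ N₂ E 0<N₁ M-𝓐 M-𝓗 5E≤ 5[r+1]N₂≤N₁

    ∣X∪⁅y⁆∣ : ∀ {X : Subset n} {y} → ∣ X ∣ ≡ t → y ∉ X → ∣ X ∪ ⁅ y ⁆ ∣ ≡ t + 1
    ∣X∪⁅y⁆∣ e y∉X = trans (∣p∪⁅x⁆∣ y∉X) (trans (cong suc e) (+-comm 1 t))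

    module OneSide {𝓕 𝓖 : Family n} (𝓕? : Decidable 𝓕) (𝓖? : Decidable 𝓖) (𝓕⊆ : 𝓕 ⊆ᶠ Uniform n k) (𝓖⊆ : 𝓖 ⊆ᶠ Uniform n k)
      (cross : CrossIntersecting t 𝓕 𝓖) (M≤𝓖 : M ≤ card 𝓖?) where

      -- Enlarge `F₀ ∩ Z` to a t-set `W ⊆ Z`. A member of `𝓖` in `𝓐` contains some `Z - z`. The two
      -- `z` outside `W` cost `N₁` each. For `z` in `W` the set `Z - z` meets `F₀` in fewer than `t`
      -- points, so a further point of `F₀` is forced, at cost `(r + 1) N₂`.
      ⊆𝓐 : ∀ {Z} → ∣ Z ∣ ≡ t + 2 → (λ G → 𝓖 G × ¬ 𝓐 k t Z G) ≼ E → 𝓕 ⊆ᶠ 𝓐 k t Z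
      ⊆𝓐 {Z} ∣Z∣ rest {F₀} f₀ = 𝓕⊆ f₀ , ≮⇒≥ λ h → contra (s≤s⁻¹ (≤-trans h (≤-reflexive (+-comm t 1))))
        where
        contra : ¬ (∣ F₀ ∩ Z ∣ ≤ t)
        contra h with intermediate t (p∩q⊆q F₀ Z) h (≤-trans (m≤m+n t 2) (≤-reflexive (sym ∣Z∣)))
        ... | W , F₀Z⊆W , W⊆Z , ∣W∣ = ¬M≤𝓐
            (≤-trans M≤𝓖 (card≤ 𝓖? 𝓖⊆ (≼-∪ {Q = λ G → 𝓖 G × 𝓐 k t Z G} (λ {G} _ g → dec g (𝓐? k t Z G)) in𝓐 rest)))
          where
          dec : ∀ {G} → 𝓖 G → Dec (𝓐 k t Z G) → (𝓖 G × 𝓐 k t Z G) ⊎ (𝓖 G × ¬ 𝓐 k t Z G)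
          dec g (yes a) = inj₁ (g , a)
          dec g (no ¬a) = inj₂ (g , ¬a)
          ∣Z-z∣ : ∀ {z} → z ∈ Z → ∣ Z - z ∣ ≡ t + 1
          ∣Z-z∣ z∈ = suc-injective (trans (suc∣p-x∣ z∈) (trans ∣Z∣ (+-suc t 1)))
          facet : ∀ {G} → 𝓐 k t Z G → ∃[ z ] (z ∈ Z × Z - z ⊆ G)
          facet {G} (_ , t≤) with Z ⊆? G
          ... | no Z⊈G with ⊈⇒∃ Z G Z⊈G
          ...   | z , z∈Z , z∉G = z , z∈Z , p∩q⊆p G Z ∘ p⊆q∧∣q∣≤∣p∣⇒q⊆p
            (λ m → let (m₁ , m₂) = x∈p∩q⁻ G Z m in x∈p∧x≢y⇒x∈p-y m₂ λ { refl → z∉G m₁ }) (≤-trans (≤-reflexive (∣Z-z∣ z∈Z)) t≤)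
          facet {G} (_ , t≤) | yes Z⊆G with ∣p∣>0⇒nonempty Z (≤-trans (s≤s z≤n) (≤-reflexive (sym ∣Z∣)))
          ... | z , z∈Z = z , z∈Z , Z⊆G ∘ p─q⊆p Z ⁅ z ⁆
          Q₁ Q₂ : Family n
          Q₁ G = Any (λ z → Z - z ⊆ G) (elements (Z ─ W))
          Q₂ G = Any (λ z → 𝓖 G × Z - z ⊆ G) (elements W)
          split : ∀ {G} → 𝓖 G × 𝓐 k t Z G → Q₁ G ⊎ Q₂ G
          split (g , a) with facet a
          ... | z , z∈Z , sub with z ∈? W
          ...   | yes z∈W = inj₂ (lose (∈⇒∈-elements z∈W) (g , sub))
          ...   | no z∉W = inj₁ (lose (∈⇒∈-elements (x∈p∧x∉q⇒x∈p─q z∈Z z∉W)) sub)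
          ∣Z─W∣ : ∣ Z ─ W ∣ ≡ 2
          ∣Z─W∣ = ∣L─X∣ W⊆Z ∣W∣ ∣Z∣
          through : ∀ {z} → z ∈ W → (λ G → 𝓖 G × Z - z ⊆ G) ≼ suc r * N₂
          through {z} z∈W with branch-points {t = t} {r} (Z - z) F₀ small (≤-reflexive (trans (𝓕⊆ f₀) k≡))
            where
            small : ∣ (Z - z) ∩ F₀ ∣ < t
            small = ≤-trans (s≤s (p⊆q⇒∣p∣≤∣q∣ {p = (Z - z) ∩ F₀} {W - z} λ m → let (m₁ , m₂) = x∈p∩q⁻ (Z - z) F₀ m; (m₃ , m₄) = x∈p─q⁻ Z ⁅ z ⁆ m₁ in
              x∈p∧x∉q⇒x∈p─q (F₀Z⊆W (x∈p∩q⁺ (m₂ , m₃))) m₄)) (≤-reflexive (trans (suc∣p-x∣ z∈W) ∣W∣))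
          ... | ys , len , ∉R , hit = ≼-mono (*-monoˡ-≤ N₂ len) (≼-branch ys (λ y G → (Z - z) ∪ ⁅ y ⁆ ⊆ G) (λ _ → branch)
            (All.map (λ {y} y∉ → ≼-supersets ((Z - z) ∪ ⁅ y ⁆) (trans (∣p∪⁅x⁆∣ y∉) (trans (cong suc (∣Z-z∣ (W⊆Z z∈W)))
                (sym (+-suc t 1)))) id) ∉R))
            where
            branch : ∀ {G} → 𝓖 G × Z - z ⊆ G → Any (λ y → (Z - z) ∪ ⁅ y ⁆ ⊆ G) ys
            branch {G} (g , sub) = Any.map extend (hit (≤-trans (cross f₀ g) (≤-reflexive (∩-comm-∣∣ F₀ G))))
              where
              extend : ∀ {y} → y ∈ G → (Z - z) ∪ ⁅ y ⁆ ⊆ G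
              extend y∈G = ∪-least sub (⁅⁆⊆ y∈G)
          in𝓐 : (λ G → 𝓖 G × 𝓐 k t Z G) ≼ 2 * N₁ + t * (suc r * N₂)
          in𝓐 = ≼-∪ {Q = Q₁} {Q₂} (λ _ → split)
            (≼-mono (≤-reflexive (cong (_* N₁) (trans (length-elements (Z ─ W)) ∣Z─W∣)))
              (≼-branch (elements (Z ─ W)) (λ z G → Z - z ⊆ G) (λ _ q → q)
                (All.map (λ {z} z∈ → ≼-supersets (Z - z) (∣Z-z∣ (p─q⊆p Z W z∈)) id) (elements⊆ (Z ─ W)))))
            (≼-mono (≤-reflexive (cong (_* (suc r * N₂)) (trans (length-elements W) ∣W∣)))
              (≼-branch (elements W) (λ z G → 𝓖 G × Z - z ⊆ G) (λ _ q → q) (All.map through (elements⊆ W))))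

      -- Members not containing the common t-set `X`

      module AtStar {X : Subset n} (∣X∣ : ∣ X ∣ ≡ t) (rest : (λ G → 𝓖 G × ¬ (X ⊆ G)) ≼ E) where

        𝓕′? : Decidable (λ F → 𝓕 F × ¬ (X ⊆ F))
        𝓕′? F = 𝓕? F ×-dec ¬? (X ⊆? F)

        𝓖ˣ? : Decidable (λ G → 𝓖 G × X ⊆ G)
        𝓖ˣ? G = 𝓖? G ×-dec (X ⊆? G)

        𝓖′? : Decidable (λ G → 𝓖 G × ¬ (X ⊆ G))
        𝓖′? G = 𝓖? G ×-dec ¬? (X ⊆? G)

        ⊆-or-⊈ : ∀ {G} → 𝓖 G → (𝓖 G × X ⊆ G) ⊎ (𝓖 G × ¬ (X ⊆ G))
        ⊆-or-⊈ {G} g with X ⊆? G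
        ... | yes h = inj₁ (g , h)
        ... | no ¬h = inj₂ (g , ¬h)

        M≤_+E : ∀ {c} → (λ G → 𝓖 G × X ⊆ G) ≼ c → M ≤ c + E
        M≤ p +E = ≤-trans M≤𝓖 (card≤ 𝓖? 𝓖⊆ (≼-∪ (λ _ → ⊆-or-⊈) p rest))

        ∣F∩X∣<t : ∀ {F} → ¬ (X ⊆ F) → ∣ F ∩ X ∣ < t
        ∣F∩X∣<t {F} X⊈F with ⊈⇒∃ X F X⊈F
        ... | z , z∈X , z∉F = ≤-trans (s≤s (≤-reflexive (∩-comm-∣∣ F X))) (≤-trans (∣p∩q∣<∣p∣ z∈X z∉F) (≤-reflexive ∣X∣))

        -- If `F` missed two points of `X`, members of `𝓖` through `X` would need two further points
        -- of `F`: one added point raises the intersection with `F` by at most one and still leaves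
        -- it below `t`. Branching twice costs only `(r + 1)² N₂`.
        one-missing : ∀ {F} → 𝓕 F → ¬ (X ⊆ F) → suc ∣ F ∩ X ∣ ≡ t
        one-missing {F} f X⊈F = ≤-antisym (∣F∩X∣<t X⊈F) (≮⇒≥ contra)
          where
          F≤ : ∣ F ∣ ≤ t + r
          F≤ = ≤-reflexive (trans (𝓕⊆ f) k≡)
          step : ∀ {R} → ∣ R ∩ F ∣ < t → ∀ {c} → (∀ {y} → y ∉ R → (λ G → 𝓖 G × R ∪ ⁅ y ⁆ ⊆ G) ≼ c) → (λ G → 𝓖 G × R ⊆ G) ≼ suc r * c
          step {R} h {c} next with branch-points {t = t} {r} R F h F≤
          ... | ys , len , ∉R , hit = ≼-mono (*-monoˡ-≤ c len) (≼-branch ys (λ y G → 𝓖 G × R ∪ ⁅ y ⁆ ⊆ G) (λ _ → branch)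
              (All.map next ∉R))
            where
            branch : ∀ {G} → 𝓖 G × R ⊆ G → Any (λ y → 𝓖 G × R ∪ ⁅ y ⁆ ⊆ G) ys
            branch {G} (g , R⊆G) = Any.map extend (hit (≤-trans (cross f g) (≤-reflexive (∩-comm-∣∣ F G))))
              where
              extend : ∀ {y} → y ∈ G → 𝓖 G × R ∪ ⁅ y ⁆ ⊆ G
              extend y∈G = g , ∪-least R⊆G (⁅⁆⊆ y∈G)
          contra : ¬ (suc ∣ F ∩ X ∣ < t)
          contra h = ¬M≤R²N′ (M≤ step (≤-trans (s≤s (≤-reflexive (∩-comm-∣∣ X F))) (<⇒≤ h)) (λ {y} y∉X → step (small y)
              λ {z} z∉ → ≼-supersets ((X ∪ ⁅ y ⁆) ∪ ⁅ z ⁆) (trans (∣p∪⁅x⁆∣ z∉) (trans (cong suc (∣X∪⁅y⁆∣ ∣X∣ y∉X))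
                  (sym (+-suc t 1)))) proj₂) +E)
            where
            small : ∀ y → ∣ (X ∪ ⁅ y ⁆) ∩ F ∣ < t
            small y = ≤-trans (s≤s (begin
              ∣ (X ∪ ⁅ y ⁆) ∩ F ∣         ≤⟨ p⊆q⇒∣p∣≤∣q∣ sub ⟩
              ∣ (F ∩ X) ∪ ⁅ y ⁆ ∣         ≤⟨ m≤m+n _ _ ⟩
              ∣ (F ∩ X) ∪ ⁅ y ⁆ ∣ + ∣ (F ∩ X) ∩ ⁅ y ⁆ ∣ ≡⟨ ∣p∪q∣+∣p∩q∣≡∣p∣+∣q∣ (F ∩ X) ⁅ y ⁆ ⟩
              ∣ F ∩ X ∣ + ∣ ⁅ y ⁆ ∣       ≡⟨ cong (∣ F ∩ X ∣ +_) (∣⁅x⁆∣≡1 y) ⟩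
              ∣ F ∩ X ∣ + 1               ≡⟨ +-comm _ 1 ⟩
              suc ∣ F ∩ X ∣               ∎)) h
              where
              open ≤-Reasoning
              sub : (X ∪ ⁅ y ⁆) ∩ F ⊆ (F ∩ X) ∪ ⁅ y ⁆
              sub m with x∈p∩q⁻ (X ∪ ⁅ y ⁆) F m
              ... | m₁ , m₂ with x∈p∪q⁻ X ⁅ y ⁆ m₁
              ...   | inj₁ m₃ = p⊆p∪q ⁅ y ⁆ (x∈p∩q⁺ (m₂ , m₃))
              ...   | inj₂ m₃ = q⊆p∪q (F ∩ X) ⁅ y ⁆ m₃

        ∣F∪X∣ : ∀ {F} → 𝓕 F → ¬ (X ⊆ F) → ∣ F ∪ X ∣ ≡ t + suc r
        ∣F∪X∣ {F} f X⊈F = +-cancelʳ-≡ (∣ F ∩ X ∣) _ _ (trans (∣p∪q∣+∣p∩q∣≡∣p∣+∣q∣ F X) (trans (cong₂ _+_ (trans (𝓕⊆ f) k≡) ∣X∣)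
          (trans (cong ((t + r) +_) (sym (one-missing f X⊈F))) (lem t r ∣ F ∩ X ∣))))
          where
          lem : ∀ t r i → (t + r) + suc i ≡ t + suc r + i
          lem = solve-∀

        meets : ∀ {F G} → 𝓕 F → ¬ (X ⊆ F) → 𝓖 G → ∃[ y ] (y ∈ F × y ∈ G × y ∉ X)
        meets {F} {G} f X⊈F g with ∣q∣<∣p∣⇒∃∈p∉q (F ∩ G) (F ∩ X) (<-≤-trans (∣F∩X∣<t X⊈F) (cross f g))
        ... | y , m , y∉ = let (y∈F , y∈G) = x∈p∩q⁻ F G m in y , y∈F , y∈G , λ y∈X → y∉ (x∈p∩q⁺ (y∈F , y∈X))

        ∈-star : ∀ {F G} → 𝓕 F → ¬ (X ⊆ F) → 𝓖 G → X ⊆ G → Star k X (F ∪ X) G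
        ∈-star {F} f X⊈F g X⊆G with meets f X⊈F g
        ... | y , y∈F , y∈G , y∉X = 𝓖⊆ g , X⊆G , y , x∈p∩q⁺ (y∈G , x∈p∧x∉q⇒x∈p─q (p⊆p∪q X y∈F) y∉X)

        -- Otherwise `𝓖` would lie in a star, which is smaller than `M` by at least `t`, the number
        -- of deletions in `𝓗`. So an exceptional member on one side forces one on the other.
        ¬all⊇X : ∀ {F₀} → 𝓕 F₀ → ¬ (X ⊆ F₀) → ¬ (∀ {G} → 𝓖 G → X ⊆ G)
        ¬all⊇X {F₀} f₀ X⊈F₀ all = <-irrefl refl (<-≤-trans (m<m+n (card 𝓖?) {t} (s≤s z≤n)) (≤-trans
          (+-monoˡ-≤ t (card-mono 𝓖? (star? k X (F₀ ∪ X)) λ {G} g → ∈-star f₀ X⊈F₀ g (all g)))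
          (≤-trans (star≤M (q⊆p∪q F₀ X) ∣X∣ (∣F∪X∣ f₀ X⊈F₀)) M≤𝓖)))

        -- The sets through X ∪ {y} avoiding K₁ ─ X lie in the star of K₀ but not in 𝓖.
        two-unions : ∀ {F₀ F₁} → 𝓕 F₀ → ¬ (X ⊆ F₀) → 𝓕 F₁ → ¬ (X ⊆ F₁) → F₀ ∪ X ≢ F₁ ∪ X → N₁′ ≤ card 𝓖′?
        two-unions {F₀} {F₁} f₀ X⊈F₀ f₁ X⊈F₁ K₀≢K₁ = remainder {t = t} disjoint (star≤M (q⊆p∪q F₀ X) ∣X∣ (∣F∪X∣ f₀ X⊈F₀)) parts
          where
          K₀ K₁ V : Subset n
          K₀ = F₀ ∪ X
          K₁ = F₁ ∪ X
          V = ∁ (K₁ ─ X)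
          S : ℕ
          S = card (star? k X K₀)
          private-point : ∃[ y ] (y ∈ K₀ × y ∉ K₁)
          private-point = ⊈⇒∃ K₀ K₁ λ K₀⊆K₁ → K₀≢K₁ (p⊆q∧∣q∣≤∣p∣⇒p≡q K₀⊆K₁
            (≤-reflexive (trans (∣F∪X∣ f₁ X⊈F₁) (sym (∣F∪X∣ f₀ X⊈F₀)))))
          y : Fin n
          y = proj₁ private-point
          y∈K₀ : y ∈ K₀
          y∈K₀ = proj₁ (proj₂ private-point)
          y∉K₁ : y ∉ K₁
          y∉K₁ = proj₂ (proj₂ private-point)
          parts : M ≤ card 𝓖ˣ? + card 𝓖′?
          parts = ≤-trans M≤𝓖 (length-filter-∪ 𝓖? 𝓖ˣ? 𝓖′? ⊆-or-⊈ (allSubsets n))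
          y∉X : y ∉ X
          y∉X y∈X = y∉K₁ (q⊆p∪q F₁ X y∈X)
          Xy⊆V : X ∪ ⁅ y ⁆ ⊆ V
          Xy⊆V = ∪-least (λ m → x∉p⇒x∈∁p λ m′ → x∈p─q⇒x∉q K₁ X m′ m) (⁅⁆⊆ (x∉p⇒x∈∁p λ m′ → y∉K₁ (p─q⊆p K₁ X m′)))
          ∣V∣ : ∣ V ∣ ≡ ∣ X ∪ ⁅ y ⁆ ∣ + x
          ∣V∣ = trans (∣∁p∣≡n∸∣p∣ (K₁ ─ X)) (trans (cong₂ _∸_ n≡ (∣L─X∣ (q⊆p∪q F₁ X) ∣X∣ (∣F∪X∣ f₁ X⊈F₁)))
            (trans (cong (_∸ suc r) (lem′ t r x)) (trans (m+n∸m≡n (suc r) (t + 1 + x)) (cong (_+ x) (sym (∣X∪⁅y⁆∣ ∣X∣ y∉X))))))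
            where
            lem′ : ∀ t r x → t + suc (suc (r + x)) ≡ suc r + (t + 1 + x)
            lem′ = solve-∀
          through : card (interval? k (X ∪ ⁅ y ⁆) V) ≡ N₁′
          through = subst (λ k → card (interval? k (X ∪ ⁅ y ⁆) V) ≡ N₁′) (trans (cong (_+ suc r′) (∣X∪⁅y⁆∣ ∣X∣ y∉X))
              (trans (+-assoc t 1 (suc r′)) (sym k≡)))
            (card-interval {c = suc r′} (X ∪ ⁅ y ⁆) V Xy⊆V ∣V∣)
          disjoint : card 𝓖ˣ? + N₁′ ≤ S
          disjoint = subst (λ u → card 𝓖ˣ? + u ≤ S) through (length-filter-disjoint (star? k X K₀) 𝓖ˣ? (interval? k (X ∪ ⁅ y ⁆) V)
            (λ { (g , X⊆G) → ∈-star f₀ X⊈F₀ g X⊆G })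
            (λ { (e , h , _) → e , (λ m → h (p⊆p∪q ⁅ y ⁆ m)) , y , x∈p∩q⁺ (h (q⊆p∪q X ⁅ y ⁆ (x∈⁅x⁆ y)) , x∈p∧x∉q⇒x∈p─q y∈K₀ y∉X) })
            (λ { {G} (g , X⊆G) (_ , _ , G⊆V) → let (z , z∈F , z∈G , z∉X) = meets f₁ X⊈F₁ g in
              x∈∁p⇒x∉p (G⊆V z∈G) (x∈p∧x∉q⇒x∈p─q (p⊆p∪q X z∈F) z∉X) })
            (allSubsets n))

        -- The `r + 1` points of `F₀ ─ X` generate all members of `𝓖` through `X`, so
        -- `(r + 1) N₁ + E` must reach the size of `𝓐`. This controls `t` by `r`.
        t-r-bound : ∀ {F₀} → 𝓕 F₀ → ¬ (X ⊆ F₀) → 24 * t + 23 ≤ 30 * r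
        t-r-bound {F₀} f₀ X⊈F₀ = M≤RN⇒ (M≤ ≼-mono
            (≤-reflexive (cong (_* N₁) (trans (length-elements (K ─ X)) (∣L─X∣ (q⊆p∪q F₀ X) ∣X∣ (∣F∪X∣ f₀ X⊈F₀)))))
          (≼-branch (elements (K ─ X)) (λ y G → X ∪ ⁅ y ⁆ ⊆ G) (λ _ → branch)
            (All.map (λ {y} y∈ → ≼-supersets (X ∪ ⁅ y ⁆) (∣X∪⁅y⁆∣ ∣X∣ (x∈p─q⇒x∉q K X y∈)) id) (elements⊆ (K ─ X)))) +E)
          where
          K = F₀ ∪ X
          branch : ∀ {G} → 𝓖 G × X ⊆ G → Any (λ y → X ∪ ⁅ y ⁆ ⊆ G) (elements (K ─ X))
          branch {G} (g , X⊆G) with meets f₀ X⊈F₀ g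
          ... | y , y∈F , y∈G , y∉X = lose (∈⇒∈-elements (x∈p∧x∉q⇒x∈p─q (p⊆p∪q X y∈F) y∉X)) (λ {z} → ∪-least X⊆G (⁅⁆⊆ y∈G) {z})

        module _ (c : ℕ) (2c≤r : 2 * c ≤ r) where

          -- Otherwise at most `c + 1` points would generate all members of `𝓖` through `X`, too few
          -- for `M` when `2 c ≤ r`.
          avoiding : ∀ {R} → ∣ R ─ X ∣ ≤ suc c → ∃[ G ] (𝓖 G × X ⊆ G × (∀ {y} → y ∈ G → y ∉ X → y ∉ R))
          avoiding {R} h with any? (λ G → (X ⊆? G) ×-dec ¬? (nonempty? (G ∩ (R ─ X)))) (members 𝓖?)
          ... | yes a with find a
          ...   | G , G∈ , X⊆G , e = G , proj₂ (∈-filter⁻ 𝓖? {xs = allSubsets n} G∈) , X⊆G ,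
            λ y∈G y∉X y∈R → e (_ , x∈p∩q⁺ (y∈G , x∈p∧x∉q⇒x∈p─q y∈R y∉X))
          avoiding {R} h | no ¬a = ⊥-elim (¬M≤[c+1]N c (s≤s (s≤s z≤n)) 2c≤r
              (M≤ ≼-mono (*-monoˡ-≤ N₁ (≤-trans (≤-reflexive (length-elements (R ─ X))) h))
            (≼-branch (elements (R ─ X)) (λ y G → X ∪ ⁅ y ⁆ ⊆ G) (λ _ → branch)
              (All.map (λ {y} y∈ → ≼-supersets (X ∪ ⁅ y ⁆) (∣X∪⁅y⁆∣ ∣X∣ (x∈p─q⇒x∉q R X y∈)) id) (elements⊆ (R ─ X)))) +E))
            where
            branch : ∀ {G} → 𝓖 G × X ⊆ G → Any (λ y → X ∪ ⁅ y ⁆ ⊆ G) (elements (R ─ X))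
            branch {G} (g , X⊆G) with nonempty? (G ∩ (R ─ X))
            ... | no ¬e = ⊥-elim (¬a (lose (∈-filter⁺ 𝓖? (∈-allSubsets G) g) (X⊆G , ¬e)))
            ... | yes (y , m) = let (y∈G , y∈) = x∈p∩q⁻ G (R ─ X) m in lose (∈⇒∈-elements y∈) (λ {z} → ∪-least X⊆G (⁅⁆⊆ y∈G) {z})

          Missing : Fin n → Subset n → Family n
          Missing z R F = 𝓕 F × z ∉ F × R ⊆ F

          -- Every such `F` meets each `G` through `X` outside `X`. While `R` is small, `avoiding`
          -- supplies a `G` disjoint from `R` outside `X`, so its `r` points there are genuinely new
          -- and each choice enlarges `R`. From the (t - 1)-set `X - z` it takes `c + 2` choices to
          -- reach size `t + suc c`.
          Missing-≼ : ∀ {z} → z ∈ X → ∀ e R → X - z ⊆ R → z ∉ R → ∣ R ∣ + e ≡ t + suc c → Missing z R ≼ r ^ e * N (t + suc c)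
          Missing-≼ z∈X zero R _ _ ∣R∣ = ≼-mono (≤-reflexive (sym (*-identityˡ _)))
            (≼-supersets R (trans (sym (+-identityʳ _)) ∣R∣) (λ q → proj₂ (proj₂ q)))
          Missing-≼ {z} z∈X (suc e) R X-z⊆R z∉R ∣R∣ with avoiding {R} few
            where
            few : ∣ R ─ X ∣ ≤ suc c
            few = +-cancelʳ-≤ ∣ X - z ∣ _ _ (begin
              ∣ R ─ X ∣ + ∣ X - z ∣      ≤⟨ +-monoʳ-≤ ∣ R ─ X ∣ (p⊆q⇒∣p∣≤∣q∣ λ m → x∈p∩q⁺ (X-z⊆R m , p─q⊆p X ⁅ z ⁆ m)) ⟩
              ∣ R ─ X ∣ + ∣ R ∩ X ∣      ≡⟨ ∣p─q∣+∣p∩q∣≡∣p∣ R X ⟩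
              ∣ R ∣                      ≤⟨ m≤m+n ∣ R ∣ e ⟩
              ∣ R ∣ + e                  ≡⟨ suc-injective (trans (sym (+-suc ∣ R ∣ e)) (trans ∣R∣ (+-suc t c))) ⟩
              t + c                      ≡⟨ cong (_+ c) (trans (sym ∣X∣) (sym (suc∣p-x∣ z∈X))) ⟩
              suc ∣ X - z ∣ + c          ≡⟨ lem ∣ X - z ∣ c ⟩
              suc c + ∣ X - z ∣          ∎)
              where
              open ≤-Reasoning
              lem : ∀ a c → suc a + c ≡ suc c + a
              lem = solve-∀
          ... | G , g , X⊆G , fresh = ≼-mono (≤-reflexive (trans (cong (_* (r ^ e * N (t + suc c))) len)
              (sym (*-assoc r (r ^ e) (N (t + suc c))))))
            (≼-branch (elements (G ─ X)) (λ y → Missing z (R ∪ ⁅ y ⁆)) (λ _ → branch) (All.map next (elements⊆ (G ─ X))))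
            where
            len : length (elements (G ─ X)) ≡ r
            len = trans (length-elements (G ─ X)) (∣L─X∣ X⊆G ∣X∣ (trans (𝓖⊆ g) k≡))
            branch : ∀ {F} → Missing z R F → Any (λ y → Missing z (R ∪ ⁅ y ⁆) F) (elements (G ─ X))
            branch {F} (f , z∉F , R⊆F) with meets f (λ X⊆F → z∉F (X⊆F z∈X)) g
            ... | y , y∈F , y∈G , y∉X = lose (∈⇒∈-elements (x∈p∧x∉q⇒x∈p─q y∈G y∉X)) (f , z∉F , ∪-least R⊆F (⁅⁆⊆ y∈F))
            next : ∀ {y} → y ∈ G ─ X → Missing z (R ∪ ⁅ y ⁆) ≼ r ^ e * N (t + suc c)
            next {y} y∈ with x∈p─q⁻ G X y∈
            ... | y∈G , y∉X = Missing-≼ z∈X e (R ∪ ⁅ y ⁆) (p⊆p∪q ⁅ y ⁆ ∘ X-z⊆R) z∉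
              (trans (cong (_+ e) (∣p∪⁅x⁆∣ (fresh y∈G y∉X))) (trans (sym (+-suc ∣ R ∣ e)) ∣R∣))
              where
              z∉ : z ∉ R ∪ ⁅ y ⁆
              z∉ m with x∈p∪q⁻ R ⁅ y ⁆ m
              ... | inj₁ z∈R = z∉R z∈R
              ... | inj₂ z∈y = y∉X (subst (_∈ X) (x∈⁅y⁆⇒x≡y y z∈y) z∈X)

          𝓕′-≼ : (λ F → 𝓕 F × ¬ (X ⊆ F)) ≼ t * (r ^ (c + 2) * N (t + suc c))
          𝓕′-≼ = ≼-mono (≤-reflexive (cong (_* (r ^ (c + 2) * N (t + suc c))) (trans (length-elements X) ∣X∣)))
            (≼-branch (elements X) (λ z → Missing z (X - z)) (λ _ → branch)
              (All.map (λ {z} z∈ → Missing-≼ z∈ (c + 2) (X - z) id (∉- X z) (trans (lem ∣ X - z ∣ c)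
                  (cong (_+ suc c) (trans (suc∣p-x∣ z∈) ∣X∣)))) (elements⊆ X)))
            where
            lem : ∀ a c → a + (c + 2) ≡ suc a + suc c
            lem = solve-∀
            branch : ∀ {F} → 𝓕 F × ¬ (X ⊆ F) → Any (λ z → Missing z (X - z) F) (elements X)
            branch {F} (f , X⊈F) with ⊈⇒∃ X F X⊈F
            ... | z , z∈X , z∉F = lose (∈⇒∈-elements z∈X) (f , z∉F , p∩q⊆p F X ∘ p⊆q∧∣q∣≤∣p∣⇒q⊆p sub
              (s≤s⁻¹ (≤-reflexive (trans (suc∣p-x∣ z∈X) (trans ∣X∣ (sym (one-missing f X⊈F)))))))
              where
              sub : F ∩ X ⊆ X - z
              sub m = let (m₁ , m₂) = x∈p∩q⁻ F X m in x∈p∧x≢y⇒x∈p-y m₂ λ { refl → z∉F m₁ }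

          -- The exceptional members number at most `t * r ^ (c + 2)` times `N (t + suc c)`, and
          -- `N-decay` bounds the latter by `N₁ / w ^ c`; `power-bound` puts the product below
          -- `4 N₁ / 5`.
          𝓕′-small-from : ∀ {F₀} → 𝓕 F₀ → ¬ (X ⊆ F₀) → r ≤ suc (2 * c) → suc c ≤ r → ¬ (N₁′ ≤ card 𝓕′?)
          𝓕′-small-from f₀ X⊈F₀ r≤ c<r h = too-small {w ^ c} {r ^ (c + 2)} {t} 0<N₁
            (power-bound c 2≤t w-t (≤-trans (*-monoʳ-≤ 5 (m≤n+m r t)) w-k) (t-r-bound f₀ X⊈F₀) 2c≤r r≤)
            4N₁≤5N₁′ (≤-trans h (card≤ 𝓕′? (𝓕⊆ ∘ proj₁) 𝓕′-≼)) (N-decay c c<r)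

        𝓕′-small : ∀ {F₀} → 𝓕 F₀ → ¬ (X ⊆ F₀) → ¬ (N₁′ ≤ card 𝓕′?)
        -- `⌊ r /2⌋` is the largest `c` with `2 * c ≤ r`, as `avoiding` demands, and it satisfies
        -- the lower bound `r ≤ suc (2 * c)` of `power-bound`.
        𝓕′-small f₀ X⊈F₀ = 𝓕′-small-from ⌊ r /2⌋ (proj₁ (halves r)) f₀ X⊈F₀ (proj₂ (halves r)) (s≤s (s≤s (⌊n/2⌋≤n r′)))

        ⊆𝓗 : ∀ {K L} → ∣ K ∣ ≡ t + suc r → (∀ {F} → 𝓕 F → ¬ (X ⊆ F) → F ∪ X ≡ K) →
            (∀ {F} → 𝓕 F → X ⊆ F → Star k X L F) → 𝓕 ⊆ᶠ 𝓗 k X K L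
        ⊆𝓗 {K} {L} ∣K∣ union star {F} f with X ⊆? F
        ... | yes X⊆F = inj₁ (star f X⊆F)
        ... | no X⊈F with ⊈⇒∃ X F X⊈F
        ...   | z , z∈X , z∉F = inj₂ (z , z∈X , p⊆q∧∣q∣≤∣p∣⇒p≡q F⊆K-z (≤-reflexive (suc-injective
          (trans (suc∣p-x∣ (F∪X⊆K (q⊆p∪q F X z∈X))) (trans ∣K∣ (trans (+-suc t r) (cong suc (trans (sym k≡) (sym (𝓕⊆ f))))))))))
          where
          F∪X⊆K : F ∪ X ⊆ K
          F∪X⊆K = ⊆-reflexive (union f X⊈F)
          F⊆K-z : F ⊆ K - z
          F⊆K-z m = x∈p∧x≢y⇒x∈p-y (F∪X⊆K (p⊆p∪q X m)) λ { refl → z∉F m }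

    -- Both sides together: identifying the two families

    module TwoSided {𝓕 𝓖 : Family n} (𝓕? : Decidable 𝓕) (𝓖? : Decidable 𝓖) (𝓕⊆ : 𝓕 ⊆ᶠ Uniform n k) (𝓖⊆ : 𝓖 ⊆ᶠ Uniform n k)
      (cross : CrossIntersecting t 𝓕 𝓖) (M≤𝓕 : M ≤ card 𝓕?) (M≤𝓖 : M ≤ card 𝓖?) where

      cross′ : CrossIntersecting t 𝓖 𝓕
      cross′ {G} {F} g f = ≤-trans (cross f g) (≤-reflexive (∩-comm-∣∣ F G))

      module 𝓕-side = OneSide 𝓕? 𝓖? 𝓕⊆ 𝓖⊆ cross M≤𝓖
      module 𝓖-side = OneSide 𝓖? 𝓕? 𝓖⊆ 𝓕⊆ cross′ M≤𝓕

      IsStar IsClique : Set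
      IsStar = ∃[ X ] ∃[ K ] ∃[ L ]
        (Uniform n t X × Uniform n (k + 1) K × Uniform n (k + 1) L
        × X ⊆ K ∩ L × t + 2 ≤ ∣ K ∩ L ∣
        × 𝓕 ≐ 𝓗 k X K L × 𝓖 ≐ 𝓗 k X L K)
      IsClique = ∃[ Z ] (Uniform n (t + 2) Z × 𝓕 ≐ 𝓐 k t Z × 𝓖 ≐ 𝓐 k t Z)

      Exceptional : Subset n → Family n → Set
      Exceptional X 𝓔 = ∃[ F ] (𝓔 F × ¬ (X ⊆ F))

      exceptional : ∀ {𝓔} → Decidable 𝓔 → ∀ X → ¬ (∀ {F} → 𝓔 F → X ⊆ F) → Exceptional X 𝓔
      exceptional {𝓔} 𝓔? X ¬all with any? (λ F → ¬? (X ⊆? F)) (members 𝓔?)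
      ... | yes a with find a
      ...   | F , F∈ , X⊈F = F , proj₂ (∈-filter⁻ 𝓔? {xs = allSubsets n} F∈) , X⊈F
      exceptional {𝓔} 𝓔? X ¬all | no ¬a = ⊥-elim (¬all λ {F} e → decidable-stable (X ⊆? F) λ X⊈F →
        ¬a (lose (∈-filter⁺ 𝓔? (∈-allSubsets F) e) X⊈F))

      clique-case : ∀ {Z} → ∣ Z ∣ ≡ t + 2 → (λ F → 𝓕 F × ¬ 𝓐 k t Z F) ≼ E → (λ G → 𝓖 G × ¬ 𝓐 k t Z G) ≼ E → IsClique
      clique-case {Z} ∣Z∣ rest𝓕 rest𝓖 = Z , ∣Z∣ ,
        (𝓕⊆𝓐 , card-mono⁻¹ 𝓕? (𝓐? k t Z) 𝓕⊆𝓐 (≤-trans (𝓐≤M ∣Z∣) M≤𝓕)) ,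
        (𝓖⊆𝓐 , card-mono⁻¹ 𝓖? (𝓐? k t Z) 𝓖⊆𝓐 (≤-trans (𝓐≤M ∣Z∣) M≤𝓖))
        where
        𝓕⊆𝓐 = 𝓕-side.⊆𝓐 ∣Z∣ rest𝓖
        𝓖⊆𝓐 = 𝓖-side.⊆𝓐 ∣Z∣ rest𝓕

      star-case : ∀ {X} → ∣ X ∣ ≡ t → (λ F → 𝓕 F × ¬ (X ⊆ F)) ≼ E → (λ G → 𝓖 G × ¬ (X ⊆ G)) ≼ E →
        Exceptional X 𝓕 ⊎ Exceptional X 𝓖 → IsStar
      star-case {X} ∣X∣ rest𝓕 rest𝓖 nontrivial = from both
        where
        module 𝓕ˢ = 𝓕-side.AtStar ∣X∣ rest𝓖
        module 𝓖ˢ = 𝓖-side.AtStar ∣X∣ rest𝓕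

        both : Exceptional X 𝓕 × Exceptional X 𝓖
        both = [ (λ e@(_ , f , h) → e , exceptional 𝓖? X (𝓕ˢ.¬all⊇X f h))
               , (λ e@(_ , g , h) → exceptional 𝓕? X (𝓖ˢ.¬all⊇X g h) , e) ]′ nontrivial

        from : Exceptional X 𝓕 × Exceptional X 𝓖 → IsStar
        from ((F₀ , f₀ , X⊈F₀) , (G₀ , g₀ , X⊈G₀)) =
          X , K , L , ∣X∣ , trans ∣K∣ t+suc-r≡ , trans ∣L∣ t+suc-r≡ , X⊆K∩L , t+2≤ , (𝓕⊆𝓗 , 𝓗⊆𝓕) , (𝓖⊆𝓗 , 𝓗⊆𝓖)
          where
          K L : Subset n
          K = F₀ ∪ X
          L = G₀ ∪ X
          X⊆K : X ⊆ K
          X⊆K = q⊆p∪q F₀ X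
          X⊆L : X ⊆ L
          X⊆L = q⊆p∪q G₀ X
          X⊆K∩L : X ⊆ K ∩ L
          X⊆K∩L m = x∈p∩q⁺ (X⊆K m , X⊆L m)
          ∣K∣ : ∣ K ∣ ≡ t + suc r
          ∣K∣ = 𝓕ˢ.∣F∪X∣ f₀ X⊈F₀
          ∣L∣ : ∣ L ∣ ≡ t + suc r
          ∣L∣ = 𝓖ˢ.∣F∪X∣ g₀ X⊈G₀
          t+suc-r≡ : t + suc r ≡ k + 1
          t+suc-r≡ = trans (+-suc t r) (trans (+-comm 1 (t + r)) (cong (_+ 1) (sym k≡)))
          union𝓕 : ∀ {F} → 𝓕 F → ¬ (X ⊆ F) → F ∪ X ≡ K
          union𝓕 {F} f X⊈F = decidable-stable (≡-dec _≟ᵇ_ (F ∪ X) K) λ ne →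
            -- Two unions on the side of `𝓕` make the exceptional part of `𝓖` large, while that part
            -- is small by the argument with the families exchanged.
            𝓖ˢ.𝓕′-small g₀ X⊈G₀ (𝓕ˢ.two-unions f X⊈F f₀ X⊈F₀ ne)
          union𝓖 : ∀ {G} → 𝓖 G → ¬ (X ⊆ G) → G ∪ X ≡ L
          union𝓖 {G} g X⊈G = decidable-stable (≡-dec _≟ᵇ_ (G ∪ X) L) λ ne →
            𝓕ˢ.𝓕′-small f₀ X⊈F₀ (𝓖ˢ.two-unions g X⊈G g₀ X⊈G₀ ne)
          𝓗≤M : ∀ {K L} → X ⊆ K → X ⊆ L → ∣ L ∣ ≡ t + suc r → card (𝓗? k X K L) ≤ M
          𝓗≤M {K} {L} X⊆K X⊆L ∣L∣ = ≤-trans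
              (≤-reflexive (trans (card-𝓗 {k = k} X K L X⊆K) (cong (card (star? k X L) +_) ∣X∣))) (star≤M X⊆L ∣X∣ ∣L∣)
          𝓕⊆𝓗 : 𝓕 ⊆ᶠ 𝓗 k X K L
          𝓕⊆𝓗 = 𝓕ˢ.⊆𝓗 ∣K∣ union𝓕 λ f X⊆F → 𝓖ˢ.∈-star g₀ X⊈G₀ f X⊆F
          𝓖⊆𝓗 : 𝓖 ⊆ᶠ 𝓗 k X L K
          𝓖⊆𝓗 = 𝓖ˢ.⊆𝓗 ∣L∣ union𝓖 λ g X⊆G → 𝓕ˢ.∈-star f₀ X⊈F₀ g X⊆G
          𝓗⊆𝓕 : 𝓗 k X K L ⊆ᶠ 𝓕
          𝓗⊆𝓕 = card-mono⁻¹ 𝓕? (𝓗? k X K L) 𝓕⊆𝓗 (≤-trans (𝓗≤M X⊆K X⊆L ∣L∣) M≤𝓕)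
          𝓗⊆𝓖 : 𝓗 k X L K ⊆ᶠ 𝓖
          𝓗⊆𝓖 = card-mono⁻¹ 𝓖? (𝓗? k X L K) 𝓖⊆𝓗 (≤-trans (𝓗≤M X⊆L X⊆K ∣K∣) M≤𝓖)
          t+2≤ : t + 2 ≤ ∣ K ∩ L ∣
          -- Since `t ≥ 2`, there are distinct `a` and `b` in `X`. The deletions `K - a` and `L - b`
          -- are members, and their intersection lacks both points of `K ∩ L`.
          t+2≤ with ∣p∣>0⇒nonempty X (≤-trans (s≤s z≤n) (≤-reflexive (sym ∣X∣)))
          ... | a , a∈X with ∣p∣>0⇒nonempty (X - a) (s≤s⁻¹ (≤-trans 2≤t (≤-reflexive (trans (sym ∣X∣) (sym (suc∣p-x∣ a∈X))))))
          ...   | b , b∈X-a = begin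
            t + 2                                ≡⟨ +-comm t 2 ⟩
            suc (suc t)                          ≤⟨ s≤s (s≤s (cross (𝓗⊆𝓕 (inj₂ (a , a∈X , refl))) (𝓗⊆𝓖 (inj₂ (b , b∈X , refl))))) ⟩
            suc (suc ∣ (K - a) ∩ (L - b) ∣)      ≤⟨ s≤s (s≤s (p⊆q⇒∣p∣≤∣q∣ sub)) ⟩
            suc (suc ∣ (K ∩ L - a) - b ∣)        ≡⟨ cong suc (suc∣p-x∣ (x∈p∧x∉q⇒x∈p─q (X⊆K∩L b∈X) b∉a)) ⟩
            suc ∣ K ∩ L - a ∣                    ≡⟨ suc∣p-x∣ (X⊆K∩L a∈X) ⟩
            ∣ K ∩ L ∣                            ∎
            where
            open ≤-Reasoning
            b∈X = proj₁ (x∈p─q⁻ X ⁅ a ⁆ b∈X-a)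
            b∉a = proj₂ (x∈p─q⁻ X ⁅ a ⁆ b∈X-a)
            sub : (K - a) ∩ (L - b) ⊆ (K ∩ L - a) - b
            sub m with x∈p∩q⁻ (K - a) (L - b) m
            ... | m₁ , m₂ with x∈p─q⁻ K ⁅ a ⁆ m₁ | x∈p─q⁻ L ⁅ b ⁆ m₂
            ...   | m₃ , m₄ | m₅ , m₆ = x∈p∧x∉q⇒x∈p─q (x∈p∧x∉q⇒x∈p─q (x∈p∩q⁺ (m₃ , m₅)) m₄) m₆

      open Structure n k t

      star-or-clique-families : (∀ {X} → ∣ X ∣ ≡ t → Exceptional X 𝓕 ⊎ Exceptional X 𝓖) → IsStar ⊎ IsClique
      star-or-clique-families nontrivial = from (star-or-clique sizeˢ sizeᵗ cross-lists (rich 𝓕? 𝓕⊆ M≤𝓕 restˢ)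
          (rich 𝓖? 𝓖⊆ M≤𝓖 restᵗ))
        where
        -- Peeling ends at level 1, with generators of at most `t + 1` points; the levels `2` to `r`
        -- removed on the way add up to `E`.
        open Peeled (peel 𝓕? 𝓖? (s≤s z≤n) 𝓕⊆ 𝓖⊆ cross (suc r′) 1 k≡) renaming (cross to cross-lists)

        rich : ∀ {𝓔 : Family n} {𝓢} (𝓔? : Decidable 𝓔) → 𝓔 ⊆ᶠ Uniform n k → M ≤ card 𝓔? → (λ F → 𝓔 F × ¬ Any (_⊆ F) 𝓢) ≼ E → Rich 𝓢
        rich {𝓔} {𝓢} 𝓔? 𝓔⊆ M≤ rest p = ¬M≤3N (≤-trans M≤ (card≤ 𝓔? 𝓔⊆ (≼-∪ (λ _ → split) p rest)))
          where
          split : ∀ {F} → 𝓔 F → Generated 𝓢 F ⊎ (𝓔 F × ¬ Any (_⊆ F) 𝓢)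
          split {F} e with any? (_⊆? F) 𝓢
          ... | yes a = inj₁ a
          ... | no ¬a = inj₂ (e , ¬a)

        outside-star : ∀ {𝓔 : Family n} {𝓢 X} → All (X ⊆_) 𝓢 → (λ F → 𝓔 F × ¬ Any (_⊆ F) 𝓢) ≼ E → (λ F → 𝓔 F × ¬ (X ⊆ F)) ≼ E
        outside-star {𝓔} {𝓢} {X} X⊆ = ≼-⊆ (λ _ (e , X⊈F) → e , λ g → X⊈F (through g))
          where
          through : ∀ {F} → Generated 𝓢 F → X ⊆ F
          through g with find g
          ... | A , A∈ , A⊆F = λ m → A⊆F (All.lookup X⊆ A∈ m)

        outside-clique : ∀ {𝓔 : Family n} {𝓢 Z} → 𝓔 ⊆ᶠ Uniform n k → Exact 𝓢 → All (_⊆ Z) 𝓢 → (λ F → 𝓔 F × ¬ Any (_⊆ F) 𝓢) ≼ E →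
          (λ F → 𝓔 F × ¬ 𝓐 k t Z F) ≼ E
        outside-clique {𝓔} {𝓢} {Z} 𝓔⊆ exact ⊆Z = ≼-⊆ (λ _ (e , ∉𝓐) → e , λ g → ∉𝓐 (𝓔⊆ e , through g))
          where
          through : ∀ {F} → Generated 𝓢 F → t + 1 ≤ ∣ F ∩ Z ∣
          through {F} g with find g
          ... | A , A∈ , A⊆F = ≤-trans (≤-reflexive (sym (All.lookup exact A∈))) (p⊆q⇒∣p∣≤∣q∣ λ m → x∈p∩q⁺
              (A⊆F m , All.lookup ⊆Z A∈ m))

        from : HasStar 𝓢 𝓣 ⊎ (Exact 𝓢 × Exact 𝓣 × HasClique 𝓢 𝓣) → IsStar ⊎ IsClique
        from (inj₁ (X , ∣X∣ , X⊆S , X⊆T)) = inj₁ (star-case ∣X∣ (outside-star X⊆S restˢ) (outside-star X⊆T restᵗ) (nontrivial ∣X∣))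
        from (inj₂ (eˢ , eᵗ , Z , ∣Z∣ , S⊆Z , T⊆Z)) = inj₂ (clique-case ∣Z∣ (outside-clique 𝓕⊆ eˢ S⊆Z restˢ)
            (outside-clique 𝓖⊆ eᵗ T⊆Z restᵗ))

-- From the rational threshold to natural numbers

toℚᵘ-fromℕ : ∀ m → ℚ.toℚᵘ (fromℕ m) ℚᵘ.≃ ℚᵘ.mkℚᵘ (ℤ.+ m) 0
toℚᵘ-fromℕ m = ℚ.toℚᵘ-fromℚᵘ (ℚᵘ.mkℚᵘ (ℤ.+ m) 0)

fromℕ-homo-+ : ∀ a b → fromℕ (a + b) ≡ fromℕ a ℚ.+ fromℕ b
fromℕ-homo-+ a b = ℚ.toℚᵘ-injective (ℚᵘ.≃-trans (toℚᵘ-fromℕ (a + b)) (ℚᵘ.≃-trans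
  (ℚᵘ.*≡* (cong (ℤ._* ℤ.+ 1) (cong₂ ℤ._+_ (sym (ℤ.*-identityʳ (ℤ.+ a))) (sym (ℤ.*-identityʳ (ℤ.+ b))))))
  (ℚᵘ.≃-trans (ℚᵘ.+-cong (ℚᵘ.≃-sym (toℚᵘ-fromℕ a)) (ℚᵘ.≃-sym (toℚᵘ-fromℕ b))) (ℚᵘ.≃-sym (ℚ.toℚᵘ-homo-+ (fromℕ a) (fromℕ b))))))

fromℕ-homo-* : ∀ a b → fromℕ (a * b) ≡ fromℕ a ℚ.* fromℕ b
fromℕ-homo-* a b = ℚ.toℚᵘ-injective (ℚᵘ.≃-trans (toℚᵘ-fromℕ (a * b)) (ℚᵘ.≃-trans
  (ℚᵘ.*≡* (cong (ℤ._* ℤ.+ 1) (ℤ.pos-* a b)))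
  (ℚᵘ.≃-trans (ℚᵘ.*-cong (ℚᵘ.≃-sym (toℚᵘ-fromℕ a)) (ℚᵘ.≃-sym (toℚᵘ-fromℕ b))) (ℚᵘ.≃-sym (ℚ.toℚᵘ-homo-* (fromℕ a) (fromℕ b))))))

fromℕ-cancel-≤ : ∀ {a b} → fromℕ a ℚ.≤ fromℕ b → a ≤ b
fromℕ-cancel-≤ {a} {b} h = ℤ.drop‿+≤+ (subst₂ ℤ._≤_ (ℤ.*-identityʳ (ℤ.+ a)) (ℤ.*-identityʳ (ℤ.+ b)) (ℚᵘ.drop-*≤*
  (ℚᵘ.≤-trans (ℚᵘ.≤-reflexive (ℚᵘ.≃-sym (toℚᵘ-fromℕ a))) (ℚᵘ.≤-trans (ℚ.toℚᵘ-mono-≤ h) (ℚᵘ.≤-reflexive (toℚᵘ-fromℕ b))))))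

-- e ≥ 1/0! + 1/1! + 1/2! = 5/2 suffices.
threshold⇒ : ∀ {n k t} → AboveThreshold n k t → t + (k ∸ t) * (30 * (t + 2)) ≤ n × t + (k ∸ t) * (5 * k) ≤ n
threshold⇒ {n} {k} {t} above = below (30 * (t + 2)) (ℚ.p≤p⊔q (fromℕ (30 * (t + 2))) e) ,
    below (5 * k) (ℚ.≤-trans (ℚ.≤-reflexive (fromℕ-homo-* 5 k)) (ℚ.p≤q⊔p (fromℕ (30 * (t + 2))) e))
  where
  e = fromℕ 2 ℚ.* ePartial 2 ℚ.* fromℕ k
  below : ∀ a → fromℕ a ℚ.≤ fromℕ (30 * (t + 2)) ℚ.⊔ e → t + (k ∸ t) * a ≤ n
  below a h = fromℕ-cancel-≤ (ℚ.≤-trans (ℚ.≤-reflexive (trans (fromℕ-homo-+ t ((k ∸ t) * a))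
      (cong (fromℕ t ℚ.+_) (fromℕ-homo-* (k ∸ t) a))))
    (ℚ.≤-trans (ℚ.+-monoʳ-≤ (fromℕ t) (ℚ.*-monoˡ-≤-nonNeg (fromℕ (k ∸ t)) {{ℚ.normalize-nonNeg (k ∸ t) 1}} h)) (above 2)))

-- Initial segments, and `M` as the maximum of the two sizes

∣initial∣ : ∀ {n i} → i ≤ n → ∣ initial n i ∣ ≡ i
∣initial∣ {zero}  {zero}  _       = refl
∣initial∣ {suc n} {zero}  _       = ∣initial∣ {n} z≤n
∣initial∣ {suc n} {suc i} (s≤s h) = cong suc (∣initial∣ h)

initial-mono : ∀ {n i j} → i ≤ j → initial n i ⊆ initial n j
initial-mono {zero}  {i}     {j}     _       = λ ()
initial-mono {suc n} {zero}  {zero}  _       = out⊆ (initial-mono {n} {0} {0} z≤n)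
initial-mono {suc n} {zero}  {suc j} _       = out⊆ (initial-mono {n} {0} {j} z≤n)
initial-mono {suc n} {suc i} {suc j} (s≤s h) = s⊆s (initial-mono h)

⊆⋂ : ∀ {X : Subset n} {xs} → All (X ⊆_) xs → X ⊆ ⋂ xs
⊆⋂ []       _ = ∈⊤
⊆⋂ (h ∷ hs) m = x∈p∩q⁺ (h m , ⊆⋂ hs m)

module Main (n k s r′ x w : ℕ)
  (k≡ : k ≡ suc (suc s) + suc (suc r′)) (n≡ : n ≡ suc (suc s) + suc (suc (suc (suc r′) + x)))
  (w-t : 30 * (suc (suc s) + 2) ≤ w) (w-k : 5 * (suc (suc s) + suc (suc r′)) ≤ w)
  (w-n : w * suc (suc r′) ≤ suc (suc (suc (suc r′) + x))) where

  open Extremal n k s r′ x w k≡ n≡ w-t w-k w-n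
  open Estimates n k t r′ x w k≡ n≡ 2≤t w-t w-k w-n using (r; N₁; star-size≥; nearly-size≥)

  M : ℕ
  M = ∣𝓐[ n , k , t ]∣ ⊔ ∣𝓗[ n , k , t ]∣

  star-count : ∀ {X L : Subset n} → X ⊆ L → ∣ X ∣ ≡ t → ∣ L ∣ ≡ t + suc r → card (star? k X L) + suc x C r ≡ (suc r + suc x) C r
  star-count {X} {L} X⊆L hX hL = subst (λ k → card (star? k X L) + suc x C r ≡ (suc r + suc x) C r) (sym k≡)
    (card-star X L X⊆L hX hL (trans n≡ (cong (λ u → t + suc u) (sym (+-suc r x)))))

  𝓐-count : ∀ {Z : Subset n} → ∣ Z ∣ ≡ t + 2 →
    card (𝓐? k t Z) + (r + x) C suc r′ ≡ (t + 2) * ((r + x) C suc r′) + suc (r + x) C suc r′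
  𝓐-count {Z} ∣Z∣ = card-𝓐 {t = t} {suc r′} {r + x} k Z ∣Z∣ (trans (cong suc k≡) (lem t r′)) (trans n≡ (lem′ t (r + x)))
    where
    lem : ∀ t r → suc (t + suc (suc r)) ≡ t + 2 + suc r
    lem = solve-∀
    lem′ : ∀ t b → t + suc (suc b) ≡ t + 2 + b
    lem′ = solve-∀

  t+suc-r≡ : k + 1 ≡ t + suc r
  t+suc-r≡ = trans (cong (_+ 1) k≡) (trans (+-assoc t r 1) (cong (t +_) (+-comm r 1)))

  ∣[t]∣ : ∣ initial n t ∣ ≡ t
  ∣[t]∣ = ∣initial∣ (≤-trans (m≤m+n t _) (≤-reflexive (sym n≡)))

  ∣[t+2]∣ : ∣ initial n (t + 2) ∣ ≡ t + 2
  ∣[t+2]∣ = ∣initial∣ (≤-trans (+-monoʳ-≤ t (s≤s (s≤s z≤n))) (≤-reflexive (sym n≡)))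

  ∣[k+1]∣ : ∣ initial n (k + 1) ∣ ≡ t + suc r
  ∣[k+1]∣ = trans (∣initial∣ (≤-trans (≤-reflexive t+suc-r≡)
      (≤-trans (+-monoʳ-≤ t (s≤s (≤-trans (m≤m+n r x) (n≤1+n _)))) (≤-reflexive (sym n≡))))) t+suc-r≡

  [t]⊆[k+1] : initial n t ⊆ initial n (k + 1)
  [t]⊆[k+1] = initial-mono (≤-trans (m≤m+n t (suc r)) (≤-reflexive (sym t+suc-r≡)))

  ∣𝓗∣≡ : ∣𝓗[ n , k , t ]∣ ≡ card (star? k (initial n t) (initial n (k + 1))) + t
  ∣𝓗∣≡ = trans (card-𝓗 {k = k} (initial n t) (initial n (k + 1)) (initial n (k + 1)) [t]⊆[k+1])
    (cong (card (star? k (initial n t) (initial n (k + 1))) +_) ∣[t]∣)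

  -- The size of a star depends only on `∣ X ∣` and `∣ L ∣`, so it is that of the standard one, and
  -- `t` deletions complete it to `𝓗(n,k,t)`.
  star≤M : ∀ {X L : Subset n} → X ⊆ L → ∣ X ∣ ≡ t → ∣ L ∣ ≡ t + suc r → card (star? k X L) + t ≤ M
  star≤M X⊆L hX hL = ≤-trans (≤-reflexive
      (trans (cong (_+ t) (+-cancelʳ-≡ _ _ _ (trans (star-count X⊆L hX hL) (sym (star-count [t]⊆[k+1] ∣[t]∣ ∣[k+1]∣)))))
    (sym ∣𝓗∣≡))) (m≤n⊔m ∣𝓐[ n , k , t ]∣ ∣𝓗[ n , k , t ]∣)

  𝓐≤M : ∀ {Z : Subset n} → ∣ Z ∣ ≡ t + 2 → card (𝓐? k t Z) ≤ M
  𝓐≤M {Z} ∣Z∣ = ≤-trans (≤-reflexive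
      (+-cancelʳ-≡ _ _ _ (trans (𝓐-count {Z} ∣Z∣) (sym (𝓐-count {initial n (t + 2)} ∣[t+2]∣)))))
      (m≤m⊔n ∣𝓐[ n , k , t ]∣ ∣𝓗[ n , k , t ]∣)

  M-𝓐 : 30 * (t + 2) * N₁ ≤ 30 * M + N₁
  M-𝓐 = ≤-trans (nearly-size≥ (𝓐-count {initial n (t + 2)} ∣[t+2]∣)) (+-monoˡ-≤ N₁ (*-monoʳ-≤ 30 (𝓐≤M {initial n (t + 2)} ∣[t+2]∣)))

  M-𝓗 : 4 * suc r * N₁ ≤ 5 * M
  M-𝓗 = ≤-trans (star-size≥ (star-count [t]⊆[k+1] ∣[t]∣ ∣[k+1]∣))
      (*-monoʳ-≤ 5 (≤-trans (m≤m+n _ t) (star≤M [t]⊆[k+1] ∣[t]∣ ∣[k+1]∣)))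

  open Bounded M M-𝓐 star≤M 𝓐≤M M-𝓗

  module _ {𝓕 𝓖 : Family n} (𝓕? : Decidable 𝓕) (𝓖? : Decidable 𝓖) (𝓕⊆ : 𝓕 ⊆ᶠ Uniform n k) (𝓖⊆ : 𝓖 ⊆ᶠ Uniform n k)
    (cross : CrossIntersecting t 𝓕 𝓖) (nontrivial : ∣ ⋂ᶠ (𝓕? ∪? 𝓖?) ∣ < t) where

    module _ (M≤𝓕 : M ≤ card 𝓕?) (M≤𝓖 : M ≤ card 𝓖?) where

      open TwoSided 𝓕? 𝓖? 𝓕⊆ 𝓖⊆ cross M≤𝓕 M≤𝓖

      extremal : IsStar ⊎ IsClique
      extremal = star-or-clique-families λ {X} ∣X∣ → separate (exceptional (𝓕? ∪? 𝓖?) X λ all →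
        <-irrefl refl (<-≤-trans nontrivial (≤-trans (≤-reflexive (sym ∣X∣))
          (p⊆q⇒∣p∣≤∣q∣ (⊆⋂ (All.map {Q = X ⊆_} (λ h → all h) (All.all-filter (𝓕? ∪? 𝓖?) (allSubsets n))))))))
        where
        separate : ∀ {X} → ∃[ F ] ((𝓕 F ⊎ 𝓖 F) × ¬ (X ⊆ F)) → Exceptional X 𝓕 ⊎ Exceptional X 𝓖
        separate (F , inj₁ f , h) = inj₁ (F , f , h)
        separate (F , inj₂ g , h) = inj₂ (F , g , h)

      extremal-size : IsStar ⊎ IsClique → card 𝓕? ≤ M
      extremal-size (inj₁ (X , K , L , hX , hK , hL , X⊆K∩L , _ , 𝓕≐ , _)) = ≤-trans (≤-reflexive
        (trans (card-cong 𝓕? (𝓗? k X K L) 𝓕≐) (trans (card-𝓗 {k = k} X K L (p∩q⊆p K L ∘ X⊆K∩L)) (cong (card (star? k X L) +_) hX))))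
        (star≤M (p∩q⊆q K L ∘ X⊆K∩L) hX (trans hL t+suc-r≡))
      extremal-size (inj₂ (Z , ∣Z∣ , 𝓕≐ , _)) = ≤-trans (≤-reflexive (card-cong 𝓕? (𝓐? k t Z) 𝓕≐)) (𝓐≤M {Z} ∣Z∣)

    -- If the minimum is at least `M`, the structure result applies, and the resulting form shows
    -- that `𝓕` has at most `M` members.
    min≤M : card 𝓕? ⊓ card 𝓖? ≤ M
    min≤M with ≤-total M (card 𝓕? ⊓ card 𝓖?)
    ... | inj₂ h = h
    ... | inj₁ h = ≤-trans (m⊓n≤m (card 𝓕?) (card 𝓖?)) (extremal-size M≤𝓕 M≤𝓖 (extremal M≤𝓕 M≤𝓖))
      where
      M≤𝓕 = ≤-trans h (m⊓n≤m (card 𝓕?) (card 𝓖?))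
      M≤𝓖 = ≤-trans h (m⊓n≤n (card 𝓕?) (card 𝓖?))

theorem1p5 : (n k t : ℕ) → t + 2 ≤ k → 4 ≤ t + 2 →
    (𝓕 𝓖 : Family n) (𝓕? : Decidable 𝓕) (𝓖? : Decidable 𝓖) →
    𝓕 ⊆ᶠ Uniform n k → 𝓖 ⊆ᶠ Uniform n k →
    CrossIntersecting t 𝓕 𝓖 →
    ∣ ⋂ᶠ (𝓕? ∪? 𝓖?) ∣ < t →
    AboveThreshold n k t →
    (card 𝓕? ⊓ card 𝓖? ≤ ∣𝓐[ n , k , t ]∣ ⊔ ∣𝓗[ n , k , t ]∣)
    × (card 𝓕? ⊓ card 𝓖? ≡ ∣𝓐[ n , k , t ]∣ ⊔ ∣𝓗[ n , k , t ]∣ →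
    (∃[ X ] ∃[ K ] ∃[ L ]
    (Uniform n t X × Uniform n (k + 1) K × Uniform n (k + 1) L
    × X ⊆ K ∩ L × t + 2 ≤ ∣ K ∩ L ∣
    × 𝓕 ≐ 𝓗 k X K L × 𝓖 ≐ 𝓗 k X L K))
    ⊎ (∃[ Z ] (Uniform n (t + 2) Z × 𝓕 ≐ 𝓐 k t Z × 𝓖 ≐ 𝓐 k t Z)))
theorem1p5 n k 0 _ (s≤s (s≤s ()))
theorem1p5 n k 1 _ (s≤s (s≤s (s≤s ())))
theorem1p5 n k t@(suc (suc s)) t+2≤k _ 𝓕 𝓖 𝓕? 𝓖? 𝓕⊆ 𝓖⊆ cross nontrivial above =
  min≤M 𝓕? 𝓖? 𝓕⊆ 𝓖⊆ cross nontrivial ,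
  λ e → extremal 𝓕? 𝓖? 𝓕⊆ 𝓖⊆ cross nontrivial
    (≤-trans (≤-reflexive (sym e)) (m⊓n≤m (card 𝓕?) (card 𝓖?)))
    (≤-trans (≤-reflexive (sym e)) (m⊓n≤n (card 𝓕?) (card 𝓖?)))
  where
  r′ w x : ℕ
  r′ = k ∸ (t + 2)
  -- An integer in place of the maximum in the threshold, by `2 e k ≥ 5 k`.
  w = 30 * (t + 2) ⊔ 5 * k
  k≡ : k ≡ t + suc (suc r′)
  k≡ = trans (sym (m+[n∸m]≡n t+2≤k)) (+-assoc t 2 r′)
  k∸t≡ : k ∸ t ≡ suc (suc r′)
  k∸t≡ = trans (cong (_∸ t) k≡) (m+n∸m≡n t (suc (suc r′)))
  t+rw≤n : t + (k ∸ t) * w ≤ n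
  t+rw≤n with ⊔-sel (30 * (t + 2)) (5 * k)
  ... | inj₁ e = ≤-trans (≤-reflexive (cong (λ u → t + (k ∸ t) * u) e)) (proj₁ (threshold⇒ {n} {k} {t} above))
  ... | inj₂ e = ≤-trans (≤-reflexive (cong (λ u → t + (k ∸ t) * u) e)) (proj₂ (threshold⇒ {n} {k} {t} above))
  wr≤ : w * suc (suc r′) ≤ n ∸ t
  wr≤ = ≤-trans (≤-reflexive (trans (*-comm w (suc (suc r′))) (cong (_* w) (sym k∸t≡))))
      (m+n≤o⇒m≤o∸n _ (≤-trans (≤-reflexive (+-comm _ t)) t+rw≤n))
  -- As `w ≥ 2`, `n - t` is at least `2 (k - t)`, hence at least `(k - t) + 2`; this makes the
  -- truncated subtraction defining `x` exact.
  4+r′≤ : suc (suc (suc (suc r′))) ≤ n ∸ t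
  4+r′≤ = ≤-trans (≤-trans (m≤m+n (suc (suc (suc (suc r′)))) r′) (≤-trans (≤-reflexive (lem r′))
    (*-monoˡ-≤ (suc (suc r′)) (≤-trans (m≤m+n 2 58) (≤-trans (*-monoʳ-≤ 30 (m≤n+m 2 t)) (m≤m⊔n (30 * (t + 2)) (5 * k))))))) wr≤
    where
    lem : ∀ r → suc (suc (suc (suc r))) + r ≡ 2 * suc (suc r)
    lem = solve-∀
  x = n ∸ t ∸ suc (suc (suc (suc r′)))
  m≡ : n ∸ t ≡ suc (suc (suc (suc r′) + x))
  m≡ = sym (m+[n∸m]≡n 4+r′≤)
  n≡ : n ≡ t + suc (suc (suc (suc r′) + x))
  n≡ = trans (sym (m+[n∸m]≡n (≤-trans (m≤m+n t _) t+rw≤n))) (cong (t +_) m≡)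
  open Main n k s r′ x w k≡ n≡ (m≤m⊔n (30 * (t + 2)) (5 * k)) (≤-trans (≤-reflexive (cong (5 *_) (sym k≡)))
      (m≤n⊔m (30 * (t + 2)) (5 * k)))
    (≤-trans wr≤ (≤-reflexive m≡))
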